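{- Let $G$ be a graph containing a spanning triangle-tree. Then $G$ has no nowhere-zero $3$-flow if and only if either $G$ is $K_4$, or $G$ is a bull-growing of some graph $G_1$ such that $G_1$ contains a spanning triangle-tree and $G_1$ has no nowhere-zero $3$-flow. In other words, $G$ has no nowhere-zero $3$-flow if and only if $G$ is formed from $K_4$ by a (possibly empty) series of bull-growing operations.
   Context: Graphs are finite, may contain parallel edges, but have no loops. Nowhere-zero $3$-flow: a pair $(D,f)$ where $D$ is an orientation of $G$ and $f:E(G)\to\{\pm1,\pm2\}$ satisfies $\sum_{e\in E_D^+(v)}f(e)=\sum_{e\in E_D^-(v)}f(e)$ for every vertex $v$, where $E_D^+(v)$, $E_D^-(v)$ are the sets of arcs leaving and entering $v$. Triangle-tree: a graph formed by starting with a triangle $x_1x_2x_3$ and then repeatedly (zero or more times) adding a new vertex $x_{j+1}$ joined to exactly two vertices $y,z$ that are adjacent in the graph already constructed (so $x_{j+1},y,z$ form a triangle). A spanning triangle-tree of $G$ is a subgraph of $G$ that is a triangle-tree and contains all vertices of $G$. Bull-reduction / bull-growing: let $u,v$ be two adjacent vertices of degree $3$ in a graph $G$ with a common neighbor $w$; let $a$ be the third neighbor of $u$ (other than $v,w$) and $b$ the third neighbor of $v$ (other than $u,w$); $a=b$ is allowed. Let $H=G-u-v+ab$, i.e. delete $u,v$ and add a new edge $ab$ (possibly parallel to existing edges), where if $a=b$ the resulting loop is deleted (so $H=G-u-v$). Then $H$ is called a bull-reduction of $G$, and $G$ is called a bull-growing of $H$. -}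

module Defs where

open import Algebra.Properties.CommutativeMonoid.Sum using (sum)
open import Data.Bool.Base using (if_then_else_)
open import Data.Fin.Base using (Fin; zero; suc)
open import Data.Fin.Patterns using (0F; 1F; 2F; 3F; 4F; 5F)
open import Data.Fin.Properties using (_≟_; suc-injective)
open import Data.Integer.Base using (ℤ; 0ℤ; 1ℤ; -1ℤ; +_; -[1+_])
import Data.Integer.Properties as ℤ
open import Data.List.Base using (_∷_; [])
open import Data.List.Membership.Propositional using (_∈_)
open import Data.Nat.Base using (ℕ; suc; _+_)
import Data.Nat.Properties as ℕ
open import Data.Product.Base using (_×_; _,_; ∃-syntax; proj₁; proj₂; map)
open import Data.Sum.Base using (_⊎_; inj₁; inj₂; [_,_])
open import Function.Base using (_∘_)
open import Function.Bundles using (_↔_; Inverse)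
open import Function.Definitions using (Injective; Bijective)
open import Relation.Binary.Construct.Closure.ReflexiveTransitive using (Star)
open import Relation.Binary.PropositionalEquality using (_≡_; _≢_; cong)
open import Relation.Nullary.Decidable using (Dec; _⊎-dec_; does)
open import Relation.Nullary.Negation using (¬_)

-- Parallel edges are distinct elements of E with the same endpoints.  The
-- order within a pair `ends e` carries no meaning: every notion below is
-- invariant under swapping it.
record Multigraph (V E : Set) : Set where
  field
    ends     : E → V × V
    loopless : ∀ e → proj₁ (ends e) ≢ proj₂ (ends e)

  Joins : E → V → V → Set
  Joins e x y = ends e ≡ (x , y) ⊎ ends e ≡ (y , x)

  Incident : E → V → Set
  Incident e x = proj₁ (ends e) ≡ x ⊎ proj₂ (ends e) ≡ x

  Adjacent : V → V → Set
  Adjacent x y = ∃[ e ] Joins e x y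

module _ {V E : Set} (G : Multigraph V E) where
  open Multigraph G

  VertexAvoiding EdgeAvoiding : V → V → Set
  VertexAvoiding u v = ∃[ x ] (x ≢ u × x ≢ v)
  EdgeAvoiding   u v = ∃[ e ] (¬ Incident e u × ¬ Incident e v)

  delete₂ : (u v : V) → Multigraph (VertexAvoiding u v) (EdgeAvoiding u v)
  delete₂ u v = record
    { ends     = λ { (e , e∌u , e∌v) →
                     (proj₁ (ends e) , e∌u ∘ inj₁ , e∌v ∘ inj₁) ,
                     (proj₂ (ends e) , e∌u ∘ inj₂ , e∌v ∘ inj₂) }
    ; loopless = λ { (e , _) → loopless e ∘ cong proj₁ }
    }

  -- The type a ≢ b has exactly one element if a and b differ, and none
  -- otherwise, so a new edge is added only when it is not a loop.
  addEdge : (a b : V) → Multigraph V (E ⊎ a ≢ b)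
  addEdge a b = record
    { ends     = [ ends , (λ _ → a , b) ]
    ; loopless = λ { (inj₁ e) → loopless e ; (inj₂ a≢b) → a≢b }
    }

record Graph : Set where
  field
    order size : ℕ
    multigraph : Multigraph (Fin order) (Fin size)

  Vertex Edge : Set
  Vertex = Fin order
  Edge   = Fin size

  open Multigraph multigraph public

  incident? : ∀ e x → Dec (Incident e x)
  incident? e x = (proj₁ (ends e) ≟ x) ⊎-dec (proj₂ (ends e) ≟ x)

  degree : Vertex → ℕ
  degree x = sum ℕ.+-0-commutativeMonoid
    (λ e → if does (incident? e x) then 1 else 0)

open Graph

module _ {V E V′ E′ : Set} where

  PreservesEnds : Multigraph V E → Multigraph V′ E′ → (V → V′) → (E → E′) → Set
  PreservesEnds G H φ ψ =
    ∀ e → H.Joins (ψ e) (φ (proj₁ (G.ends e))) (φ (proj₂ (G.ends e)))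
    where
    module G = Multigraph G
    module H = Multigraph H

  record Isomorphism (G : Multigraph V E) (H : Multigraph V′ E′) : Set where
    field
      vertices      : V ↔ V′
      edges         : E ↔ E′
      preservesEnds : PreservesEnds G H (Inverse.to vertices) (Inverse.to edges)

infix 4 _≅_

_≅_ : Graph → Graph → Set
G ≅ H = Isomorphism (multigraph G) (multigraph H)

K₃ : Graph
K₃ = record
  { order = 3 ; size = 3
  ; multigraph = record
    { ends     = λ { 0F → 0F , 1F ; 1F → 0F , 2F ; 2F → 1F , 2F }
    ; loopless = λ { 0F () ; 1F () ; 2F () }
    }
  }

K₄ : Graph
K₄ = record
  { order = 4 ; size = 6
  ; multigraph = record
    { ends     = λ { 0F → 0F , 1F ; 1F → 0F , 2F ; 2F → 0F , 3F
                   ; 3F → 1F , 2F ; 4F → 1F , 3F ; 5F → 2F , 3F }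
    ; loopless = λ { 0F () ; 1F () ; 2F () ; 3F () ; 4F () ; 5F () }
    }
  }

record Orientation (G : Graph) : Set where
  field
    tail head : Edge G → Vertex G
    orients   : ∀ e → Joins G e (tail e) (head e)

record NowhereZero3Flow (G : Graph) : Set where
  field
    orientation : Orientation G

  open Orientation orientation public

  field
    flow      : Edge G → ℤ
    values    : ∀ e → flow e ∈ 1ℤ ∷ -1ℤ ∷ + 2 ∷ -[1+ 1 ] ∷ []
    conserved : ∀ x →
      sum ℤ.+-0-commutativeMonoid (λ e → if does (tail e ≟ x) then flow e else 0ℤ) ≡
      sum ℤ.+-0-commutativeMonoid (λ e → if does (head e ≟ x) then flow e else 0ℤ)

-- The new vertex is 0F; edges 0F and 1F join it to the two ends of e.
attachTriangle : (T : Graph) → Edge T → Graph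
attachTriangle T e = record
  { order = suc (order T) ; size = 2 + size T
  ; multigraph = record
    { ends     = λ { zero          → zero , suc (proj₁ (ends T e))
                   ; (suc zero)    → zero , suc (proj₂ (ends T e))
                   ; (suc (suc d)) → map suc suc (ends T d) }
    ; loopless = λ { zero () ; (suc zero) ()
                   ; (suc (suc d)) → loopless T d ∘ suc-injective }
    }
  }

-- Triangle-trees up to isomorphism; the two adjacent vertices y, z are given
-- by an edge joining them.
data TriangleTree : Graph → Set where
  triangle : TriangleTree K₃
  attach   : ∀ {T} → TriangleTree T → (e : Edge T) → TriangleTree (attachTriangle T e)

record IsSpanningSubgraph (T G : Graph) : Set where
  field
    vertexMap       : Vertex T → Vertex G
    edgeMap         : Edge T → Edge G
    vertexBijective : Bijective _≡_ _≡_ vertexMap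
    edgeInjective   : Injective _≡_ _≡_ edgeMap
    preservesEnds   : PreservesEnds (multigraph T) (multigraph G) vertexMap edgeMap

HasSpanningTriangleTree : Graph → Set
HasSpanningTriangleTree G = ∃[ T ] TriangleTree T × IsSpanningSubgraph T G

infix 4 _IsBullReductionOf_ _IsBullGrowingOf_

record _IsBullReductionOf_ (H G : Graph) : Set where
  field
    u v w a b : Vertex G
    degree-u  : degree G u ≡ 3
    degree-v  : degree G v ≡ 3
    u~v       : Adjacent G u v
    u~w       : Adjacent G u w
    v~w       : Adjacent G v w
    u~a       : Adjacent G u a
    v~b       : Adjacent G v b
    a≢u       : a ≢ u
    a≢v       : a ≢ v
    a≢w       : a ≢ w
    b≢u       : b ≢ u
    b≢v       : b ≢ v
    b≢w       : b ≢ w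
    reduced   : Isomorphism (multigraph H)
                  (addEdge (delete₂ (multigraph G) u v) (a , a≢u , a≢v) (b , b≢u , b≢v))

_IsBullGrowingOf_ : Graph → Graph → Set
G IsBullGrowingOf H = H IsBullReductionOf G

-- K₄ is meant up to isomorphism, so a series may start from any copy of it.
FormedFromK₄ : Graph → Set
FormedFromK₄ G = ∃[ K ] K ≅ K₄ × Star _IsBullReductionOf_ K G

{-# OPTIONS --safe #-}
module Submission where

-- Modulo 3, a nowhere-zero 3-flow is a choice of signs for the edges under
-- which every boundary vanishes: an integral flow is recovered by repeatedly
-- moving three units of excess along a path of positively directed edges.
--
-- In a triangle-tree, a doubled edge carries an arbitrary value; then so does
-- each of its triangles, and every balanced boundary is attained.  A leaf x on
-- the edge yz with boundary 0 at x has the same effect as doubling yz.  Hence,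
-- if G has no flow, no choice of signs outside the tree may give boundary 0 at
-- a leaf, so every leaf has exactly one edge outside the tree, and that edge
-- does not end at y or z.
--
-- Peel leaves off the tree until a vertex q is reached that has leaves on its
-- two edges.  If two of these leaves are adjacent, they are the degree-3
-- vertices of a bull with common neighbour q.  Otherwise each leaf acts on q
-- as one signed vector, and two or more signs at q could be chosen so as to
-- give boundary 0 at q; so there is a single leaf, q has degree 3, and the
-- leaf and q form a bull.  If no such q is reached, all other vertices are
-- leaves on one edge and two of them are adjacent.  Finally, the five edges of
-- a bull act exactly as the new edge ab.

-- The vectors that receive signs are not always edges: a leaf cut off by equal signs on its three
-- edges leaves behind a vector with three nonzero entries, at its two tree neighbours and at the
-- far end of its third edge. Feasibility is therefore stated for arbitrary lists of vectors and an
-- arbitrary initial boundary, and lists are used up to permutation, so that any vectors can be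
-- brought forward and signed first. Two facts about residues drive everything. Two signs reach
-- every residue, so two vectors that are nonzero at a vertex can clear its boundary whatever it is;
-- a single one cannot leave a boundary 0 in place. Three equal signs add up to 0, so a vertex of
-- degree three with equal outward signs is invisible to the rest; the apex of a leaf and the two
-- degree-three vertices of a bull are instances. A bull is found together with a tree on all the
-- other vertices. That tree survives the reduction, which is why the reduction again has a spanning
-- triangle-tree; when it is a single edge, only four vertices exist and the graph is `K₄`.

open import Defs
import Algebra.Properties.CommutativeMonoid.Sum as FinSum
import Algebra.Solver.CommutativeMonoid as CommutativeMonoidSolver
open import Data.Bool.Base using (true; false; if_then_else_)
open import Data.Fin.Base using (Fin; zero; suc)
open import Data.Fin.Patterns using (0F; 1F; 2F; 3F; 4F; 5F)
open import Data.Fin.Properties using (_≟_; all?; any?)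
open import Data.Integer.Base as ℤ using (ℤ; 0ℤ; 1ℤ; -1ℤ; +_; -[1+_]; ∣_∣)
import Data.Integer.Properties as ℤ
open import Data.Integer.Tactic.RingSolver using (solve-∀)
open import Data.List.Base using (List; []; _∷_; _++_; map; length; tabulate; allFin; lookup; filter)
open import Data.List.Membership.Propositional using (_∈_; _∉_)
open import Data.List.Membership.Propositional.Properties
  using (∈-∃++; ∈-map⁺; ∈-map⁻; ∈-++⁺ˡ; ∈-++⁺ʳ; ∈-++⁻; ∈-allFin; ∈-lookup; ∈-filter⁺; ∈-tabulate⁺; ∈-tabulate⁻)
open import Data.List.Membership.Propositional.Properties.WithK using (unique∧set⇒bag)
open import Data.List.Properties
  using (map-++; map-∘; map-tabulate; length-++; length-map; length-tabulate; filter-accept; filter-reject; filter-none)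
open import Data.List.Relation.Binary.BagAndSetEquality using (∼bag⇒↭)
open import Data.List.Relation.Binary.Permutation.Propositional as ↭
  using (_↭_; ↭-refl; ↭-sym; ↭-trans; ↭-prep; ↭-swap; ↭-reflexive; ↭⇒↭ₛ)
open import Data.List.Relation.Binary.Permutation.Propositional.Properties
  using (shift; shifts; All-resp-↭; ∈-resp-↭; ++⁺ˡ; ++⁺ʳ; ++⁺; ++-comm; ++-assoc; ++-commutativeMonoid; map⁺; drop-∷; filter-↭; ↭-length)
import Data.List.Relation.Binary.Permutation.Setoid.Properties as ↭ₛ
open import Data.List.Relation.Binary.Pointwise as Pointwise using (Pointwise; []; _∷_)
open import Data.List.Relation.Unary.All as All using (All; []; _∷_)
import Data.List.Relation.Unary.All.Properties as All
open import Data.List.Relation.Unary.Any as Any using (here; there)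
open import Data.List.Relation.Unary.Any.Properties using (lookup-index)
open import Data.List.Relation.Unary.Unique.Propositional using (Unique; []; _∷_)
open import Data.List.Relation.Unary.Unique.Propositional.Properties
  using (Unique[x∷xs]⇒x∉xs; allFin⁺; tabulate⁺; drop⁺)
  renaming (map⁺ to Unique-map⁺; map⁻ to Unique-map⁻; ++⁺ to Unique-++⁺)
open import Data.Nat.Base as ℕ using (ℕ; zero; suc; _≤_; z≤n; s≤s)
open import Data.Nat.Induction using (<-wellFounded)
import Data.Nat.Properties as ℕ
open import Data.Product.Base using (_×_; _,_; ∃; ∃-syntax; proj₁; proj₂)
open import Data.Sum.Base as Sum using (_⊎_; inj₁; inj₂)
open import Data.Sum.Properties using (inj₁-injective)
open import Function.Base using (_∘_; id; case_of_)
open import Function.Bundles using (_⇔_; _↔_; Inverse; mk⇔; mk↔ₛ′)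
open import Function.Definitions using (Injective)
open import Induction.WellFounded using (Acc; acc)
open import Relation.Binary.Construct.Closure.ReflexiveTransitive using (Star; ε; _◅_; _◅◅_)
open import Relation.Binary.PropositionalEquality
open import Relation.Nullary.Decidable
  using (Dec; yes; no; does; from-yes; from-no; dec-true; dec-false; _⊎-dec_)
open import Relation.Nullary.Negation using (¬_; contradiction)

-- Lists and enumerations

module ↭-Solver {A : Set} where
  open CommutativeMonoidSolver (++-commutativeMonoid {A = A}) public
    using (solve; _⊜_) renaming (_⊕_ to _⊞_)

open ↭-Solver

Unique-↭ : ∀ {A : Set} {xs ys : List A} → xs ↭ ys → Unique xs → Unique ys
Unique-↭ {A} p = ↭ₛ.Unique-resp-↭ (setoid A) (↭⇒↭ₛ p)

∉⇒unique : ∀ {A : Set} {x : A} {xs} → x ∉ xs → Unique xs → Unique (x ∷ xs)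
∉⇒unique x∉ xs! = All.tabulate (λ { v∈ refl → x∉ v∈ }) ∷ xs!

Unique-++⁻ˡ : ∀ {A : Set} (xs : List A) {ys} → Unique (xs ++ ys) → Unique xs
Unique-++⁻ˡ []       _          = []
Unique-++⁻ˡ (x ∷ xs) (x≢ ∷ xs!) = All.++⁻ˡ xs x≢ ∷ Unique-++⁻ˡ xs xs!

Unique-++⁻ʳ : ∀ {A : Set} (xs : List A) {ys} → Unique (xs ++ ys) → Unique ys
Unique-++⁻ʳ []       ys!       = ys!
Unique-++⁻ʳ (_ ∷ xs) (_ ∷ ys!) = Unique-++⁻ʳ xs ys!

split : ∀ {A : Set} {P : A → Set} → (∀ x → Dec (P x)) → ∀ xs →
  ∃[ ys ] ∃[ zs ] xs ↭ ys ++ zs × All P ys × All (λ x → ¬ P x) zs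
split P? []       = [] , [] , ↭-refl , [] , []
split P? (x ∷ xs) with P? x | split P? xs
... | yes px | ys , zs , p , Pys , ¬Pzs = x ∷ ys , zs , ↭-prep x p , px ∷ Pys , ¬Pzs
... | no ¬px | ys , zs , p , Pys , ¬Pzs =
  ys , x ∷ zs , ↭-trans (↭-prep x p) (↭-sym (shift x ys zs)) , Pys , ¬px ∷ ¬Pzs

↔-injective : ∀ {A B : Set} (β : A ↔ B) {x y} → Inverse.to β x ≡ Inverse.to β y → x ≡ y
↔-injective β {x} {y} eq = trans (sym (Inverse.strictlyInverseʳ β x))
  (trans (cong (Inverse.from β) eq) (Inverse.strictlyInverseʳ β y))

module _ {A : Set} where

  unique-same-elements⇒↭ : ∀ {xs ys : List A} → Unique xs → Unique ys →
    (∀ {x} → x ∈ xs → x ∈ ys) → (∀ {x} → x ∈ ys → x ∈ xs) → xs ↭ ys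
  unique-same-elements⇒↭ xs! ys! ⊆ ⊇ = ∼bag⇒↭ (unique∧set⇒bag xs! ys! (mk⇔ ⊆ ⊇))

  unique-⊆⇒length≤ : ∀ {xs ys : List A} → Unique xs → (∀ {x} → x ∈ xs → x ∈ ys) → length xs ℕ.≤ length ys
  unique-⊆⇒length≤ {[]} _ _ = z≤n
  unique-⊆⇒length≤ {x ∷ xs} xs!@(_ ∷ xs!′) ⊆ with ∈-∃++ (⊆ (here refl))
  ... | ys , zs , refl = subst (suc (length xs) ℕ.≤_) (sym eq) (s≤s (unique-⊆⇒length≤ xs!′ ⊆′))
    where
    eq : length (ys ++ x ∷ zs) ≡ suc (length (ys ++ zs))
    eq = trans (length-++ ys) (trans (ℕ.+-suc _ _) (cong suc (sym (length-++ ys))))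
    ⊆′ : ∀ {y} → y ∈ xs → y ∈ ys ++ zs
    ⊆′ y∈ with ∈-++⁻ ys (⊆ (there y∈))
    ... | inj₁ y∈ys          = ∈-++⁺ˡ y∈ys
    ... | inj₂ (here refl)   = contradiction y∈ (Unique[x∷xs]⇒x∉xs xs!)
    ... | inj₂ (there y∈zs)  = ∈-++⁺ʳ ys y∈zs

  lookup-injective : ∀ {xs : List A} → Unique xs → ∀ i j → lookup xs i ≡ lookup xs j → i ≡ j
  lookup-injective {x ∷ xs} _         zero    zero    _  = refl
  lookup-injective {x ∷ xs} xs!       zero    (suc j) eq = contradiction (subst (_∈ xs) (sym eq) (∈-lookup j)) (Unique[x∷xs]⇒x∉xs xs!)
  lookup-injective {x ∷ xs} xs!       (suc i) zero    eq = contradiction (subst (_∈ xs) eq (∈-lookup i)) (Unique[x∷xs]⇒x∉xs xs!)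
  lookup-injective {x ∷ xs} (_ ∷ xs!) (suc i) (suc j) eq = cong suc (lookup-injective xs! i j eq)

  enumerate : ∀ {xs : List A} → Unique xs → (∀ x → x ∈ xs) → Fin (length xs) ↔ A
  enumerate {xs} xs! complete = mk↔ₛ′ (lookup xs) (Any.index ∘ complete)
    (λ x → sym (lookup-index (complete x)))
    (λ i → lookup-injective xs! _ i (sym (lookup-index (complete (lookup xs i)))))

  listing-unique : ∀ {k} (β : Fin k ↔ A) → Unique (map (Inverse.to β) (allFin k))
  listing-unique β = Unique-map⁺ (↔-injective β) (allFin⁺ _)

  listing-complete : ∀ {k} (β : Fin k ↔ A) → ∀ x → x ∈ map (Inverse.to β) (allFin k)
  listing-complete β x = subst (_∈ _) (Inverse.strictlyInverseˡ β x) (∈-map⁺ (Inverse.to β) (∈-allFin (Inverse.from β x)))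

  listing-↭ : ∀ {k} (β : Fin k ↔ A) {xs} → Unique xs → (∀ x → x ∈ xs) → map (Inverse.to β) (allFin k) ↭ xs
  listing-↭ β xs! complete = unique-same-elements⇒↭ (listing-unique β) xs! (λ _ → complete _) (λ _ → listing-complete β _)

-- Signed sums of vectors modulo 3

ℤ₃ : Set
ℤ₃ = Fin 3

infixl 6 _⊕_
infixl 7 _⊗_
infix  8 ⊝_

_⊕_ : ℤ₃ → ℤ₃ → ℤ₃
0F ⊕ b  = b
1F ⊕ 0F = 1F
1F ⊕ 1F = 2F
1F ⊕ 2F = 0F
2F ⊕ 0F = 2F
2F ⊕ 1F = 0F
2F ⊕ 2F = 1F

⊝_ : ℤ₃ → ℤ₃
⊝ 0F = 0F
⊝ 1F = 2F
⊝ 2F = 1F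

_⊗_ : ℤ₃ → ℤ₃ → ℤ₃
0F ⊗ b = 0F
1F ⊗ b = b
2F ⊗ b = ⊝ b

data Sign : Set where
  pos neg : Sign

⟦_⟧ : Sign → ℤ₃
⟦ pos ⟧ = 1F
⟦ neg ⟧ = 2F

opposite : Sign → Sign
opposite pos = neg
opposite neg = pos

⟦opposite⟧ : ∀ s → ⟦ opposite s ⟧ ≡ ⊝ ⟦ s ⟧
⟦opposite⟧ pos = refl
⟦opposite⟧ neg = refl

⊕-identityʳ : ∀ a → a ⊕ 0F ≡ a
⊕-identityʳ = from-yes (all? λ a → a ⊕ 0F ≟ a)

⊕-assoc : ∀ a b c → a ⊕ b ⊕ c ≡ a ⊕ (b ⊕ c)
⊕-assoc = from-yes (all? λ a → all? λ b → all? λ c → a ⊕ b ⊕ c ≟ a ⊕ (b ⊕ c))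

⊗-zeroʳ : ∀ a → a ⊗ 0F ≡ 0F
⊗-zeroʳ = from-yes (all? λ a → a ⊗ 0F ≟ 0F)

⊕-swapʳ : ∀ a b c → a ⊕ b ⊕ c ≡ a ⊕ c ⊕ b
⊕-swapʳ = from-yes (all? λ a → all? λ b → all? λ c → a ⊕ b ⊕ c ≟ a ⊕ c ⊕ b)

private variable
  I I′ : Set

-- Feasible W β: the vectors in W can be given signs so that the signed sum is
-- the negative of β.
Feasible : List (I → ℤ₃) → (I → ℤ₃) → Set
Feasible []      β = ∀ x → β x ≡ 0F
Feasible (w ∷ W) β = ∃[ s ] Feasible W (λ x → β x ⊕ ⟦ s ⟧ ⊗ w x)

Feasible-congʳ : ∀ (W : List (I → ℤ₃)) {β γ} → (∀ x → β x ≡ γ x) → Feasible W β → Feasible W γ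
Feasible-congʳ []      β≗γ f       x = trans (sym (β≗γ x)) (f x)
Feasible-congʳ (w ∷ W) β≗γ (s , f) = s , Feasible-congʳ W (λ x → cong (_⊕ ⟦ s ⟧ ⊗ w x) (β≗γ x)) f

Feasible-↭ : ∀ {W U : List (I → ℤ₃)} {β} → W ↭ U → Feasible W β → Feasible U β
Feasible-↭ ↭.refl         f           = f
Feasible-↭ (↭.prep w p)   (s , f)     = s , Feasible-↭ p f
Feasible-↭ {β = β} (↭.swap {ys = U} w u p) (s , t , f) =
  t , s , Feasible-congʳ U (λ x → ⊕-swapʳ (β x) (⟦ s ⟧ ⊗ w x) _) (Feasible-↭ p f)
Feasible-↭ (↭.trans p q)  f           = Feasible-↭ q (Feasible-↭ p f)

infix 4 _≈±_

_≈±_ : (I → ℤ₃) → (I → ℤ₃) → Set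
w ≈± u = (∀ x → w x ≡ u x) ⊎ (∀ x → w x ≡ ⊝ u x)

≈±-refl : ∀ {w : I → ℤ₃} → w ≈± w
≈±-refl = inj₁ λ _ → refl

⊝-involutive : ∀ a → ⊝ ⊝ a ≡ a
⊝-involutive = from-yes (all? λ a → ⊝ ⊝ a ≟ a)

≈±-sym : ∀ {w u : I → ℤ₃} → w ≈± u → u ≈± w
≈±-sym (inj₁ p) = inj₁ λ x → sym (p x)
≈±-sym (inj₂ p) = inj₂ λ x → trans (sym (⊝-involutive _)) (cong ⊝_ (sym (p x)))

⊝⊗⊝ : ∀ a b → a ⊗ ⊝ b ≡ ⊝ a ⊗ b
⊝⊗⊝ = from-yes (all? λ a → all? λ b → a ⊗ ⊝ b ≟ ⊝ a ⊗ b)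

-- A reversed vector takes the opposite sign. Hence neither the stored order of the ends of an edge
-- nor the direction that a flow gives to it matters.
Feasible-cong± : ∀ {W U : List (I → ℤ₃)} {β} → Pointwise _≈±_ W U → Feasible W β → Feasible U β
Feasible-cong± [] f = f
Feasible-cong± {U = _ ∷ U} {β} (inj₁ p ∷ ps) (s , f) =
  s , Feasible-congʳ U (λ x → cong (λ a → β x ⊕ ⟦ s ⟧ ⊗ a) (p x)) (Feasible-cong± ps f)
Feasible-cong± {U = u ∷ U} {β} (inj₂ p ∷ ps) (s , f) =
  opposite s , Feasible-congʳ U (λ x → cong (β x ⊕_) (eq x)) (Feasible-cong± ps f)
  where
  eq : ∀ x → ⟦ s ⟧ ⊗ _ ≡ ⟦ opposite s ⟧ ⊗ u x
  eq x = trans (cong (⟦ s ⟧ ⊗_) (p x)) (trans (⊝⊗⊝ ⟦ s ⟧ (u x)) (cong (_⊗ u x) (sym (⟦opposite⟧ s))))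

≈±-refls : ∀ (W : List (I → ℤ₃)) → Pointwise _≈±_ W W
≈±-refls W = Pointwise.refl ≈±-refl

Feasible-pullback : ∀ (φ : I → I′) W {β} → Feasible W β → Feasible (map (_∘ φ) W) (β ∘ φ)
Feasible-pullback φ []      f x     = f (φ x)
Feasible-pullback φ (w ∷ W) (s , f) = s , Feasible-pullback φ W f

-- Coordinates outside the image of `φ` are 0 at the start and stay 0 under every choice of signs.
Feasible-pushforward : ∀ (φ : I → I′) → (∀ y → Dec (∃[ x ] φ x ≡ y)) → ∀ W {β} →
  (∀ y → ¬ (∃[ x ] φ x ≡ y) → β y ≡ 0F × All (λ w → w y ≡ 0F) W) →
  Feasible (map (_∘ φ) W) (β ∘ φ) → Feasible W β
Feasible-pushforward φ im? [] off f y with im? y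
... | yes (x , refl) = f x
... | no  y∉         = proj₁ (off y y∉)
Feasible-pushforward φ im? (w ∷ W) off (s , f) = s , Feasible-pushforward φ im? W off′ f
  where
  off′ : ∀ y → _ → _
  off′ y y∉ with off y y∉
  ... | βy , wy ∷ Wy = trans (cong₂ (λ a b → a ⊕ ⟦ s ⟧ ⊗ b) βy wy) (⊗-zeroʳ ⟦ s ⟧) , Wy

-- Two signs add up to any residue: 0 = 1 + 2, 1 = 2 + 2, 2 = 1 + 1. A doubled vector thus takes any
-- coefficient, 0 included, while a single one takes only 1 or 2.
double : ∀ {w : I → ℤ₃} {W β} t → Feasible W (λ x → β x ⊕ t ⊗ w x) → Feasible (w ∷ w ∷ W) β
double {w = w} {W} {β} t f =
  let s₁ , s₂ , eq = signs t in
  s₁ , s₂ , Feasible-congʳ W (λ x → eq (β x) (w x)) f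
  where
  signs : ∀ t → ∃[ s₁ ] ∃[ s₂ ] (∀ a b → a ⊕ t ⊗ b ≡ a ⊕ ⟦ s₁ ⟧ ⊗ b ⊕ ⟦ s₂ ⟧ ⊗ b)
  signs 0F = pos , neg , from-yes (all? λ a → all? λ b → a ⊕ 0F ⊗ b ≟ a ⊕ 1F ⊗ b ⊕ 2F ⊗ b)
  signs 1F = neg , neg , from-yes (all? λ a → all? λ b → a ⊕ 1F ⊗ b ≟ a ⊕ 2F ⊗ b ⊕ 2F ⊗ b)
  signs 2F = pos , pos , from-yes (all? λ a → all? λ b → a ⊕ 2F ⊗ b ≟ a ⊕ 1F ⊗ b ⊕ 1F ⊗ b)

-- Opposite signs. This serves the two edges of a leaf, whose difference vanishes at the apex.
difference : ∀ {w u : I → ℤ₃} {W β} →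
  Feasible ((λ x → w x ⊕ ⊝ u x) ∷ W) β → Feasible (w ∷ u ∷ W) β
difference {w = w} {u} {W} {β} (s , f) = s , opposite s , Feasible-congʳ W eq f
  where
  lemma : ∀ a s b c → a ⊕ s ⊗ (b ⊕ ⊝ c) ≡ a ⊕ s ⊗ b ⊕ ⊝ s ⊗ c
  lemma = from-yes (all? λ a → all? λ s → all? λ b → all? λ c →
    a ⊕ s ⊗ (b ⊕ ⊝ c) ≟ a ⊕ s ⊗ b ⊕ ⊝ s ⊗ c)
  eq : ∀ x → _
  eq x = trans (lemma (β x) ⟦ s ⟧ (w x) (u x)) (cong (λ t → β x ⊕ ⟦ s ⟧ ⊗ w x ⊕ t ⊗ u x) (sym (⟦opposite⟧ s)))

-- Equal signs on all three. Where each vector is 1, as at the apex of a leaf, the sum 1 + 1 + 1 is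
-- 0.
star : ∀ {w₁ w₂ w₃ : I → ℤ₃} {W β} →
  Feasible ((λ x → w₁ x ⊕ w₂ x ⊕ w₃ x) ∷ W) β → Feasible (w₁ ∷ w₂ ∷ w₃ ∷ W) β
star {w₁ = w₁} {w₂} {w₃} {W} {β} (s , f) =
  s , s , s , Feasible-congʳ W (λ x → lemma (β x) ⟦ s ⟧ (w₁ x) (w₂ x) (w₃ x)) f
  where
  lemma : ∀ a s b c d → a ⊕ s ⊗ (b ⊕ c ⊕ d) ≡ a ⊕ s ⊗ b ⊕ s ⊗ c ⊕ s ⊗ d
  lemma = from-yes (all? λ a → all? λ s → all? λ b → all? λ c → all? λ d →
    a ⊕ s ⊗ (b ⊕ c ⊕ d) ≟ a ⊕ s ⊗ b ⊕ s ⊗ c ⊕ s ⊗ d)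

Feasible-zero : ∀ {w : I → ℤ₃} {W β} → (∀ x → w x ≡ 0F) → Feasible W β → Feasible (w ∷ W) β
Feasible-zero {W = W} {β} w≗0 f = pos , Feasible-congʳ W (λ x → sym (trans (cong (β x ⊕_) (w≗0 x)) (⊕-identityʳ (β x)))) f

-- Boundaries and triangle-trees

module _ {n : ℕ} where

  private
    V = Fin n
  private variable
    S : List V
    x y z v : V
    β γ w : V → ℤ₃

  χ : V → V → ℤ₃
  χ x v = if does (x ≟ v) then 1F else 0F

  χ-self : ∀ (x : V) → χ x x ≡ 1F
  χ-self x rewrite dec-true (x ≟ x) refl = refl

  χ-other : x ≢ v → χ x v ≡ 0F
  χ-other {x} {v} x≢v rewrite dec-false (x ≟ v) x≢v = refl

  opaque
    -- The boundary of an edge directed from `x` to `y`: 1 at `x` and 2, that is -1, at `y`.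
    -- Arguments use only its values and its chain rule; it is unfolded solely to evaluate `K₄`.
    δ : V → V → V → ℤ₃
    δ x y v = χ x v ⊕ ⊝ χ y v

    δ-def : ∀ x y v → δ x y v ≡ χ x v ⊕ 2F ⊗ χ y v
    δ-def x y v = refl

  δ-source : x ≢ y → δ x y x ≡ 1F
  δ-source {x} {y} x≢y rewrite δ-def x y x | χ-self x | χ-other (x≢y ∘ sym) = refl

  δ-target : x ≢ y → δ x y y ≡ 2F
  δ-target {x} {y} x≢y rewrite δ-def x y y | χ-self y | χ-other x≢y = refl

  δ-outside : v ≢ x → v ≢ y → δ x y v ≡ 0F
  δ-outside {v} {x} {y} v≢x v≢y rewrite δ-def x y v | χ-other (v≢x ∘ sym) | χ-other (v≢y ∘ sym) = refl

  δ-loop : ∀ x v → δ x x v ≡ 0F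
  δ-loop x v = trans (δ-def x x v) (lemma (χ x v))
    where
    lemma : ∀ a → a ⊕ 2F ⊗ a ≡ 0F
    lemma = from-yes (all? λ a → a ⊕ 2F ⊗ a ≟ 0F)

  δ-chain : ∀ x y z v → δ x z v ≡ δ x y v ⊕ δ y z v
  δ-chain x y z v rewrite δ-def x z v | δ-def x y v | δ-def y z v = lemma (χ x v) (χ y v) (χ z v)
    where
    lemma : ∀ a b c → a ⊕ ⊝ c ≡ (a ⊕ ⊝ b) ⊕ (b ⊕ ⊝ c)
    lemma = from-yes (all? λ a → all? λ b → all? λ c → a ⊕ ⊝ c ≟ (a ⊕ ⊝ b) ⊕ (b ⊕ ⊝ c))

  δ-flip : δ x y ≈± δ y x
  δ-flip {x} {y} = inj₂ λ v → begin
    δ x y v                ≡⟨ δ-def x y v ⟩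
    χ x v ⊕ ⊝ χ y v        ≡⟨ lemma (χ x v) (χ y v) ⟩
    ⊝ (χ y v ⊕ ⊝ χ x v)    ≡⟨ cong ⊝_ (δ-def y x v) ⟨
    ⊝ δ y x v              ∎
    where
    open ≡-Reasoning
    lemma : ∀ a b → a ⊕ ⊝ b ≡ ⊝ (b ⊕ ⊝ a)
    lemma = from-yes (all? λ a → all? λ b → a ⊕ ⊝ b ≟ ⊝ (b ⊕ ⊝ a))

  Σₗ : List V → (V → ℤ₃) → ℤ₃
  Σₗ []      β = 0F
  Σₗ (x ∷ S) β = β x ⊕ Σₗ S β

  Σₗ-linear : ∀ S t → Σₗ S (λ x → β x ⊕ t ⊗ w x) ≡ Σₗ S β ⊕ t ⊗ Σₗ S w
  Σₗ-linear []      t = sym (⊗-zeroʳ t)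
  Σₗ-linear {β} {w} (x ∷ S) t =
    trans (cong (β x ⊕ t ⊗ w x ⊕_) (Σₗ-linear S t)) (lemma (β x) t (w x) _ _)
    where
    lemma : ∀ a t b c d → a ⊕ t ⊗ b ⊕ (c ⊕ t ⊗ d) ≡ a ⊕ c ⊕ t ⊗ (b ⊕ d)
    lemma = from-yes (all? λ a → all? λ t → all? λ b → all? λ c → all? λ d →
      a ⊕ t ⊗ b ⊕ (c ⊕ t ⊗ d) ≟ a ⊕ c ⊕ t ⊗ (b ⊕ d))

  Σₗ-cong : ∀ S → (∀ x → β x ≡ γ x) → Σₗ S β ≡ Σₗ S γ
  Σₗ-cong []      β≗γ = refl
  Σₗ-cong (x ∷ S) β≗γ = cong₂ _⊕_ (β≗γ x) (Σₗ-cong S β≗γ)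

  Σₗ-χ-∉ : x ∉ S → Σₗ S (χ x) ≡ 0F
  Σₗ-χ-∉ {S = []}    x∉ = refl
  Σₗ-χ-∉ {S = y ∷ S} x∉ rewrite χ-other (x∉ ∘ here) = Σₗ-χ-∉ (x∉ ∘ there)

  Σₗ-χ-∈ : Unique S → x ∈ S → Σₗ S (χ x) ≡ 1F
  Σₗ-χ-∈ {x = x} S!@(_ ∷ _) (here refl) rewrite χ-self x | Σₗ-χ-∉ (Unique[x∷xs]⇒x∉xs S!) = refl
  Σₗ-χ-∈ {S = y ∷ S} {x} S!@(_ ∷ S!′) (there x∈) =
    cong₂ _⊕_ (χ-other {x} {y} λ { refl → Unique[x∷xs]⇒x∉xs S! x∈ }) (Σₗ-χ-∈ S!′ x∈)

  -- These conditions are necessary for edges inside `S` to cancel `β`; `doubled-edge-feasible`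
  -- shows that they suffice for a tree on `S` with one edge doubled.
  record Balanced (S : List V) (β : V → ℤ₃) : Set where
    constructor balanced
    field
      total   : Σₗ S β ≡ 0F
      support : ∀ x → x ∉ S → β x ≡ 0F

  Balanced-cong : (∀ x → β x ≡ γ x) → Balanced S β → Balanced S γ
  Balanced-cong {S = S} β≗γ (balanced t s) =
    balanced (trans (sym (Σₗ-cong S β≗γ)) t) λ x x∉ → trans (sym (β≗γ x)) (s x x∉)

  Balanced-0 : ∀ (S : List V) → Balanced S (λ _ → 0F)
  Balanced-0 []      = balanced refl λ _ _ → refl
  Balanced-0 (x ∷ S) = balanced (Balanced.total (Balanced-0 S)) λ _ _ → refl

  Balanced-+ : ∀ t → Balanced S β → Balanced S w → Balanced S (λ x → β x ⊕ t ⊗ w x)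
  Balanced-+ {S = S} {β} {w} t (balanced t₁ s₁) (balanced t₂ s₂) = balanced
    (trans (Σₗ-linear S t) (trans (cong₂ (λ a b → a ⊕ t ⊗ b) t₁ t₂) (⊗-zeroʳ t)))
    λ x x∉ → trans (cong₂ (λ a b → a ⊕ t ⊗ b) (s₁ x x∉) (s₂ x x∉)) (⊗-zeroʳ t)

  Balanced-δ : Unique S → x ∈ S → y ∈ S → Balanced S (δ x y)
  Balanced-δ {S} {x} {y} S! x∈ y∈ = balanced
    (trans (Σₗ-cong S (δ-def x y))
      (trans (Σₗ-linear S 2F) (cong₂ (λ a b → a ⊕ ⊝ b) (Σₗ-χ-∈ S! x∈) (Σₗ-χ-∈ S! y∈))))
    λ v v∉ → δ-outside (λ { refl → v∉ x∈ }) (λ { refl → v∉ y∈ })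

  Balanced-tail : Balanced (x ∷ S) β → β x ≡ 0F → Balanced S β
  Balanced-tail {x} {S} {β} (balanced t s) βx = balanced
    (trans (cong (_⊕ Σₗ S β) (sym βx)) t) support
    where
    support : ∀ v → v ∉ S → β v ≡ 0F
    support v v∉ with v ≟ x
    ... | yes refl = βx
    ... | no  v≢x  = s v λ { (here v≡x) → v≢x v≡x ; (there v∈) → v∉ v∈ }

  Balanced-singleton : Balanced (x ∷ []) β → ∀ v → β v ≡ 0F
  Balanced-singleton {x} {β} b v =
    Balanced.support (Balanced-tail b (trans (sym (⊕-identityʳ (β x))) (Balanced.total b))) v λ ()

  -- Both new vectors are 1 at `x`, so two signs can cancel `β x`. What remains is balanced on `S`.
  attach-feasible : ∀ {W} → x ∉ S → Unique S → y ∈ S → z ∈ S →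
    (∀ γ → Balanced S γ → Feasible W γ) →
    Balanced (x ∷ S) β → Feasible (δ x y ∷ δ x z ∷ W) β
  attach-feasible {x} {S} {y} {z} {β} x∉ S! y∈ z∈ feasible b with signs (β x)
    where
    signs : ∀ c → ∃[ s ] ∃[ t ] c ⊕ ⟦ s ⟧ ⊗ 1F ⊕ ⟦ t ⟧ ⊗ 1F ≡ 0F
    signs 0F = pos , neg , refl
    signs 1F = pos , pos , refl
    signs 2F = neg , neg , refl
  ... | s , t , eq = s , t , feasible _ (Balanced-tail b′ zeroed)
    where
    xS! : Unique (x ∷ S)
    xS! = ∉⇒unique x∉ S!
    b′ : Balanced (x ∷ S) (λ v → β v ⊕ ⟦ s ⟧ ⊗ δ x y v ⊕ ⟦ t ⟧ ⊗ δ x z v)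
    b′ = Balanced-+ ⟦ t ⟧ (Balanced-+ ⟦ s ⟧ b (Balanced-δ xS! (here refl) (there y∈)))
           (Balanced-δ xS! (here refl) (there z∈))
    zeroed : β x ⊕ ⟦ s ⟧ ⊗ δ x y x ⊕ ⟦ t ⟧ ⊗ δ x z x ≡ 0F
    zeroed rewrite δ-source {x} {y} (λ { refl → x∉ y∈ }) | δ-source {x} {z} (λ { refl → x∉ z∈ }) = eq

module Trees {n : ℕ} {E : Set} (G : Multigraph (Fin n) E) where
  open Multigraph G

  V : Set
  V = Fin n

  private variable
    x y z v : V
    e e₁ e₂ f g : E
    A : List E
    S : List V
    β : V → ℤ₃
    W : List (V → ℤ₃)

  ∂ : E → V → ℤ₃
  ∂ e = δ (proj₁ (ends e)) (proj₂ (ends e))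

  Joins-sym : Joins e x y → Joins e y x
  Joins-sym (inj₁ p) = inj₂ p
  Joins-sym (inj₂ p) = inj₁ p

  Joins⇒≢ : Joins e x y → x ≢ y
  Joins⇒≢ {e} (inj₁ p) refl = loopless e (trans (cong proj₁ p) (sym (cong proj₂ p)))
  Joins⇒≢ {e} (inj₂ p) refl = loopless e (trans (cong proj₁ p) (sym (cong proj₂ p)))

  ∂-joins : Joins e x y → ∂ e ≈± δ x y
  ∂-joins (inj₁ p) rewrite p = ≈±-refl
  ∂-joins (inj₂ p) rewrite p = δ-flip

  joins-∂ : Joins e x y → δ x y ≈± ∂ e
  joins-∂ j = ≈±-sym (∂-joins j)

  -- A single edge counts as a tree here, so that a triangle is one attachment.
  data Tree : List E → List V → Set where
    edge   : Joins f y z → Tree (f ∷ []) (y ∷ z ∷ [])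
    attach : Tree A S → f ∈ A → Joins f y z → Joins e₁ x y → Joins e₂ x z → x ∉ S →
             Tree (e₁ ∷ e₂ ∷ A) (x ∷ S)

  Tree-unique : Tree A S → Unique S
  Tree-unique (edge j)                = (Joins⇒≢ j ∷ []) ∷ [] ∷ []
  Tree-unique (attach T _ _ _ _ x∉S) = ∉⇒unique x∉S (Tree-unique T)

  Tree-length : Tree A S → 2 ≤ length S
  Tree-length (edge _)             = s≤s (s≤s z≤n)
  Tree-length (attach T _ _ _ _ _) = ℕ.m≤n⇒m≤1+n (Tree-length T)

  Inside : List V → E → Set
  Inside S e = proj₁ (ends e) ∈ S × proj₂ (ends e) ∈ S

  Inside-joins : Inside S e → Joins e x y → x ∈ S × y ∈ S
  Inside-joins (p , q) (inj₁ refl) = p , q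
  Inside-joins (p , q) (inj₂ refl) = q , p

  joins-Inside : Joins e x y → x ∈ S → y ∈ S → Inside S e
  joins-Inside (inj₁ refl) p q = p , q
  joins-Inside (inj₂ refl) p q = q , p

  Tree-inside : Tree A S → f ∈ A → Inside S f
  Tree-inside (edge j) (here refl) = joins-Inside j (here refl) (there (here refl))
  Tree-inside (attach T f∈ j j₁ j₂ x∉) g∈ with Inside-joins (Tree-inside T f∈) j
  Tree-inside (attach T f∈ j j₁ j₂ x∉) (here refl)         | y∈ , z∈ = joins-Inside j₁ (here refl) (there y∈)
  Tree-inside (attach T f∈ j j₁ j₂ x∉) (there (here refl)) | y∈ , z∈ = joins-Inside j₂ (here refl) (there z∈)
  Tree-inside (attach T f∈ j j₁ j₂ x∉) (there (there g∈))  | _ =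
    let p , q = Tree-inside T g∈ in there p , there q

  Balanced-∂ : Unique S → Inside S e → Balanced S (∂ e)
  Balanced-∂ S! (p , q) = Balanced-δ S! p q

  private
    reroute : ∀ b s p q → ⊝ b ⊗ p ⊕ s ⊗ q ≡ (⊝ b ⊕ ⊝ s) ⊗ p ⊕ s ⊗ (p ⊕ q)
    reroute = from-yes (all? λ b → all? λ s → all? λ p → all? λ q →
      ⊝ b ⊗ p ⊕ s ⊗ q ≟ (⊝ b ⊕ ⊝ s) ⊗ p ⊕ s ⊗ (p ⊕ q))

    -- Doubling the edge xy lets the path y x z play the role of the edge yz.
    free-new : Tree A S → x ∉ S → y ∈ S → z ∈ S → Joins f y z →
      (∀ γ → Balanced S γ → Feasible (∂ f ∷ map ∂ A) γ) →
      Balanced (x ∷ S) β → Feasible (δ x y ∷ δ x y ∷ δ x z ∷ map ∂ A) β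
    free-new {A} {S} {x} {y} {z} {β = β} T x∉ y∈ z∈ j feasible b =
      finish (Feasible-cong± (∂-joins j ∷ ≈±-refls _) (feasible γ γ-balanced))
      where
      xS! : Unique (x ∷ S)
      xS! = ∉⇒unique x∉ (Tree-unique T)
      γ : V → ℤ₃
      γ v = β v ⊕ ⊝ β x ⊗ δ x y v
      γ-balanced : Balanced S γ
      γ-balanced = Balanced-tail (Balanced-+ (⊝ β x) b (Balanced-δ xS! (here refl) (there y∈))) zeroed
        where
        lemma : ∀ a → a ⊕ ⊝ a ⊗ 1F ≡ 0F
        lemma = from-yes (all? λ a → a ⊕ ⊝ a ⊗ 1F ≟ 0F)
        zeroed : γ x ≡ 0F
        zeroed rewrite δ-source {x = x} {y} (λ { refl → x∉ y∈ }) = lemma (β x)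
      eq : ∀ s v → γ v ⊕ s ⊗ δ y z v ≡ β v ⊕ (⊝ β x ⊕ ⊝ s) ⊗ δ x y v ⊕ s ⊗ δ x z v
      eq s v = begin
        γ v ⊕ s ⊗ δ y z v                               ≡⟨ ⊕-assoc (β v) _ _ ⟩
        β v ⊕ (⊝ β x ⊗ δ x y v ⊕ s ⊗ δ y z v)           ≡⟨ cong (β v ⊕_) (reroute (β x) s (δ x y v) (δ y z v)) ⟩
        β v ⊕ (t ⊗ δ x y v ⊕ s ⊗ (δ x y v ⊕ δ y z v))   ≡⟨ cong (λ a → β v ⊕ (t ⊗ δ x y v ⊕ s ⊗ a)) (δ-chain x y z v) ⟨
        β v ⊕ (t ⊗ δ x y v ⊕ s ⊗ δ x z v)               ≡⟨ ⊕-assoc (β v) _ _ ⟨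
        β v ⊕ t ⊗ δ x y v ⊕ s ⊗ δ x z v                 ∎
        where
        open ≡-Reasoning
        t : ℤ₃
        t = ⊝ β x ⊕ ⊝ s
      finish : Feasible (δ y z ∷ map ∂ A) γ → Feasible (δ x y ∷ δ x y ∷ δ x z ∷ map ∂ A) β
      -- The sign `s` of yz passes to xz. The doubled xy carries the coefficient -β x - s: the first
      -- part clears `x`, the second pays for the detour through `x`.
      finish (s , h) = double (⊝ β x ⊕ ⊝ ⟦ s ⟧) (s , Feasible-congʳ (map ∂ A) (eq ⟦ s ⟧) h)

  -- Induction on the tree. If the doubled edge is one of the two newest, `free-new` makes the older
  -- tree see its base doubled instead. If it is older, the two newest edges merely clear their
  -- apex.
  doubled-edge-feasible : Tree A S → f ∈ A → ∀ β → Balanced S β → Feasible (∂ f ∷ map ∂ A) β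
  doubled-edge-feasible (edge {y = y} {z} j) (here refl) β b =
    Feasible-cong± (joins-∂ j ∷ joins-∂ j ∷ []) (double (⊝ β y)
      (Balanced-singleton (Balanced-tail b′ zeroed)))
    where
    y≢z = Joins⇒≢ j
    b′ : Balanced (y ∷ z ∷ []) (λ v → β v ⊕ ⊝ β y ⊗ δ y z v)
    b′ = Balanced-+ (⊝ β y) b (Balanced-δ ((y≢z ∷ []) ∷ [] ∷ []) (here refl) (there (here refl)))
    lemma : ∀ a → a ⊕ ⊝ a ⊗ 1F ≡ 0F
    lemma = from-yes (all? λ a → a ⊕ ⊝ a ⊗ 1F ≟ 0F)
    zeroed : β y ⊕ ⊝ β y ⊗ δ y z y ≡ 0F
    zeroed rewrite δ-source y≢z = lemma (β y)
  doubled-edge-feasible (attach T f∈ j j₁ j₂ x∉) (here refl) β b =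
    let y∈ , z∈ = Inside-joins (Tree-inside T f∈) j in
    Feasible-cong± (joins-∂ j₁ ∷ joins-∂ j₁ ∷ joins-∂ j₂ ∷ ≈±-refls _)
      (free-new T x∉ y∈ z∈ j (doubled-edge-feasible T f∈) b)
  doubled-edge-feasible (attach T f∈ j j₁ j₂ x∉) (there (here refl)) β b =
    let y∈ , z∈ = Inside-joins (Tree-inside T f∈) j in
    Feasible-↭ (↭-prep _ (↭-swap _ _ ↭-refl))
      (Feasible-cong± (joins-∂ j₂ ∷ joins-∂ j₂ ∷ joins-∂ j₁ ∷ ≈±-refls _)
        (free-new T x∉ z∈ y∈ (Joins-sym j) (doubled-edge-feasible T f∈) b))
  doubled-edge-feasible (attach T f∈ j j₁ j₂ x∉) (there (there g∈)) β b =
    let y∈ , z∈ = Inside-joins (Tree-inside T f∈) j in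
    Feasible-↭ (shift _ (_ ∷ _ ∷ []) _)
      (Feasible-cong± (joins-∂ j₁ ∷ joins-∂ j₂ ∷ ≈±-refls _)
        (attach-feasible x∉ (Tree-unique T) y∈ z∈ (doubled-edge-feasible T g∈) b))

  -- With opposite signs the two edges at `x` give δ x y - δ x z = δ z y, which is 0 at `x` and, up
  -- to sign, a second copy of the base `f`.
  leaf-zero-feasible : Tree A S → f ∈ A → Joins f y z → Joins e₁ x y → Joins e₂ x z →
    Balanced (x ∷ S) β → β x ≡ 0F → Feasible (∂ e₁ ∷ ∂ e₂ ∷ map ∂ A) β
  leaf-zero-feasible {y = y} {z} {x = x} T f∈ j j₁ j₂ b βx =
    Feasible-cong± (joins-∂ j₁ ∷ joins-∂ j₂ ∷ ≈±-refls _) (difference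
      (Feasible-cong± (eq ∷ ≈±-refls _)
        (Feasible-cong± (∂-joins j ∷ ≈±-refls _) (doubled-edge-feasible T f∈ _ (Balanced-tail b βx)))))
    where
    lemma : ∀ p q → q ≡ ⊝ (p ⊕ ⊝ (p ⊕ q))
    lemma = from-yes (all? λ p → all? λ q → q ≟ ⊝ (p ⊕ ⊝ (p ⊕ q)))
    eq : δ y z ≈± (λ v → δ x y v ⊕ ⊝ δ x z v)
    eq = inj₂ λ v → trans (lemma (δ x y v) (δ y z v)) (cong (λ a → ⊝ (δ x y v ⊕ ⊝ a)) (sym (δ-chain x y z v)))

open ↭-Solver

-- Clearing the boundary at one vertex; leaves and their stars

module _ {n : ℕ} {S : List (Fin n)} {x : Fin n} {U : List (Fin n → ℤ₃)} where

  -- The choice of sign is immaterial, hence always `pos`: a balanced vector that is 0 at `x` never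
  -- leads out of the boundaries that `cont` accepts.
  absorb : ∀ {W} → All (Balanced S) W → All (λ w → w x ≡ 0F) W →
    (∀ γ → Balanced S γ → γ x ≡ 0F → Feasible U γ) →
    ∀ β → Balanced S β → β x ≡ 0F → Feasible (W ++ U) β
  absorb []       []         cont β b βx = cont β b βx
  absorb (c ∷ cs) (wx ∷ wxs) cont β b βx =
    pos , absorb cs wxs cont _ (Balanced-+ 1F b c) (cong₂ _⊕_ βx wx)

  -- The last two vectors decide: when b and c are nonzero, some choice of signs in a ± b ± c gives
  -- 0, whatever a is. All earlier vectors may take any sign.
  steer : ∀ {W} → 2 ≤ length W → All (Balanced S) W → All (λ w → w x ≢ 0F) W →
    (∀ γ → Balanced S γ → γ x ≡ 0F → Feasible U γ) →
    ∀ β → Balanced S β → Feasible (W ++ U) β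
  steer {w ∷ []} (s≤s ()) _ _
  steer {w ∷ u ∷ []} _ (cw ∷ cu ∷ []) (wx ∷ ux ∷ []) cont β b
    with signs (β x) (w x) (u x) wx ux
    where
    signs : ∀ a b c → b ≢ 0F → c ≢ 0F → ∃[ s ] ∃[ t ] a ⊕ ⟦ s ⟧ ⊗ b ⊕ ⟦ t ⟧ ⊗ c ≡ 0F
    signs _  0F _  b≢0 c≢0 = contradiction refl b≢0
    signs _  1F 0F b≢0 c≢0 = contradiction refl c≢0
    signs _  2F 0F b≢0 c≢0 = contradiction refl c≢0
    signs 0F 1F 1F _ _ = pos , neg , refl
    signs 0F 1F 2F _ _ = pos , pos , refl
    signs 0F 2F 1F _ _ = pos , pos , refl
    signs 0F 2F 2F _ _ = pos , neg , refl
    signs 1F 1F 1F _ _ = pos , pos , refl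
    signs 1F 1F 2F _ _ = pos , neg , refl
    signs 1F 2F 1F _ _ = neg , pos , refl
    signs 1F 2F 2F _ _ = neg , neg , refl
    signs 2F 1F 1F _ _ = neg , neg , refl
    signs 2F 1F 2F _ _ = neg , pos , refl
    signs 2F 2F 1F _ _ = pos , neg , refl
    signs 2F 2F 2F _ _ = pos , pos , refl
  ... | s , t , eq = s , t , cont _ (Balanced-+ ⟦ t ⟧ (Balanced-+ ⟦ s ⟧ b cw) cu) eq
  steer {w ∷ u ∷ v ∷ W} _ (cw ∷ cs) (_ ∷ nz) cont β b =
    pos , steer {u ∷ v ∷ W} (s≤s (s≤s z≤n)) cs nz cont _ (Balanced-+ 1F b cw)

module Bulls {n : ℕ} {E : Set} (G : Multigraph (Fin n) E) where
  open Multigraph G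
  open Trees G

  private variable
    x y z v p q : V
    e e₁ e₂ e₃ f g : E
    A X X′ Y Z : List E
    S : List V
    β : V → ℤ₃
    W Γ : List (V → ℤ₃)

  incident? : ∀ e x → Dec (Incident e x)
  incident? e x = (proj₁ (ends e) ≟ x) ⊎-dec (proj₂ (ends e) ≟ x)

  joins-incidentˡ : Joins e x y → Incident e x
  joins-incidentˡ (inj₁ refl) = inj₁ refl
  joins-incidentˡ (inj₂ refl) = inj₂ refl

  joins-incidentʳ : Joins e x y → Incident e y
  joins-incidentʳ j = joins-incidentˡ (Joins-sym j)

  incident⇒joins : Incident e x → ∃[ p ] Joins e x p
  incident⇒joins (inj₁ refl) = _ , inj₁ refl
  incident⇒joins (inj₂ refl) = _ , inj₂ refl

  joins-incident⇒ : Joins e x y → Incident e v → v ≡ x ⊎ v ≡ y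
  joins-incident⇒ (inj₁ refl) (inj₁ refl) = inj₁ refl
  joins-incident⇒ (inj₁ refl) (inj₂ refl) = inj₂ refl
  joins-incident⇒ (inj₂ refl) (inj₁ refl) = inj₂ refl
  joins-incident⇒ (inj₂ refl) (inj₂ refl) = inj₁ refl

  joins-other : Joins e x y → Joins e x z → y ≡ z
  joins-other (inj₁ p) (inj₁ r) = cong proj₂ (trans (sym p) r)
  joins-other j@(inj₁ p) (inj₂ r) = contradiction (cong proj₂ (trans (sym r) p)) (Joins⇒≢ j)
  joins-other j@(inj₂ p) (inj₁ r) = contradiction (cong proj₁ (trans (sym r) p)) (Joins⇒≢ j)
  joins-other (inj₂ p) (inj₂ r) = cong proj₁ (trans (sym p) r)

  ∂-incident : Incident e x → ∂ e x ≢ 0F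
  ∂-incident {e} (inj₁ refl) eq = case trans (sym (δ-source (loopless e))) eq of λ ()
  ∂-incident {e} (inj₂ refl) eq = case trans (sym (δ-target (loopless e))) eq of λ ()

  ∂-nonincident : ¬ Incident e x → ∂ e x ≡ 0F
  ∂-nonincident ¬i = δ-outside (¬i ∘ inj₁ ∘ sym) (¬i ∘ inj₂ ∘ sym)

  Inside-tail : ¬ Incident e x → Inside (x ∷ S) e → Inside S e
  Inside-tail ¬i (p , q) = step (¬i ∘ inj₁) p , step (¬i ∘ inj₂) q
    where
    step : v ≢ x → v ∈ x ∷ S → v ∈ S
    step v≢x (here v≡x) = contradiction v≡x v≢x
    step v≢x (there v∈) = v∈

  All-Balanced-∂ : Unique S → All (Inside S) X → All (Balanced S) (map ∂ X)
  All-Balanced-∂ S! = All.map⁺ ∘ All.map (Balanced-∂ S!)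

  map-∂-↭ : ∀ Y Z → X ↭ Y ++ Z → map ∂ X ↭ map ∂ Y ++ map ∂ Z
  map-∂-↭ Y Z p = ↭-trans (map⁺ ∂ p) (↭-reflexive (map-++ ∂ Y Z))

  private
    -- Since δ x z = δ x y + δ y z, the sum δ x y + δ x z + δ x y equals δ y z modulo 3. Equal signs
    -- on the three edges thus produce another copy of `f`.
    parallel : ∀ {β} → Joins f y z → Joins e₁ x y → Joins e₂ x z → Joins e₃ x y →
      Feasible (∂ f ∷ W) β → Feasible (∂ e₁ ∷ ∂ e₂ ∷ ∂ e₃ ∷ W) β
    parallel {y = y} {z} {x = x} j j₁ j₂ j₃ h =
      Feasible-cong± (joins-∂ j₁ ∷ joins-∂ j₂ ∷ joins-∂ j₃ ∷ ≈±-refls _) (star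
        (Feasible-cong± (inj₁ eq ∷ ≈±-refls _)
          (Feasible-cong± (∂-joins j ∷ ≈±-refls _) h)))
      where
      lemma : ∀ a b → b ≡ a ⊕ (a ⊕ b) ⊕ a
      lemma = from-yes (all? λ a → all? λ b → b ≟ a ⊕ (a ⊕ b) ⊕ a)
      eq : ∀ v → δ y z v ≡ δ x y v ⊕ δ x z v ⊕ δ x y v
      eq v = trans (lemma (δ x y v) (δ y z v)) (cong (λ a → δ x y v ⊕ a ⊕ δ x y v) (sym (δ-chain x y z v)))

  record ThirdEdge (x y z : V) (X : List E) : Set where
    constructor thirdEdge
    field
      third     : E
      far       : V
      rest      : List E
      split-off : X ↭ third ∷ rest
      joins     : Joins third x far
      far≢y     : far ≢ y
      far≢z     : far ≢ z
      avoids    : All (λ e → ¬ Incident e x) rest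

  -- With no edge of `X` at `x` the boundary there is 0 already; with two or more it can be steered
  -- to 0; in both cases `leaf-zero-feasible` completes the signs. `Γ` holds what is left of leaves
  -- cut off earlier, and is 0 at `x` so as not to disturb this count.
  leaf-third-edge : Tree A S → f ∈ A → Joins f y z → Joins e₁ x y → Joins e₂ x z → x ∉ S →
    All (Balanced (x ∷ S)) Γ → All (λ w → w x ≡ 0F) Γ → All (Inside (x ∷ S)) X →
    ¬ Feasible (map ∂ X ++ Γ ++ map ∂ (e₁ ∷ e₂ ∷ A)) (λ _ → 0F) → ThirdEdge x y z X
  leaf-third-edge {A} {S} {f} {y} {z} {e₁} {x} {e₂} {Γ} {X} T f∈ j j₁ j₂ x∉ cΓ Γx inside infeasible
    with split (λ e → incident? e x) X
  ... | Y , Z , p , Yx , Zx = cases Y p Yx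
    where
    xS! : Unique (x ∷ S)
    xS! = ∉⇒unique x∉ (Tree-unique T)
    insides : All (Inside (x ∷ S)) (Y ++ Z)
    insides = All-resp-↭ p inside
    others : List (V → ℤ₃)
    others = map ∂ Z ++ Γ
    cW : All (Balanced (x ∷ S)) others
    cW = All.++⁺ (All-Balanced-∂ xS! (All.++⁻ʳ Y insides)) cΓ
    Wx : All (λ w → w x ≡ 0F) others
    Wx = All.++⁺ (All.map⁺ (All.map ∂-nonincident Zx)) Γx

    cases : ∀ Y → X ↭ Y ++ Z → All (λ e → Incident e x) Y → ThirdEdge x y z X
    cases [] p [] = contradiction
      (Feasible-↭ (↭-trans (++-assoc (map ∂ Z) Γ _) (++⁺ʳ _ (map⁺ ∂ (↭-sym p))))
        (absorb cW Wx (λ γ b γx → leaf-zero-feasible T f∈ j j₁ j₂ b γx) _ (Balanced-0 _) refl))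
      infeasible
    cases (e₃ ∷ []) p (i ∷ []) with incident⇒joins i
    ... | q , j₃ = record
      { third = e₃ ; far = q ; rest = Z ; split-off = p ; joins = j₃
      -- Parallel to a tree edge at `x`, the third edge would complete a second copy of the base,
      -- and a tree with a doubled edge attains every balanced boundary.
      ; far≢y = λ { refl → infeasible (Feasible-↭ perm (absorb cW Wx
          (λ γ b γx → parallel j j₁ j₂ j₃
            (doubled-edge-feasible T f∈ γ (Balanced-tail b γx))) _ (Balanced-0 _) refl)) }
      ; far≢z = λ { refl → infeasible (Feasible-↭ perm (absorb cW Wx
          (λ γ b γx → Feasible-↭ (↭-swap _ _ ↭-refl) (parallel (Joins-sym j) j₂ j₁ j₃
            (doubled-edge-feasible T f∈ γ (Balanced-tail b γx)))) _ (Balanced-0 _) refl)) }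
      ; avoids = Zx }
      where
      perm : (map ∂ Z ++ Γ) ++ map ∂ (e₁ ∷ e₂ ∷ e₃ ∷ A) ↭ map ∂ X ++ Γ ++ map ∂ (e₁ ∷ e₂ ∷ A)
      perm = ↭-trans
        (solve 6 (λ z g a b c d → (z ⊞ g) ⊞ (a ⊞ b ⊞ c ⊞ d) ⊜ (c ⊞ z) ⊞ (g ⊞ (a ⊞ b ⊞ d))) ↭-refl
          (map ∂ Z) Γ (∂ e₁ ∷ []) (∂ e₂ ∷ []) (∂ e₃ ∷ []) (map ∂ A))
        (++⁺ʳ _ (map⁺ ∂ (↭-sym p)))
    cases Y@(_ ∷ _ ∷ _) p Yx = contradiction
      (Feasible-↭ (↭-trans
        (solve 4 (λ y z g t → y ⊞ ((z ⊞ g) ⊞ t) ⊜ (y ⊞ z) ⊞ (g ⊞ t)) ↭-refl (map ∂ Y) (map ∂ Z) Γ _)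
        (++⁺ʳ _ (↭-sym (map-∂-↭ Y Z p))))
        (steer (s≤s (s≤s z≤n)) (All-Balanced-∂ xS! (All.++⁻ˡ Y (All-resp-↭ p inside)))
          (All.map⁺ (All.map ∂-incident Yx))
          (absorb cW Wx (λ γ b γx → leaf-zero-feasible T f∈ j j₁ j₂ b γx)) _ (Balanced-0 _)))
      infeasible

  -- An attachment of apex to the edge base, remembered so that it can be
  -- performed on any tree that contains base.
  record Leaf : Set where
    field
      apex hub rim     : V
      toHub toRim base : E
      base-joins       : Joins base hub rim
      toHub-joins      : Joins toHub apex hub
      toRim-joins      : Joins toRim apex rim

  open Leaf

  flipLeaf : Leaf → Leaf
  flipLeaf ℓ = record
    { apex = apex ℓ ; hub = rim ℓ ; rim = hub ℓ
    ; toHub = toRim ℓ ; toRim = toHub ℓ ; base = base ℓ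
    ; base-joins = Joins-sym (base-joins ℓ)
    ; toHub-joins = toRim-joins ℓ ; toRim-joins = toHub-joins ℓ
    }

  leafEdges : List Leaf → List E
  leafEdges []      = []
  leafEdges (ℓ ∷ L) = toHub ℓ ∷ toRim ℓ ∷ leafEdges L

  apexes : List Leaf → List V
  apexes = map apex

  leafEdges-↭ : ∀ {L M} → L ↭ M → leafEdges L ↭ leafEdges M
  leafEdges-↭ ↭.refl         = ↭-refl
  leafEdges-↭ (↭.prep ℓ p)   = ↭-prep _ (↭-prep _ (leafEdges-↭ p))
  leafEdges-↭ (↭.swap ℓ m p) = ↭-trans
    (++⁺ˡ (toHub ℓ ∷ toRim ℓ ∷ toHub m ∷ toRim m ∷ []) (leafEdges-↭ p))
    (shifts (toHub ℓ ∷ toRim ℓ ∷ []) (toHub m ∷ toRim m ∷ []))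
  leafEdges-↭ (↭.trans p q)  = ↭-trans (leafEdges-↭ p) (leafEdges-↭ q)

  -- All bases lie in the core `A`, so no leaf rests on another and any order of attachment will do.
  attachAll : Tree A S → ∀ L → All (λ ℓ → base ℓ ∈ A) L → Unique (apexes L ++ S) →
    Tree (leafEdges L ++ A) (apexes L ++ S)
  attachAll T []      _         _         = T
  attachAll T (ℓ ∷ L) (b ∷ bs) u@(_ ∷ us) =
    attach (attachAll T L bs us) (∈-++⁺ʳ (leafEdges L) b)
      (base-joins ℓ) (toHub-joins ℓ) (toRim-joins ℓ) (Unique[x∷xs]⇒x∉xs u)

  record AdjacentPair (L : List Leaf) (X : List E) : Set where
    constructor adjacentPair
    field
      first second : Leaf
      others       : List Leaf
      chosen       : L ↭ first ∷ second ∷ others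
      link         : E
      link∈        : link ∈ X
      link-joins   : Joins link (apex first) (apex second)

  ∈-apexes⇒ : ∀ {L} → p ∈ apexes L → ∃[ m ] ∃[ L′ ] p ≡ apex m × L ↭ m ∷ L′
  ∈-apexes⇒ {L = ℓ ∷ L} (here p≡)  = ℓ , L , p≡ , ↭-refl
  ∈-apexes⇒ {L = ℓ ∷ L} (there p∈) with ∈-apexes⇒ {L = L} p∈
  ... | m , L′ , p≡ , perm = m , ℓ ∷ L′ , p≡ , ↭-trans (↭-prep ℓ perm) (↭-swap ℓ m ↭-refl)

  -- A leaf with third edge e₃ is cut off by giving its three edges the same
  -- sign at the apex; they then act as a single vector.
  module LeafStar {ℓ : Leaf} {p : V} {e₃ : E} (j₃ : Joins e₃ (apex ℓ) p) (p≢hub : p ≢ hub ℓ) where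

    starVector : V → ℤ₃
    starVector v = δ (apex ℓ) (hub ℓ) v ⊕ δ (apex ℓ) (rim ℓ) v ⊕ δ (apex ℓ) p v

    star-apex : starVector (apex ℓ) ≡ 0F
    star-apex rewrite δ-source (Joins⇒≢ (toHub-joins ℓ)) | δ-source (Joins⇒≢ (toRim-joins ℓ))
      | δ-source (Joins⇒≢ j₃) = refl

    star-hub : starVector (hub ℓ) ≢ 0F
    star-hub rewrite δ-target (Joins⇒≢ (toHub-joins ℓ))
      | δ-outside (Joins⇒≢ (toHub-joins ℓ) ∘ sym) (Joins⇒≢ (base-joins ℓ))
      | δ-outside {y = p} (Joins⇒≢ (toHub-joins ℓ) ∘ sym) (p≢hub ∘ sym) = λ ()

    star-off : v ≢ apex ℓ → v ≢ hub ℓ → v ≢ rim ℓ → v ≢ p → starVector v ≡ 0F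
    star-off v≢x v≢q v≢r v≢p rewrite δ-outside v≢x v≢q | δ-outside v≢x v≢r | δ-outside v≢x v≢p = refl

    star-balanced : Unique (apex ℓ ∷ S) → hub ℓ ∈ S → rim ℓ ∈ S → p ∈ apex ℓ ∷ S → Balanced S starVector
    star-balanced u q∈ r∈ p∈ = Balanced-tail
      (Balanced-+ 1F (Balanced-+ 1F (Balanced-δ u (here refl) (there q∈)) (Balanced-δ u (here refl) (there r∈)))
        (Balanced-δ u (here refl) p∈))
      star-apex

    star-feasible : Feasible (starVector ∷ W) β → Feasible (∂ (toHub ℓ) ∷ ∂ (toRim ℓ) ∷ ∂ e₃ ∷ W) β
    star-feasible h = Feasible-cong±
      (joins-∂ (toHub-joins ℓ) ∷ joins-∂ (toRim-joins ℓ) ∷ joins-∂ j₃ ∷ ≈±-refls _) (star h)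

    cut-leaf : ∀ {X X′ Γ B} → X ↭ e₃ ∷ X′ →
      Feasible (map ∂ X′ ++ (starVector ∷ Γ) ++ map ∂ B) β →
      Feasible (map ∂ X ++ Γ ++ map ∂ (toHub ℓ ∷ toRim ℓ ∷ B)) β
    cut-leaf {X = X} {X′} {Γ} {B} perm h = Feasible-↭ regroup
      (star-feasible {W = map ∂ X′ ++ Γ ++ map ∂ B} (Feasible-↭ (shift starVector (map ∂ X′) _) h))
      where
      regroup : ∂ (toHub ℓ) ∷ ∂ (toRim ℓ) ∷ ∂ e₃ ∷ map ∂ X′ ++ Γ ++ map ∂ B
        ↭ map ∂ X ++ Γ ++ map ∂ (toHub ℓ ∷ toRim ℓ ∷ B)
      regroup = ↭-trans
        (solve 6 (λ a b c x g t → a ⊞ b ⊞ c ⊞ x ⊞ (g ⊞ t) ⊜ (c ⊞ x) ⊞ (g ⊞ a ⊞ b ⊞ t)) ↭-refl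
          (∂ (toHub ℓ) ∷ []) (∂ (toRim ℓ) ∷ []) (∂ e₃ ∷ []) (map ∂ X′) Γ (map ∂ B))
        (++⁺ʳ _ (map⁺ ∂ (↭-sym perm)))

  module Hub {A S f q y z e₁ e₂} (T : Tree A S) (f∈ : f ∈ A) (j : Joins f y z)
    (j₁ : Joins e₁ q y) (j₂ : Joins e₂ q z) (q∉ : q ∉ S) where

    hubTree : Tree (e₁ ∷ e₂ ∷ A) (q ∷ S)
    hubTree = attach T f∈ j j₁ j₂ q∉

    private
      hubTree! : Unique (q ∷ S)
      hubTree! = Tree-unique hubTree

    -- `Γ` and `Y` supply at least two vectors that are nonzero at `q`. Once they have cleared `q`,
    -- it is itself a leaf with boundary 0.
    hub-feasible : ∀ Γ → All (Balanced (q ∷ S)) Γ → All (λ w → w q ≢ 0F) Γ →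
      ∀ Y Z → X ↭ Y ++ Z → All (Inside (q ∷ S)) X →
      All (λ e → Incident e q) Y → All (λ e → ¬ Incident e q) Z → 2 ≤ length Γ ℕ.+ length Y →
      Feasible (map ∂ X ++ Γ ++ map ∂ (e₁ ∷ e₂ ∷ A)) (λ _ → 0F)
    hub-feasible Γ cΓ Γq Y Z p inside Yq Zq 2≤ = Feasible-↭ (↭-trans
        (solve 4 (λ g y z t → (g ⊞ y) ⊞ (z ⊞ t) ⊜ (y ⊞ z) ⊞ (g ⊞ t)) ↭-refl Γ (map ∂ Y) (map ∂ Z) _)
        (++⁺ʳ _ (↭-sym (map-∂-↭ Y Z p))))
      (steer {W = Γ ++ map ∂ Y}
        (subst (2 ≤_) (sym (trans (length-++ Γ) (cong (length Γ ℕ.+_) (length-map ∂ Y)))) 2≤)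
        (All.++⁺ cΓ (All-Balanced-∂ hubTree! (All.++⁻ˡ Y insides)))
        (All.++⁺ Γq (All.map⁺ (All.map ∂-incident Yq)))
        (absorb (All-Balanced-∂ hubTree! (All.++⁻ʳ Y insides)) (All.map⁺ (All.map ∂-nonincident Zq))
          (λ γ b γq → leaf-zero-feasible T f∈ j j₁ j₂ b γq))
        _ (Balanced-0 _))
      where
      insides : All (Inside (q ∷ S)) (Y ++ Z)
      insides = All-resp-↭ p inside

    -- Induction on the leaves at `q`. If the third edge of the first one ends at another apex of
    -- `L`, the pair is found. Otherwise its star moves into `Γ`, which keeps `length L + length Γ`
    -- constant; with no leaf left, two vectors at `q` contradict infeasibility. The last hypothesis
    -- keeps `Γ` at 0 on the remaining apexes, where `leaf-third-edge` is still to be applied.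
    spread : ∀ L → All (λ ℓ → base ℓ ∈ e₁ ∷ e₂ ∷ A) L → All (λ ℓ → hub ℓ ≡ q) L →
      Unique (apexes L ++ q ∷ S) →
      ∀ Γ → All (Balanced (apexes L ++ q ∷ S)) Γ → All (λ w → w q ≢ 0F) Γ → 2 ≤ length L ℕ.+ length Γ →
      ∀ X → All (Inside (apexes L ++ q ∷ S)) X →
      ¬ Feasible (map ∂ X ++ Γ ++ map ∂ (leafEdges L ++ e₁ ∷ e₂ ∷ A)) (λ _ → 0F) →
      (∀ ℓ → ℓ ∈ L → All (λ w → w (apex ℓ) ≡ 0F) Γ) →
      AdjacentPair L X
    spread [] _ _ _ Γ cΓ Γq 2≤ X inside infeasible _ with split (λ e → incident? e q) X
    ... | Y , Z , p , Yq , Zq = contradiction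
      (hub-feasible Γ cΓ Γq Y Z p inside Yq Zq (ℕ.≤-trans 2≤ (ℕ.m≤m+n _ _))) infeasible
    spread (ℓ ∷ L) (b∈ ∷ bs∈) (refl ∷ hubs) u@(_ ∷ u′) Γ cΓ Γq 2≤ X inside infeasible off
      with leaf-third-edge (attachAll hubTree L bs∈ u′) (∈-++⁺ʳ (leafEdges L) b∈)
             (base-joins ℓ) (toHub-joins ℓ) (toRim-joins ℓ) (Unique[x∷xs]⇒x∉xs u) cΓ (off ℓ (here refl)) inside infeasible
    ... | thirdEdge e₃ p X′ perm j₃ p≢hub p≢rim avoid with Any.any? (p ≟_) (apexes L)
    ...   | yes p∈ with ∈-apexes⇒ p∈
    ...     | m , L′ , refl , perm′ = adjacentPair ℓ m L′ (↭-prep ℓ perm′) e₃ (∈-resp-↭ (↭-sym perm) (here refl)) j₃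
    spread (ℓ ∷ L) (b∈ ∷ bs∈) (refl ∷ hubs) u@(_ ∷ u′) Γ cΓ Γq 2≤ X inside infeasible off
          | thirdEdge e₃ p X′ perm j₃ p≢hub p≢rim avoid
          | no p∉ = extend (spread L bs∈ hubs u′ (starVector ∷ Γ)
              (star-balanced u q∈ r∈ p∈ ∷ All.zipWith (λ (c , w) → Balanced-tail c w) (cΓ , off ℓ (here refl)))
              (star-hub ∷ Γq) (subst (2 ≤_) (sym (ℕ.+-suc _ _)) 2≤) X′
              (All.zipWith (λ (a , i) → Inside-tail a i) (avoid , All.tail (All-resp-↭ perm inside)))
              (infeasible ∘ cut-leaf {Γ = Γ} {leafEdges L ++ e₁ ∷ e₂ ∷ A} perm)
              off′)
      where
      open LeafStar {ℓ} j₃ p≢hub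
      S₁ : List V
      S₁ = apexes L ++ q ∷ S
      q∈ : q ∈ S₁
      q∈ = ∈-++⁺ʳ (apexes L) (here refl)
      r∈q∷S : rim ℓ ∈ q ∷ S
      r∈q∷S = proj₂ (Inside-joins (Tree-inside hubTree b∈) (base-joins ℓ))
      r∈ : rim ℓ ∈ S₁
      r∈ = ∈-++⁺ʳ (apexes L) r∈q∷S
      p∈ : p ∈ apex ℓ ∷ S₁
      p∈ = proj₂ (Inside-joins (All.head (All-resp-↭ perm inside)) j₃)
      outside : ∀ {m} → m ∈ L → ∀ {v} → v ∈ q ∷ S → apex m ≢ v
      outside {m} m∈ v∈ refl = distinct L u′ (∈-map⁺ apex m∈) v∈
        where
        distinct : ∀ L {x} → Unique (apexes L ++ q ∷ S) → x ∈ apexes L → x ∉ q ∷ S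
        distinct (_ ∷ L) u@(_ ∷ _) (here refl) x∈ = Unique[x∷xs]⇒x∉xs u (∈-++⁺ʳ (apexes L) x∈)
        distinct (_ ∷ L) (_ ∷ u)   (there x∈′) x∈ = distinct L u x∈′ x∈
      -- The star lives on the hub, the rim and `p`. The first two are in the core, and `p` is not
      -- an apex in this case, so the remaining leaves do not notice it.
      off′ : ∀ m → m ∈ L → All (λ w → w (apex m) ≡ 0F) (starVector ∷ Γ)
      off′ m m∈ = star-off
          (λ eq → Unique[x∷xs]⇒x∉xs u (subst (_∈ S₁) eq (∈-++⁺ˡ (∈-map⁺ apex m∈))))
          (outside m∈ (here refl)) (outside m∈ r∈q∷S)
          (λ eq → p∉ (subst (_∈ apexes L) eq (∈-map⁺ apex m∈)))
        ∷ off m (there m∈)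
      extend : AdjacentPair L X′ → AdjacentPair (ℓ ∷ L) X
      extend (adjacentPair l m others chosen e e∈ je) = adjacentPair l m (ℓ ∷ others)
        (↭-trans (↭-prep ℓ chosen) (shifts (ℓ ∷ []) (l ∷ m ∷ [])))
        e (∈-resp-↭ (↭-sym perm) (there e∈)) je

-- Finding a bull

module FindBull {n : ℕ} {E : Set} (G : Multigraph (Fin n) E) (allEdges : List E) where
  open Multigraph G
  open Trees G
  open Bulls G
  open Leaf

  -- The tree on the vertices other than `u` and `v` is kept because it becomes the spanning
  -- triangle-tree of the reduction.
  record Bull : Set where
    field
      u v w a b           : V
      uv uw vw ua vb      : E
      uv-joins            : Joins uv u v
      uw-joins            : Joins uw u w
      vw-joins            : Joins vw v w
      ua-joins            : Joins ua u a
      vb-joins            : Joins vb v b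
      {treeEdges}         : List E
      {treeVertices}      : List V
      tree                : Tree treeEdges treeVertices
      unique              : Unique (u ∷ v ∷ treeVertices)
      full                : ∀ x → x ∈ u ∷ v ∷ treeVertices
      rest                : List E
      edges               : allEdges ↭ uv ∷ uw ∷ vw ∷ ua ∷ vb ∷ treeEdges ++ rest
      rest-avoids         : All (λ e → ¬ Incident e u × ¬ Incident e v) rest
      w∈                  : w ∈ treeVertices
      a∈                  : a ∈ treeVertices
      b∈                  : b ∈ treeVertices
      a≢w                 : a ≢ w
      b≢w                 : b ≢ w

  private variable
    x y z q p : V
    e e₁ e₂ f g : E
    A X : List E
    S : List V

  all-inside : (∀ x → x ∈ S) → ∀ X → All (Inside S) X
  all-inside full X = All.tabulate λ _ → full _ , full _

  module _ (infeasible : ¬ Feasible (map ∂ allEdges) (λ _ → 0F)) where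

    infeasible-↭ : ∀ X A → allEdges ↭ X ++ A → ¬ Feasible (map ∂ X ++ map ∂ A) (λ _ → 0F)
    infeasible-↭ X A p = infeasible ∘ Feasible-↭ (↭-sym (map-∂-↭ X A p))

    leaf-third : ∀ ℓ L → Tree A S → All (λ ℓ → base ℓ ∈ A) (ℓ ∷ L) → Unique (apexes (ℓ ∷ L) ++ S) →
      (∀ x → x ∈ apexes (ℓ ∷ L) ++ S) → allEdges ↭ X ++ leafEdges (ℓ ∷ L) ++ A →
      ThirdEdge (apex ℓ) (hub ℓ) (rim ℓ) X
    leaf-third {X = X} ℓ L T (b∈ ∷ bs∈) u@(_ ∷ u′) full p =
      leaf-third-edge (attachAll T L bs∈ u′) (∈-++⁺ʳ (leafEdges L) b∈) (base-joins ℓ) (toHub-joins ℓ)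
        (toRim-joins ℓ) (Unique[x∷xs]⇒x∉xs u) [] [] (all-inside full X) (infeasible-↭ X (leafEdges (ℓ ∷ L) ++ _) p)

    -- The link lies outside the tree and meets both apexes, so it is the unique third edge of each,
    -- and both have degree three. Their hub `q` is the common neighbour; the rims are `a` and `b`,
    -- which may coincide.
    adjacent⇒bull : Tree A S → ∀ L → All (λ ℓ → base ℓ ∈ A) L → All (λ ℓ → hub ℓ ≡ q) L →
      Unique (apexes L ++ S) → (∀ x → x ∈ apexes L ++ S) → allEdges ↭ X ++ leafEdges L ++ A →
      AdjacentPair L X → Bull
    adjacent⇒bull {A} {S} {q} {X} T L bases hubs unique full perm (adjacentPair ℓ m M chosen e e∈ e-joins)
      with All-resp-↭ chosen bases | All-resp-↭ chosen hubs
    ... | bℓ ∷ bm ∷ bs | hℓ ∷ hm ∷ _ = record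
      { u = apex ℓ ; v = apex m ; w = q ; a = rim ℓ ; b = rim m
      ; uv = e ; uw = toHub ℓ ; vw = toHub m ; ua = toRim ℓ ; vb = toRim m
      ; uv-joins = e-joins
      ; uw-joins = subst (Joins (toHub ℓ) (apex ℓ)) hℓ (toHub-joins ℓ)
      ; vw-joins = subst (Joins (toHub m) (apex m)) hm (toHub-joins m)
      ; ua-joins = toRim-joins ℓ
      ; vb-joins = toRim-joins m
      ; tree = attachAll T M bs (unique-tail (unique-tail unique₁))
      ; unique = unique₁
      ; full = full₁
      ; rest = Thirdℓ.rest
      ; edges = ↭-trans perm₁ (↭-trans (++⁺ʳ _ split-ℓ)
          (solve 7 (λ e h r h′ r′ t x → (e ⊞ x) ⊞ (h ⊞ r ⊞ h′ ⊞ r′ ⊞ t) ⊜ e ⊞ h ⊞ h′ ⊞ r ⊞ r′ ⊞ t ⊞ x) ↭-refl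
            (e ∷ []) (toHub ℓ ∷ []) (toRim ℓ ∷ []) (toHub m ∷ []) (toRim m ∷ []) (leafEdges M ++ A) Thirdℓ.rest))
      ; rest-avoids = All.zip (Thirdℓ.avoids , All-resp-↭ rest≡ Thirdm.avoids)
      ; w∈ = subst (_∈ _) hℓ (in-tree (proj₁ (base-inside bℓ (base-joins ℓ))))
      ; a∈ = in-tree (proj₂ (base-inside bℓ (base-joins ℓ)))
      ; b∈ = in-tree (proj₂ (base-inside bm (base-joins m)))
      ; a≢w = λ { refl → Joins⇒≢ (base-joins ℓ) hℓ }
      ; b≢w = λ { refl → Joins⇒≢ (base-joins m) hm }
      }
      where
      unique-tail : ∀ {x} {xs : List V} → Unique (x ∷ xs) → Unique xs
      unique-tail (_ ∷ u) = u
      base-inside : f ∈ A → Joins f y z → y ∈ S × z ∈ S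
      base-inside f∈ j = Inside-joins (Tree-inside T f∈) j
      in-tree : x ∈ S → x ∈ apexes M ++ S
      in-tree = ∈-++⁺ʳ (apexes M)
      unique₁ : Unique (apexes (ℓ ∷ m ∷ M) ++ S)
      unique₁ = Unique-↭ (++⁺ʳ S (map⁺ apex chosen)) unique
      full₁ : ∀ x → x ∈ apexes (ℓ ∷ m ∷ M) ++ S
      full₁ x = ∈-resp-↭ (++⁺ʳ S (map⁺ apex chosen)) (full x)
      perm₁ : allEdges ↭ X ++ leafEdges (ℓ ∷ m ∷ M) ++ A
      perm₁ = ↭-trans perm (++⁺ˡ X (++⁺ʳ A (leafEdges-↭ chosen)))
      flip : ℓ ∷ m ∷ M ↭ m ∷ ℓ ∷ M
      flip = ↭-swap ℓ m ↭-refl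
      third-ℓ : ThirdEdge (apex ℓ) (hub ℓ) (rim ℓ) X
      third-ℓ = leaf-third ℓ (m ∷ M) T (bℓ ∷ bm ∷ bs) unique₁ full₁ perm₁
      third-m : ThirdEdge (apex m) (hub m) (rim m) X
      third-m = leaf-third m (ℓ ∷ M) T (bm ∷ bℓ ∷ bs)
        (Unique-↭ (++⁺ʳ S (map⁺ apex flip)) unique₁)
        (λ x → ∈-resp-↭ (++⁺ʳ S (map⁺ apex flip)) (full₁ x))
        (↭-trans perm₁ (++⁺ˡ X (++⁺ʳ A (leafEdges-↭ flip))))
      module Thirdℓ = ThirdEdge third-ℓ
      module Thirdm = ThirdEdge third-m
      is-third : ∀ {x y z} (t : ThirdEdge x y z X) → Incident e x → e ≡ ThirdEdge.third t
      is-third t i with ∈-resp-↭ (ThirdEdge.split-off t) e∈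
      ... | here e≡  = e≡
      ... | there e∈ = contradiction i (All.lookup (ThirdEdge.avoids t) e∈)
      split-ℓ : X ↭ e ∷ Thirdℓ.rest
      split-ℓ = subst (λ d → X ↭ d ∷ Thirdℓ.rest) (sym (is-third third-ℓ (joins-incidentˡ e-joins))) Thirdℓ.split-off
      split-m : X ↭ e ∷ Thirdm.rest
      split-m = subst (λ d → X ↭ d ∷ Thirdm.rest) (sym (is-third third-m (joins-incidentʳ e-joins))) Thirdm.split-off
      -- Both splittings remove the same link from `X`, so one remainder avoids both apexes.
      rest≡ : Thirdm.rest ↭ Thirdℓ.rest
      rest≡ = drop-∷ (↭-trans (↭-sym split-m) split-ℓ)

    -- The star of `ℓ` is one vector at `q`; another edge outside the tree at `q` would be a second,
    -- and `hub-feasible` would apply. So `q` has only the edges `toHub ℓ`, `e₁` and `e₂`. One of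
    -- the last two is the base of `ℓ`: its other end, the rim, is the common neighbour, and the
    -- remaining edge leads to `b`.
    lone-leaf⇒bull : Tree A S → f ∈ A → Joins f y z → Joins e₁ q y → Joins e₂ q z → q ∉ S →
      ∀ ℓ → base ℓ ∈ e₁ ∷ e₂ ∷ A → hub ℓ ≡ q → apex ℓ ∉ q ∷ S → (∀ x → x ∈ apex ℓ ∷ q ∷ S) →
      allEdges ↭ X ++ leafEdges (ℓ ∷ []) ++ e₁ ∷ e₂ ∷ A → Bull
    lone-leaf⇒bull {A} {S} {f} {y} {z} {e₁} {q} {e₂} {X} T f∈ j j₁ j₂ q∉ ℓ b∈ refl x∉ full perm =
      go (split (λ e → incident? e q) Third.rest)
      where
      open Hub T f∈ j j₁ j₂ q∉
      u! : Unique (apex ℓ ∷ q ∷ S)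
      u! = ∉⇒unique x∉ (Tree-unique hubTree)
      third-ℓ : ThirdEdge (apex ℓ) q (rim ℓ) X
      third-ℓ = leaf-third ℓ [] hubTree (b∈ ∷ []) u! full perm
      module Third = ThirdEdge third-ℓ
      open LeafStar {ℓ} Third.joins Third.far≢y
      y∈ : y ∈ S
      y∈ = proj₁ (Inside-joins (Tree-inside T f∈) j)
      z∈ : z ∈ S
      z∈ = proj₂ (Inside-joins (Tree-inside T f∈) j)
      far∈ : Third.far ∈ S
      far∈ with full Third.far
      ... | here eq          = contradiction (sym eq) (Joins⇒≢ Third.joins)
      ... | there (here eq)  = contradiction eq Third.far≢y
      ... | there (there p∈) = p∈
      star-ok : Balanced (q ∷ S) starVector
      star-ok = star-balanced u! (here refl)
        (proj₂ (Inside-joins (Tree-inside hubTree b∈) (base-joins ℓ))) (full _)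
      bull : All (λ e → ¬ Incident e q) Third.rest → e₁ ∷ e₂ ∷ A ↭ base ℓ ∷ e ∷ A → Joins e q p →
        p ∈ S → p ≢ rim ℓ → rim ℓ ∈ S → Bull
      bull {e} {p} avoids perm′ e-joins p∈ p≢r r∈ = record
        { u = apex ℓ ; v = q ; w = rim ℓ ; a = Third.far ; b = p
        ; uv = toHub ℓ ; uw = toRim ℓ ; vw = base ℓ ; ua = Third.third ; vb = e
        ; uv-joins = toHub-joins ℓ ; uw-joins = toRim-joins ℓ ; vw-joins = base-joins ℓ
        ; ua-joins = Third.joins ; vb-joins = e-joins
        ; tree = T ; unique = u! ; full = full
        ; rest = Third.rest
        ; edges = ↭-trans perm (↭-trans (++⁺ Third.split-off (++⁺ˡ (toHub ℓ ∷ toRim ℓ ∷ []) perm′))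
            (solve 7 (λ t x h r b e a → (t ⊞ x) ⊞ (h ⊞ r ⊞ b ⊞ e ⊞ a) ⊜ h ⊞ r ⊞ b ⊞ t ⊞ e ⊞ a ⊞ x) ↭-refl
              (Third.third ∷ []) Third.rest (toHub ℓ ∷ []) (toRim ℓ ∷ []) (base ℓ ∷ []) (e ∷ []) A))
        ; rest-avoids = All.zip (Third.avoids , avoids)
        ; w∈ = r∈ ; a∈ = far∈ ; b∈ = p∈
        ; a≢w = Third.far≢z ; b≢w = p≢r
        }
      go : ∃[ Y ] ∃[ Z ] Third.rest ↭ Y ++ Z × All (λ e → Incident e q) Y × All (λ e → ¬ Incident e q) Z → Bull
      go ([] , Z , p , [] , Zq) = pick b∈
        where
        avoids : All (λ e → ¬ Incident e q) Third.rest
        avoids = All-resp-↭ (↭-sym p) Zq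
        pick : base ℓ ∈ e₁ ∷ e₂ ∷ A → Bull
        pick (here b≡) = bull avoids (↭-reflexive (cong (λ e → e ∷ e₂ ∷ A) (sym b≡))) j₂ z∈
            (λ z≡r → Joins⇒≢ j (trans r≡y (sym z≡r))) (subst (_∈ S) r≡y y∈)
          where
          r≡y : y ≡ rim ℓ
          r≡y = joins-other j₁ (subst (λ e → Joins e q (rim ℓ)) b≡ (base-joins ℓ))
        pick (there (here b≡)) = bull avoids
            (↭-trans (↭-swap e₁ e₂ ↭-refl) (↭-reflexive (cong (λ e → e ∷ e₁ ∷ A) (sym b≡)))) j₁ y∈
            (λ y≡r → Joins⇒≢ j (trans y≡r (sym r≡z))) (subst (_∈ S) r≡z z∈)
          where
          r≡z : z ≡ rim ℓ
          r≡z = joins-other j₂ (subst (λ e → Joins e q (rim ℓ)) b≡ (base-joins ℓ))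
        -- A base in the older tree would force its end `q` into `S`.
        pick (there (there b∈A)) = contradiction (proj₁ (Inside-joins (Tree-inside T b∈A) (base-joins ℓ))) q∉
      go (Y@(_ ∷ _) , Z , p , Yq , Zq) = contradiction
        (cut-leaf {Γ = []} {e₁ ∷ e₂ ∷ A} Third.split-off
          (hub-feasible (starVector ∷ []) (star-ok ∷ []) (star-hub ∷ []) Y Z p
            (All.zipWith (λ (a , i) → Inside-tail a i)
              (Third.avoids , All.tail (All-resp-↭ Third.split-off (all-inside full X))))
            Yq Zq (s≤s (s≤s z≤n))))
        (infeasible-↭ X (leafEdges (ℓ ∷ []) ++ e₁ ∷ e₂ ∷ A) perm)

    -- Leaves whose base meets `q` are turned so that `q` becomes their hub; the others rest on `A`
    -- and can do without `q`.
    record Separation (A B : List E) (q : V) (L : List Leaf) : Set where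
      constructor separation
      field
        atHub others    : List Leaf
        atHub-hubs      : All (λ ℓ → hub ℓ ≡ q) atHub
        atHub-bases     : All (λ ℓ → base ℓ ∈ B) atHub
        others-bases    : All (λ ℓ → base ℓ ∈ A) others
        leafEdges-split : leafEdges L ↭ leafEdges atHub ++ leafEdges others
        apexes-split    : apexes L ↭ apexes atHub ++ apexes others

    separate : ∀ {A B} L → All (λ ℓ → base ℓ ∈ B × (Incident (base ℓ) q ⊎ base ℓ ∈ A)) L → Separation A B q L
    separate [] [] = separation [] [] [] [] [] ↭-refl ↭-refl
    separate {q} (ℓ ∷ L) ((b∈B , which) ∷ bs) with separate L bs
    ... | separation M N hubs bases bases′ edges vertices = place which
      where
      place : Incident (base ℓ) q ⊎ base ℓ ∈ _ → Separation _ _ q (ℓ ∷ L)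
      place (inj₂ b∈A) = separation M (ℓ ∷ N) hubs bases (b∈A ∷ bases′)
        (↭-trans (++⁺ˡ _ edges) (shifts (toHub ℓ ∷ toRim ℓ ∷ []) (leafEdges M)))
        (↭-trans (↭-prep _ vertices) (shifts (apex ℓ ∷ []) (apexes M)))
      place (inj₁ i) with joins-incident⇒ (base-joins ℓ) i
      ... | inj₁ q≡hub = separation (ℓ ∷ M) N (sym q≡hub ∷ hubs) (b∈B ∷ bases) bases′
        (++⁺ˡ _ edges) (↭-prep _ vertices)
      ... | inj₂ q≡rim = separation (flipLeaf ℓ ∷ M) N (sym q≡rim ∷ hubs) (b∈B ∷ bases) bases′
        (↭-swap _ _ edges) (↭-prep _ vertices)

    -- Vertices that carry no leaf are peeled off and become leaves themselves,
    -- until a vertex q with leaves on its two edges is found.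
    peel : Tree A S → ∀ L → All (λ ℓ → base ℓ ∈ A) L → Unique (apexes L ++ S) → (∀ x → x ∈ apexes L ++ S) →
      allEdges ↭ X ++ leafEdges L ++ A → 3 ≤ length L ℕ.+ length S → Bull
    peel (edge j) [] _ _ _ _ (s≤s (s≤s ()))
    peel {X = X} T₀@(edge {f} {y} {z} j) L@(_ ∷ _) bases unique full perm _
      with separate {q = y} {[]} {f ∷ []} L (All.map (λ { b@(here refl) → b , inj₁ (joins-incidentˡ j) }) bases)
    ... | separation []      []      _ _ _       _ vertices =
      contradiction (∈-resp-↭ vertices (here refl)) λ ()
    ... | separation M       (_ ∷ _) _ _ (() ∷ _) _ _
    ... | separation (ℓ ∷ M) []      (hub≡ ∷ hubs) (b∈@(here refl) ∷ bs) _ edges vertices =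
      adjacent⇒bull T₀ (ℓ ∷ M) (b∈ ∷ bs) (hub≡ ∷ hubs) unique₁ full₁ perm₁ pair
      where
      vertices₁ : apexes L ↭ apexes (ℓ ∷ M)
      vertices₁ = ↭-trans vertices (++-comm _ [])
      unique₁ : Unique (apexes (ℓ ∷ M) ++ y ∷ z ∷ [])
      unique₁ = Unique-↭ (++⁺ʳ _ vertices₁) unique
      full₁ : ∀ x → x ∈ apexes (ℓ ∷ M) ++ y ∷ z ∷ []
      full₁ x = ∈-resp-↭ (++⁺ʳ _ vertices₁) (full x)
      perm₁ : allEdges ↭ X ++ leafEdges (ℓ ∷ M) ++ f ∷ []
      perm₁ = ↭-trans perm (++⁺ˡ X (++⁺ʳ _ (↭-trans edges (++-comm _ []))))
      module Third = ThirdEdge (leaf-third ℓ M T₀ (b∈ ∷ bs) unique₁ full₁ perm₁)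
      z≡rim : z ≡ rim ℓ
      z≡rim = joins-other j (subst (λ h → Joins (base ℓ) h (rim ℓ)) hub≡ (base-joins ℓ))
      -- The third edge avoids both ends of the only base, and every other vertex is an apex.
      far∈ : Third.far ∈ apexes M
      far∈ with full₁ Third.far
      ... | here p≡   = contradiction (sym p≡) (Joins⇒≢ Third.joins)
      ... | there p∈  with ∈-++⁻ (apexes M) p∈
      ...   | inj₁ p∈M                 = p∈M
      ...   | inj₂ (here p≡y)          = contradiction (trans p≡y (sym hub≡)) Third.far≢y
      ...   | inj₂ (there (here p≡z))  = contradiction (trans p≡z z≡rim) Third.far≢z
      pair : AdjacentPair (ℓ ∷ M) X
      pair with ∈-apexes⇒ far∈
      ... | m , M′ , p≡ , chosen = adjacentPair ℓ m M′ (↭-prep ℓ chosen) Third.third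
        (∈-resp-↭ (↭-sym Third.split-off) (here refl))
        (subst (Joins Third.third (apex ℓ)) p≡ Third.joins)
    peel {X = X} (attach {A = A} {S} {f} {y} {z} {e₁} {q} {e₂} T f∈ j j₁ j₂ q∉) L bases unique full perm _
      with separate {q = q} {A} {e₁ ∷ e₂ ∷ A} L (All.map (λ {ℓ} → sort {ℓ}) bases)
      where
      sort : ∀ {ℓ} → base ℓ ∈ e₁ ∷ e₂ ∷ A → base ℓ ∈ e₁ ∷ e₂ ∷ A × (Incident (base ℓ) q ⊎ base ℓ ∈ A)
      sort b∈@(here refl)         = b∈ , inj₁ (joins-incidentˡ j₁)
      sort b∈@(there (here refl)) = b∈ , inj₁ (joins-incidentˡ j₂)
      sort b∈@(there (there b∈A)) = b∈ , inj₂ b∈A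
    ... | separation M N hubs bs bs′ edges vertices = cases M hubs bs perm₁ unique₁ full₁
      where
      vertices₁ : apexes L ++ q ∷ S ↭ apexes M ++ q ∷ apexes N ++ S
      vertices₁ = ↭-trans (++⁺ʳ (q ∷ S) vertices)
        (solve 4 (λ m n q s → (m ⊞ n) ⊞ q ⊞ s ⊜ m ⊞ q ⊞ n ⊞ s) ↭-refl (apexes M) (apexes N) (q ∷ []) S)
      unique₁ : Unique (apexes M ++ q ∷ apexes N ++ S)
      unique₁ = Unique-↭ vertices₁ unique
      full₁ : ∀ x → x ∈ apexes M ++ q ∷ apexes N ++ S
      full₁ x = ∈-resp-↭ vertices₁ (full x)
      perm₁ : allEdges ↭ X ++ leafEdges M ++ e₁ ∷ e₂ ∷ leafEdges N ++ A
      perm₁ = ↭-trans perm (++⁺ˡ X (↭-trans (++⁺ʳ _ edges)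
        (solve 4 (λ m n q s → (m ⊞ n) ⊞ q ⊞ s ⊜ m ⊞ q ⊞ n ⊞ s) ↭-refl (leafEdges M) (leafEdges N) (e₁ ∷ e₂ ∷ []) A)))

      cases : ∀ M → All (λ ℓ → hub ℓ ≡ q) M → All (λ ℓ → base ℓ ∈ e₁ ∷ e₂ ∷ A) M →
        allEdges ↭ X ++ leafEdges M ++ e₁ ∷ e₂ ∷ leafEdges N ++ A →
        Unique (apexes M ++ q ∷ apexes N ++ S) → (∀ x → x ∈ apexes M ++ q ∷ apexes N ++ S) → Bull
      cases [] _ _ perm₂ unique₂ full₂ = peel {X = X} T (leaf ∷ N) (f∈ ∷ bs′) unique₂ full₂ perm₂
        (s≤s (ℕ.≤-trans (Tree-length T) (ℕ.m≤n+m _ _)))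
        where
        leaf : Leaf
        leaf = record { apex = q ; hub = y ; rim = z ; toHub = e₁ ; toRim = e₂ ; base = f
          ; base-joins = j ; toHub-joins = j₁ ; toRim-joins = j₂ }
      cases M@(_ ∷ _) hubs bs perm₂ unique₂ full₂ = branch M (s≤s z≤n) hubs bs″ perm₂ unique₂ full₂
        where
        lift : ∀ {ℓ} → base ℓ ∈ e₁ ∷ e₂ ∷ A → base ℓ ∈ e₁ ∷ e₂ ∷ leafEdges N ++ A
        lift (here b≡)          = here b≡
        lift (there (here b≡))  = there (here b≡)
        lift (there (there b∈)) = there (there (∈-++⁺ʳ (leafEdges N) b∈))
        bs″ : All (λ ℓ → base ℓ ∈ e₁ ∷ e₂ ∷ leafEdges N ++ A) M
        bs″ = All.map (λ {ℓ} → lift {ℓ}) bs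
        N! : Unique (q ∷ apexes N ++ S)
        N! = Unique-++⁻ʳ (apexes M) unique₂
        -- Leaves away from `q` are attached before `q`, so that only the leaves on the edges of `q`
        -- come after it.
        T′ : Tree (leafEdges N ++ A) (apexes N ++ S)
        T′ = attachAll T N bs′ (Unique-++⁻ʳ (q ∷ []) N!)
        f∈′ : f ∈ leafEdges N ++ A
        f∈′ = ∈-++⁺ʳ (leafEdges N) f∈
        q∉′ : q ∉ apexes N ++ S
        q∉′ = Unique[x∷xs]⇒x∉xs N!
        open Hub T′ f∈′ j j₁ j₂ q∉′
        branch : ∀ M → 1 ≤ length M → All (λ ℓ → hub ℓ ≡ q) M → All (λ ℓ → base ℓ ∈ e₁ ∷ e₂ ∷ leafEdges N ++ A) M →
          allEdges ↭ X ++ leafEdges M ++ e₁ ∷ e₂ ∷ leafEdges N ++ A →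
          Unique (apexes M ++ q ∷ apexes N ++ S) → (∀ x → x ∈ apexes M ++ q ∷ apexes N ++ S) → Bull
        branch (ℓ ∷ []) _ (hub≡ ∷ []) (b∈ ∷ []) p u full =
          lone-leaf⇒bull {X = X} T′ f∈′ j j₁ j₂ q∉′ ℓ b∈ hub≡ (Unique[x∷xs]⇒x∉xs u) full p
        branch M@(_ ∷ _ ∷ _) _ hubs bs p u full =
          adjacent⇒bull {X = X} hubTree M bs hubs u full p
            (spread M bs hubs u [] [] [] (s≤s (s≤s z≤n)) X (all-inside full X)
              (infeasible-↭ X (leafEdges M ++ e₁ ∷ e₂ ∷ leafEdges N ++ A) p) λ _ _ → [])

-- From flows modulo 3 to integral flows

residueℕ : ℕ → ℤ₃
residueℕ zero    = 0F
residueℕ (suc k) = 1F ⊕ residueℕ k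

residue : ℤ → ℤ₃
residue (+ k)    = residueℕ k
residue -[1+ k ] = ⊝ residueℕ (suc k)

residueℕ-+ : ∀ j k → residueℕ (j ℕ.+ k) ≡ residueℕ j ⊕ residueℕ k
residueℕ-+ zero    k = refl
residueℕ-+ (suc j) k = trans (cong (1F ⊕_) (residueℕ-+ j k)) (sym (⊕-assoc 1F (residueℕ j) (residueℕ k)))

residue-⊖ : ∀ j k → residue (j ℤ.⊖ k) ≡ residueℕ j ⊕ ⊝ residueℕ k
residue-⊖ j       zero    = sym (⊕-identityʳ (residueℕ j))
residue-⊖ zero    (suc k) = refl
residue-⊖ (suc j) (suc k) = trans (cong residue (ℤ.[1+m]⊖[1+n]≡m⊖n j k))
  (trans (residue-⊖ j k) (lemma (residueℕ j) (residueℕ k)))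
  where
  lemma : ∀ a b → a ⊕ ⊝ b ≡ 1F ⊕ a ⊕ ⊝ (1F ⊕ b)
  lemma = from-yes (all? λ a → all? λ b → a ⊕ ⊝ b ≟ 1F ⊕ a ⊕ ⊝ (1F ⊕ b))

⊕-comm : ∀ a b → a ⊕ b ≡ b ⊕ a
⊕-comm = from-yes (all? λ a → all? λ b → a ⊕ b ≟ b ⊕ a)

residue-+ : ∀ i j → residue (i ℤ.+ j) ≡ residue i ⊕ residue j
residue-+ (+ i)    (+ j)    = residueℕ-+ i j
residue-+ (+ i)    -[1+ j ] = residue-⊖ i (suc j)
residue-+ -[1+ i ] (+ j)    = trans (residue-⊖ j (suc i)) (⊕-comm (residueℕ j) _)
residue-+ -[1+ i ] -[1+ j ] = trans (cong (λ a → ⊝ (1F ⊕ (1F ⊕ a))) (residueℕ-+ i j)) (lemma (residueℕ i) (residueℕ j))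
  where
  lemma : ∀ a b → ⊝ (1F ⊕ (1F ⊕ (a ⊕ b))) ≡ ⊝ (1F ⊕ a) ⊕ ⊝ (1F ⊕ b)
  lemma = from-yes (all? λ a → all? λ b → ⊝ (1F ⊕ (1F ⊕ (a ⊕ b))) ≟ ⊝ (1F ⊕ a) ⊕ ⊝ (1F ⊕ b))

Σ₃ : ∀ {m} → (Fin m → ℤ₃) → ℤ₃
Σ₃ {zero}  f = 0F
Σ₃ {suc m} f = f zero ⊕ Σ₃ (f ∘ suc)

Σ₃-cong : ∀ {m} {f g : Fin m → ℤ₃} → (∀ i → f i ≡ g i) → Σ₃ f ≡ Σ₃ g
Σ₃-cong {zero}  f≗g = refl
Σ₃-cong {suc m} f≗g = cong₂ _⊕_ (f≗g zero) (Σ₃-cong (f≗g ∘ suc))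

Σ₃-subtract : ∀ {m} (f g : Fin m → ℤ₃) → Σ₃ (λ i → f i ⊕ ⊝ g i) ≡ Σ₃ f ⊕ ⊝ Σ₃ g
Σ₃-subtract {zero}  f g = refl
Σ₃-subtract {suc m} f g = trans (cong (f zero ⊕ ⊝ g zero ⊕_) (Σ₃-subtract (f ∘ suc) (g ∘ suc)))
  (lemma (f zero) (g zero) _ _)
  where
  lemma : ∀ a b c d → a ⊕ ⊝ b ⊕ (c ⊕ ⊝ d) ≡ a ⊕ c ⊕ ⊝ (b ⊕ d)
  lemma = from-yes (all? λ a → all? λ b → all? λ c → all? λ d → a ⊕ ⊝ b ⊕ (c ⊕ ⊝ d) ≟ a ⊕ c ⊕ ⊝ (b ⊕ d))

module _ {V : Set} where

  signs⇒feasible : ∀ {m} {w : Fin m → V → ℤ₃} {β} (s : Fin m → Sign) →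
    (∀ x → β x ⊕ Σ₃ (λ e → ⟦ s e ⟧ ⊗ w e x) ≡ 0F) → Feasible (tabulate w) β
  signs⇒feasible {zero}              s eq x = trans (sym (⊕-identityʳ _)) (eq x)
  signs⇒feasible {suc m} {w} {β} s eq =
    s zero , signs⇒feasible (s ∘ suc) λ x → trans (⊕-assoc (β x) (⟦ s zero ⟧ ⊗ w zero x) (Σ₃ λ e → ⟦ s (suc e) ⟧ ⊗ w (suc e) x)) (eq x)

  feasible⇒signs : ∀ {m} {w : Fin m → V → ℤ₃} {β} → Feasible (tabulate w) β →
    ∃ λ (s : Fin m → Sign) → ∀ x → β x ⊕ Σ₃ (λ e → ⟦ s e ⟧ ⊗ w e x) ≡ 0F
  feasible⇒signs {zero}      h = (λ ()) , λ x → trans (⊕-identityʳ _) (h x)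
  feasible⇒signs {suc m} {w} {β} (s₀ , h) =
    let t , eq = feasible⇒signs {w = w ∘ suc} h
        s : Fin (suc m) → Sign
        s = λ { zero → s₀ ; (suc e) → t e }
    in s , λ x → trans (sym (⊕-assoc (β x) (⟦ s₀ ⟧ ⊗ w zero x) (Σ₃ λ e → ⟦ t e ⟧ ⊗ w (suc e) x))) (eq x)

private module ℤSum = FinSum ℤ.+-0-commutativeMonoid

opaque
  sum : ∀ {m} → (Fin m → ℤ) → ℤ
  sum = ℤSum.sum

  sum-def : ∀ {m} (f : Fin m → ℤ) → sum f ≡ ℤSum.sum f
  sum-def f = refl

  sum-suc : ∀ {m} (f : Fin (suc m) → ℤ) → sum f ≡ f zero ℤ.+ sum (f ∘ suc)
  sum-suc f = refl

  sum-cong : ∀ {m} {f g : Fin m → ℤ} → (∀ i → f i ≡ g i) → sum f ≡ sum g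
  sum-cong = ℤSum.sum-cong-≗

  sum-comm : ∀ {m n} (f : Fin m → Fin n → ℤ) → sum (λ i → sum (f i)) ≡ sum (λ j → sum (λ i → f i j))
  sum-comm = ℤSum.∑-comm

  sum-+ : ∀ {m} (f g : Fin m → ℤ) → sum (λ i → f i ℤ.+ g i) ≡ sum f ℤ.+ sum g
  sum-+ = ℤSum.∑-distrib-+

  residue-sum : ∀ {m} (f : Fin m → ℤ) → residue (sum f) ≡ Σ₃ (residue ∘ f)
  residue-sum {zero}  f = refl
  residue-sum {suc m} f = trans (residue-+ (f zero) _) (cong (residue (f zero) ⊕_) (residue-sum (f ∘ suc)))

  sum-zero : ∀ m → sum {m} (λ _ → 0ℤ) ≡ 0ℤ
  sum-zero zero    = refl
  sum-zero (suc m) = trans (ℤ.+-identityˡ _) (sum-zero m)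

  sum-mono : ∀ {m} {f g : Fin m → ℤ} → (∀ i → f i ℤ.≤ g i) → sum f ℤ.≤ sum g
  sum-mono {zero}  f≤g = ℤ.≤-refl
  sum-mono {suc m} f≤g = ℤ.+-mono-≤ (f≤g zero) (sum-mono (f≤g ∘ suc))

  sum-mono-< : ∀ {m} {f g : Fin m → ℤ} → (∀ i → f i ℤ.≤ g i) → ∀ i → f i ℤ.< g i → sum f ℤ.< sum g
  sum-mono-< f≤g zero    f<g = ℤ.+-mono-<-≤ f<g (sum-mono (f≤g ∘ suc))
  sum-mono-< f≤g (suc i) f<g = ℤ.+-mono-≤-< (f≤g zero) (sum-mono-< (f≤g ∘ suc) i f<g)

  sum-* : ∀ {m} c (f : Fin m → ℤ) → sum (λ i → c ℤ.* f i) ≡ c ℤ.* sum f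
  sum-* {zero}  c f = sym (ℤ.*-zeroʳ c)
  sum-* {suc m} c f = trans (cong (λ a → c ℤ.* f zero ℤ.+ a) (sum-* c (f ∘ suc))) (sym (ℤ.*-distribˡ-+ c (f zero) _))

𝟙 : ∀ {m} → Fin m → Fin m → ℤ
𝟙 x y = if does (x ≟ y) then 1ℤ else 0ℤ

𝟙-self : ∀ {m} (x : Fin m) → 𝟙 x x ≡ 1ℤ
𝟙-self x rewrite dec-true (x ≟ x) refl = refl

𝟙-other : ∀ {m} {x y : Fin m} → x ≢ y → 𝟙 x y ≡ 0ℤ
𝟙-other {x = x} {y} x≢y rewrite dec-false (x ≟ y) x≢y = refl

sum-𝟙 : ∀ {m} (x : Fin m) (f : Fin m → ℤ) → sum (λ y → 𝟙 x y ℤ.* f y) ≡ f x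
sum-𝟙 {suc m} zero    f = trans (sum-suc _) (trans
  (cong₂ ℤ._+_ (ℤ.*-identityˡ (f zero)) (sum-zero m)) (ℤ.+-identityʳ (f zero)))
sum-𝟙 {suc m} (suc x) f = trans (sum-suc _) (trans (ℤ.+-identityˡ _) (sum-𝟙 x (f ∘ suc)))

data FlowValue : ℤ → Set where
  one       : FlowValue 1ℤ
  two       : FlowValue (+ 2)
  minus-one : FlowValue -1ℤ
  minus-two : FlowValue -[1+ 1 ]

-- Subtracting 3 turns 1 and 2 into -2 and -1. A positive value can thus be lowered by 3 without
-- leaving the admissible values or changing its residue.
FlowValue-lower : ∀ {a} → FlowValue a → 0ℤ ℤ.< a → FlowValue (a ℤ.- + 3)
FlowValue-lower one _ = minus-two
FlowValue-lower two _ = minus-one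
FlowValue-lower minus-one ()
FlowValue-lower minus-two ()

FlowValue-raise : ∀ {a} → FlowValue a → 0ℤ ℤ.< ℤ.- a → FlowValue (a ℤ.+ + 3)
FlowValue-raise minus-one _ = two
FlowValue-raise minus-two _ = one
FlowValue-raise one ()
FlowValue-raise two ()

module Integral {n m : ℕ} (G : Multigraph (Fin n) (Fin m)) where
  open Multigraph G
  open Trees G

  tail head : Fin m → Fin n
  tail = proj₁ ∘ ends
  head = proj₂ ∘ ends

  excess : (Fin m → ℤ) → Fin n → ℤ
  excess f x = sum λ e → f e ℤ.* (𝟙 (tail e) x ℤ.- 𝟙 (head e) x)

  -- Summation by parts. For `ρ` constant it shows that the excesses add up to 0; for `ρ` the
  -- indicator of a set it expresses the total excess of the set as its net outflow.
  excess-sum : ∀ f (ρ : Fin n → ℤ) →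
    sum (λ x → ρ x ℤ.* excess f x) ≡ sum (λ e → f e ℤ.* (ρ (tail e) ℤ.- ρ (head e)))
  excess-sum f ρ = begin
    sum (λ x → ρ x ℤ.* excess f x)
      ≡⟨ sum-cong (λ x → sum-* (ρ x) _) ⟨
    sum (λ x → sum (λ e → ρ x ℤ.* (f e ℤ.* (𝟙 (tail e) x ℤ.- 𝟙 (head e) x))))
      ≡⟨ sum-comm _ ⟩
    sum (λ e → sum (λ x → ρ x ℤ.* (f e ℤ.* (𝟙 (tail e) x ℤ.- 𝟙 (head e) x))))
      ≡⟨ sum-cong (λ e → trans (sum-cong (λ x → rearrange (ρ x) (f e) (𝟙 (tail e) x) (𝟙 (head e) x)))
           (trans (sum-+ _ _) (cong₂ ℤ._+_ (sum-𝟙 (tail e) (λ x → f e ℤ.* ρ x)) (sum-𝟙 (head e) (λ x → ℤ.- f e ℤ.* ρ x))))) ⟩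
    sum (λ e → f e ℤ.* ρ (tail e) ℤ.+ ℤ.- f e ℤ.* ρ (head e))
      ≡⟨ sum-cong (λ e → collect (f e) (ρ (tail e)) (ρ (head e))) ⟩
    sum (λ e → f e ℤ.* (ρ (tail e) ℤ.- ρ (head e))) ∎
    where
    open ≡-Reasoning
    rearrange : ∀ r a t h → r ℤ.* (a ℤ.* (t ℤ.- h)) ≡ t ℤ.* (a ℤ.* r) ℤ.+ h ℤ.* (ℤ.- a ℤ.* r)
    rearrange = solve-∀
    collect : ∀ a r s → a ℤ.* r ℤ.+ ℤ.- a ℤ.* s ≡ a ℤ.* (r ℤ.- s)
    collect = solve-∀

  bump : (Fin m → ℤ) → Fin m → ℤ → Fin m → ℤ
  bump f e d i = f i ℤ.+ 𝟙 e i ℤ.* d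

  excess-bump : ∀ f e d x → excess (bump f e d) x ≡ excess f x ℤ.+ d ℤ.* (𝟙 (tail e) x ℤ.- 𝟙 (head e) x)
  excess-bump f e d x = trans
    (sum-cong λ i → rearrange (f i) (𝟙 e i) d (𝟙 (tail i) x ℤ.- 𝟙 (head i) x))
    (trans (sum-+ _ _) (cong (λ a → excess f x ℤ.+ a) (sum-𝟙 e (λ i → d ℤ.* (𝟙 (tail i) x ℤ.- 𝟙 (head i) x)))))
    where
    rearrange : ∀ a b d c → (a ℤ.+ b ℤ.* d) ℤ.* c ≡ a ℤ.* c ℤ.+ b ℤ.* (d ℤ.* c)
    rearrange = solve-∀

  bump-elsewhere : ∀ f {e i} d → e ≢ i → bump f e d i ≡ f i
  bump-elsewhere f {e} {i} d e≢i rewrite 𝟙-other e≢i = ℤ.+-identityʳ (f i)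

  ThreeDivides : (Fin m → ℤ) → Set
  ThreeDivides f = ∀ x → residue (excess f x) ≡ 0F

  Ranged : (Fin m → ℤ) → Set
  Ranged f = ∀ e → FlowValue (f e)

  excess-residue : ∀ f x → residue (excess f x) ≡ Σ₃ (λ e → residue (f e ℤ.* (𝟙 (tail e) x ℤ.- 𝟙 (head e) x)))
  excess-residue f x = residue-sum (λ e → f e ℤ.* (𝟙 (tail e) x ℤ.- 𝟙 (head e) x))

  module Augment (f : Fin m → ℤ) (ranged : Ranged f) (x₀ : Fin n) where

    -- Three units of excess have travelled from `x₀` to `u` along edges inside `R`. By `agrees`, an
    -- edge crossing out of `R` still has its original value and is free to prolong the path.
    record Shift (R : List (Fin n)) (u : Fin n) : Set where
      field
        f′      : Fin m → ℤ
        ranged′ : Ranged f′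
        excess′ : ∀ x → excess f′ x ≡ excess f x ℤ.+ + 3 ℤ.* (𝟙 u x ℤ.- 𝟙 x₀ x)
        agrees  : ∀ e → tail e ∉ R ⊎ head e ∉ R → f′ e ≡ f e

    start : Shift (x₀ ∷ []) x₀
    start = record
      { f′ = f ; ranged′ = ranged
      ; excess′ = λ x → lemma (excess f x) (𝟙 x₀ x)
      ; agrees = λ _ _ → refl }
      where
      lemma : ∀ a b → a ≡ a ℤ.+ + 3 ℤ.* (b ℤ.- b)
      lemma = solve-∀

    weaken : ∀ {R u v} → Shift R u → Shift (v ∷ R) u
    weaken s = record
      { f′ = Shift.f′ s ; ranged′ = Shift.ranged′ s ; excess′ = Shift.excess′ s
      ; agrees = λ e → Shift.agrees s e ∘ Sum.map (_∘ there) (_∘ there) }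

    extend : ∀ {R u v} → Shift R u → ∀ e d → u ∈ R → v ∉ R → (tail e ∉ R ⊎ head e ∉ R) →
      (∀ y → d ℤ.* (𝟙 (tail e) y ℤ.- 𝟙 (head e) y) ≡ + 3 ℤ.* (𝟙 v y ℤ.- 𝟙 u y)) →
      tail e ∈ v ∷ R → head e ∈ v ∷ R →
      FlowValue (f e ℤ.+ d) → Shift (v ∷ R) v
    extend {R} {u} {v} s e d u∈ v∉ crossing moves t∈ h∈ value = record
      { f′ = bump f′ e d
      ; ranged′ = ranged″
      ; excess′ = λ y → trans (excess-bump f′ e d y) (trans (cong₂ ℤ._+_ (excess′ y) (moves y))
          (lemma (excess f y) (𝟙 u y) (𝟙 x₀ y) (𝟙 v y)))
      ; agrees = agrees″ }
      where
      open Shift s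
      lemma : ∀ a u x v → a ℤ.+ + 3 ℤ.* (u ℤ.- x) ℤ.+ + 3 ℤ.* (v ℤ.- u) ≡ a ℤ.+ + 3 ℤ.* (v ℤ.- x)
      lemma = solve-∀
      ranged″ : Ranged (bump f′ e d)
      ranged″ i with e ≟ i
      ... | yes refl = subst FlowValue (trans (cong (ℤ._+ d) (sym (agrees e crossing)))
              (cong (λ a → f′ e ℤ.+ a) (sym (ℤ.*-identityˡ d)))) value
      ... | no  e≢i  = subst FlowValue (sym (ℤ.+-identityʳ (f′ i))) (ranged′ i)
      agrees″ : ∀ i → tail i ∉ v ∷ R ⊎ head i ∉ v ∷ R → bump f′ e d i ≡ f i
      agrees″ i out = trans (bump-elsewhere f′ {e} {i} d λ { refl → avoid out })
          (agrees i (Sum.map (_∘ there) (_∘ there) out))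
        where
        avoid : ¬ (tail e ∉ v ∷ R ⊎ head e ∉ v ∷ R)
        avoid (inj₁ t∉) = t∉ t∈
        avoid (inj₂ h∉) = h∉ h∈

    indicator : List (Fin n) → Fin n → ℤ
    indicator R x = if does (Any.any? (x ≟_) R) then 1ℤ else 0ℤ

    indicator-∈ : ∀ {R x} → x ∈ R → indicator R x ≡ 1ℤ
    indicator-∈ {R} {x} x∈ rewrite dec-true (Any.any? (x ≟_) R) x∈ = refl

    -- The net outflow of a set containing x₀ is positive, so an edge carries
    -- positive flow out of it.
    outflow : ∀ R → x₀ ∈ R → 0ℤ ℤ.< excess f x₀ → (∀ u → u ∈ R → 0ℤ ℤ.≤ excess f u) →
      ∃[ e ] 0ℤ ℤ.< f e ℤ.* (indicator R (tail e) ℤ.- indicator R (head e))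
    outflow R x₀∈ 0<x₀ nonneg
      with any? (λ e → 0ℤ ℤ.<? f e ℤ.* (indicator R (tail e) ℤ.- indicator R (head e)))
    ... | yes found = found
    ... | no  none  = contradiction (ℤ.<-≤-trans total>0 total≤0) (ℤ.<-irrefl refl)
      where
      term : ∀ x → 0ℤ ℤ.≤ indicator R x ℤ.* excess f x
      term x with Any.any? (x ≟_) R
      ... | yes x∈ = subst (0ℤ ℤ.≤_) (sym (ℤ.*-identityˡ _)) (nonneg x x∈)
      ... | no  _  = ℤ.≤-refl
      total>0 : 0ℤ ℤ.< sum (λ x → indicator R x ℤ.* excess f x)
      total>0 = subst (ℤ._< sum (λ x → indicator R x ℤ.* excess f x)) (sum-zero n) (sum-mono-< term x₀
        (subst (0ℤ ℤ.<_) (sym (trans (cong (ℤ._* excess f x₀) (indicator-∈ x₀∈)) (ℤ.*-identityˡ _))) 0<x₀))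
      total≤0 : sum (λ x → indicator R x ℤ.* excess f x) ℤ.≤ 0ℤ
      total≤0 = subst₂ ℤ._≤_ (sym (excess-sum f (indicator R))) (sum-zero m)
        (sum-mono λ e → ℤ.≮⇒≥ λ 0<e → none (e , 0<e))

    data Step (R : List (Fin n)) : Set where
      step : ∀ {u v} → u ∈ R → v ∉ R → (Shift R u → Shift (v ∷ R) v) → Step R

    advance : ∀ R e → 0ℤ ℤ.< f e ℤ.* (indicator R (tail e) ℤ.- indicator R (head e)) → Step R
    advance R e 0< with Any.any? (tail e ≟_) R | Any.any? (head e ≟_) R
    ... | yes t∈ | yes h∈ = contradiction 0< (subst (λ b → ¬ 0ℤ ℤ.< b) (sym (ℤ.*-zeroʳ (f e))) (ℤ.<-irrefl refl))
    ... | no  t∉ | no  h∉ = contradiction 0< (subst (λ b → ¬ 0ℤ ℤ.< b) (sym (ℤ.*-zeroʳ (f e))) (ℤ.<-irrefl refl))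
    -- An edge directed out of `R` has a positive value, and lowering it by 3 carries three units of
    -- excess from tail to head. The next case is its mirror image: directed into `R`, negative,
    -- raised by 3.
    ... | yes t∈ | no  h∉ = step t∈ h∉ λ s → extend s e (ℤ.- + 3) t∈ h∉ (inj₂ h∉)
      (λ y → lemma (𝟙 (tail e) y) (𝟙 (head e) y)) (there t∈) (here refl)
      (FlowValue-lower (ranged e) (subst (0ℤ ℤ.<_) (ℤ.*-identityʳ (f e)) 0<))
      where
      lemma : ∀ t h → ℤ.- + 3 ℤ.* (t ℤ.- h) ≡ + 3 ℤ.* (h ℤ.- t)
      lemma = solve-∀
    ... | no  t∉ | yes h∈ = step h∈ t∉ λ s → extend s e (+ 3) h∈ t∉ (inj₁ t∉)
      (λ y → refl) (here refl) (there h∈)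
      (FlowValue-raise (ranged e) (subst (0ℤ ℤ.<_) (lemma (f e)) 0<))
      where
      lemma : ∀ a → a ℤ.* -1ℤ ≡ ℤ.- a
      lemma = solve-∀

    Sink : Set
    Sink = ∃[ v ] excess f v ℤ.< 0ℤ × ∃[ R ] Shift R v

    -- As long as no reached vertex has negative excess, `outflow` gives an edge to a new vertex.
    -- `C` contains every vertex outside `R` and shrinks each time, so a vertex of negative excess
    -- must turn up; `k` bounds the length of `C` to make the recursion structural.
    sink : ∀ k R C → length C ℕ.≤ k → x₀ ∈ R → 0ℤ ℤ.< excess f x₀ →
      (∀ v → v ∈ R ⊎ v ∈ C) → (∀ u → u ∈ R → 0ℤ ℤ.≤ excess f u × Shift R u) → Sink
    sink k R C C≤k x₀∈ 0<x₀ cover reached with outflow R x₀∈ 0<x₀ (λ u u∈ → proj₁ (reached u u∈))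
    ... | e , 0< with advance R e 0<
    ...   | step {u} {v} u∈ v∉ extend-to with extend-to (proj₂ (reached u u∈)) | excess f v ℤ.<? 0ℤ
    ...     | s | yes v<0 = v , v<0 , v ∷ R , s
    ...     | s | no  v≮0 with cover v
    ...       | inj₁ v∈R = contradiction v∈R v∉
    ...       | inj₂ v∈C with ∈-∃++ v∈C
    ...         | C₁ , C₂ , refl = continue k C≤k
      where
      C≡ : length (C₁ ++ v ∷ C₂) ≡ suc (length (C₁ ++ C₂))
      C≡ = trans (length-++ C₁) (trans (ℕ.+-suc _ _) (cong suc (sym (length-++ C₁))))
      cover′ : ∀ x → x ∈ v ∷ R ⊎ x ∈ C₁ ++ C₂
      cover′ x with cover x
      ... | inj₁ x∈R = inj₁ (there x∈R)
      ... | inj₂ x∈C with ∈-++⁻ C₁ x∈C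
      ...   | inj₁ x∈C₁         = inj₂ (∈-++⁺ˡ x∈C₁)
      ...   | inj₂ (here x≡v)   = inj₁ (here x≡v)
      ...   | inj₂ (there x∈C₂) = inj₂ (∈-++⁺ʳ C₁ x∈C₂)
      reached′ : ∀ u → u ∈ v ∷ R → 0ℤ ℤ.≤ excess f u × Shift (v ∷ R) u
      reached′ u (here refl) = ℤ.≮⇒≥ v≮0 , s
      reached′ u (there u∈)  = let nonneg , s = reached u u∈ in nonneg , weaken s
      continue : ∀ k → length (C₁ ++ v ∷ C₂) ℕ.≤ k → Sink
      continue zero    ≤k = contradiction (subst (ℕ._≤ 0) C≡ ≤k) λ ()
      continue (suc k) ≤k = sink k (v ∷ R) (C₁ ++ C₂) (ℕ.s≤s⁻¹ (subst (ℕ._≤ suc k) C≡ ≤k))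
        (there x₀∈) 0<x₀ cover′ reached′

  imbalance : (Fin m → ℤ) → ℤ
  imbalance f = sum (λ x → + ∣ excess f x ∣)

  -- Each round moves three units from a positive to a negative excess. Being divisible by 3, both
  -- have absolute value at least 3, so neither overshoots 0 and the imbalance, bounded by `k`,
  -- drops. With no positive excess left, all are 0 because their sum is 0.
  balance : ∀ k f → imbalance f ℤ.≤ + k → Ranged f → ThreeDivides f →
    ∃[ g ] Ranged g × (∀ x → excess g x ≡ 0ℤ)
  balance k f bound ranged 3∣ with any? (λ x → 0ℤ ℤ.<? excess f x)
  ... | no none = f , ranged , λ x → vanish x (excess f x ℤ.≟ 0ℤ)
    where
    total : sum (excess f) ≡ 0ℤ
    total = trans (sum-cong (λ x → sym (ℤ.*-identityˡ (excess f x))))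
      (trans (excess-sum f (λ _ → 1ℤ)) (trans (sum-cong (λ e → ℤ.*-zeroʳ (f e))) (sum-zero m)))
    vanish : ∀ x → Dec (excess f x ≡ 0ℤ) → excess f x ≡ 0ℤ
    vanish x (yes eq) = eq
    vanish x (no neq) = contradiction total (ℤ.<⇒≢ (subst (sum (excess f) ℤ.<_) (sum-zero n)
      (sum-mono-< (λ y → ℤ.≮⇒≥ λ 0< → none (y , 0<)) x (ℤ.≤∧≢⇒< (ℤ.≮⇒≥ λ 0< → none (x , 0<)) neq))))
  ... | yes (x₀ , 0<x₀) = improve (Augment.sink f ranged x₀ n (x₀ ∷ []) (allFin n) (ℕ.≤-reflexive (length-tabulate id))
        (here refl) 0<x₀ (λ v → inj₂ (∈-allFin v))
        λ { _ (here refl) → ℤ.<⇒≤ 0<x₀ , Augment.start f ranged x₀ })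
    where
    improve : Augment.Sink f ranged x₀ → _
    improve (v , v<0 , R , s) = continue k bound
      where
      open Augment.Shift s
      x₀≢v : x₀ ≢ v
      x₀≢v refl = ℤ.<-asym 0<x₀ v<0
      at-x₀ : excess f′ x₀ ≡ excess f x₀ ℤ.- + 3
      at-x₀ = trans (excess′ x₀) (cong (λ a → excess f x₀ ℤ.+ a)
        (cong₂ (λ a b → + 3 ℤ.* (a ℤ.- b)) (𝟙-other (x₀≢v ∘ sym)) (𝟙-self x₀)))
      at-v : excess f′ v ≡ excess f v ℤ.+ + 3
      at-v = trans (excess′ v) (cong (λ a → excess f v ℤ.+ a)
        (cong₂ (λ a b → + 3 ℤ.* (a ℤ.- b)) (𝟙-self v) (𝟙-other x₀≢v)))
      elsewhere : ∀ {x} → x ≢ x₀ → x ≢ v → excess f′ x ≡ excess f x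
      elsewhere {x} x≢x₀ x≢v = trans (excess′ x) (trans (cong (λ a → excess f x ℤ.+ a)
        (cong₂ (λ a b → + 3 ℤ.* (a ℤ.- b)) (𝟙-other (x≢v ∘ sym)) (𝟙-other (x≢x₀ ∘ sym)))) (ℤ.+-identityʳ _))
      lower : ∀ a → 0ℤ ℤ.< a → residue a ≡ 0F → ∣ a ℤ.- + 3 ∣ ℕ.< ∣ a ∣
      lower (+ 0) (ℤ.+<+ ()) _
      lower (+ 1) _ ()
      lower (+ 2) _ ()
      lower (+ suc (suc (suc k))) _ _ = ℕ.m≤n⇒m≤1+n (ℕ.m≤n⇒m≤1+n (ℕ.n<1+n k))
      lower -[1+ _ ] ()
      raise : ∀ a → a ℤ.< 0ℤ → residue a ≡ 0F → ∣ a ℤ.+ + 3 ∣ ℕ.< ∣ a ∣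
      raise (+ _) (ℤ.+<+ ()) _
      raise -[1+ 0 ] _ ()
      raise -[1+ 1 ] _ ()
      raise -[1+ suc (suc zero) ] _ _ = s≤s z≤n
      raise -[1+ suc (suc (suc k)) ] _ _ = ℕ.m≤n⇒m≤1+n (ℕ.m≤n⇒m≤1+n (ℕ.n<1+n (suc k)))
      decreases-x₀ : ∣ excess f′ x₀ ∣ ℕ.< ∣ excess f x₀ ∣
      decreases-x₀ = subst (λ a → ∣ a ∣ ℕ.< ∣ excess f x₀ ∣) (sym at-x₀) (lower _ 0<x₀ (3∣ x₀))
      pointwise : ∀ x → ∣ excess f′ x ∣ ℕ.≤ ∣ excess f x ∣
      pointwise x with x ≟ x₀ | x ≟ v
      ... | yes refl | _        = ℕ.<⇒≤ decreases-x₀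
      ... | no _     | yes refl = ℕ.<⇒≤ (subst (λ a → ∣ a ∣ ℕ.< ∣ excess f v ∣) (sym at-v) (raise _ v<0 (3∣ v)))
      ... | no x≢x₀  | no x≢v   = ℕ.≤-reflexive (cong ∣_∣ (elsewhere x≢x₀ x≢v))
      decreases : imbalance f′ ℤ.< imbalance f
      decreases = sum-mono-< (λ x → ℤ.+≤+ (pointwise x)) x₀ (ℤ.+<+ decreases-x₀)
      3∣′ : ThreeDivides f′
      3∣′ x = trans (cong residue (trans (excess′ x) (cong (λ a → excess f x ℤ.+ a) (triple _))))
          (trans (residue-+ (excess f x) _) (trans (cong₂ _⊕_ (3∣ x)
            (trans (residue-+ d (d ℤ.+ d)) (cong (residue d ⊕_) (residue-+ d d)))) (lemma (residue d))))
        where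
        d : ℤ
        d = 𝟙 v x ℤ.- 𝟙 x₀ x
        triple : ∀ a → + 3 ℤ.* a ≡ a ℤ.+ (a ℤ.+ a)
        triple = solve-∀
        lemma : ∀ a → 0F ⊕ (a ⊕ (a ⊕ a)) ≡ 0F
        lemma = from-yes (all? λ a → 0F ⊕ (a ⊕ (a ⊕ a)) ≟ 0F)
      continue : ∀ k → imbalance f ℤ.≤ + k → ∃[ g ] Ranged g × (∀ x → excess g x ≡ 0ℤ)
      continue zero    ≤k = contradiction (ℤ.<-≤-trans decreases ≤k)
        (ℤ.≤⇒≯ (subst (ℤ._≤ imbalance f′) (sum-zero n) (sum-mono λ x → ℤ.+≤+ z≤n)))
      continue (suc k) ≤k = balance k f′ (ℤ.i<j⇒i≤pred[j] (ℤ.<-≤-trans decreases ≤k)) ranged′ 3∣′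

FeasibleGraph : Graph → Set
FeasibleGraph G = Feasible (map (Trees.∂ (Graph.multigraph G)) (allFin (Graph.size G))) (λ _ → 0F)

module _ (G : Graph) where
  open Graph G
  open Trees multigraph
  open Integral multigraph using (tail; head; excess; imbalance; balance; ThreeDivides; Ranged; excess-residue)

  private
    value-sign : ∀ {a} → a ∈ 1ℤ ∷ -1ℤ ∷ + 2 ∷ -[1+ 1 ] ∷ [] → ∃[ s ] residue a ≡ ⟦ s ⟧
    value-sign (here refl)                         = pos , refl
    value-sign (there (here refl))                 = neg , refl
    value-sign (there (there (here refl)))         = neg , refl
    value-sign (there (there (there (here refl)))) = pos , refl

    FlowValue⇒∈ : ∀ {a} → FlowValue a → a ∈ 1ℤ ∷ -1ℤ ∷ + 2 ∷ -[1+ 1 ] ∷ []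
    FlowValue⇒∈ one       = here refl
    FlowValue⇒∈ minus-one = there (here refl)
    FlowValue⇒∈ two       = there (there (here refl))
    FlowValue⇒∈ minus-two = there (there (there (here refl)))

  -- Modulo 3 every admissible value is a sign: 1 and -2 become 1, while -1 and 2 become 2. The flow
  -- may direct an edge against its stored order, which `joins-∂` absorbs.
  flow⇒feasible : NowhereZero3Flow G → FeasibleGraph G
  flow⇒feasible φ = subst (λ W → Feasible W (λ _ → 0F)) (sym (map-tabulate id ∂))
      (Feasible-cong± (Pointwise.tabulate⁺ (λ e → joins-∂ (Φ.orients e)))
        (signs⇒feasible (proj₁ ∘ s) zero-boundary))
    where
    module Φ = NowhereZero3Flow φ
    s : ∀ e → ∃[ s ] residue (Φ.flow e) ≡ ⟦ s ⟧
    s e = value-sign (Φ.values e)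
    out into : Vertex → Edge → ℤ
    out  x e = if does (Φ.tail e ≟ x) then Φ.flow e else 0ℤ
    into x e = if does (Φ.head e ≟ x) then Φ.flow e else 0ℤ
    residue-if : ∀ b {a c} → residue a ≡ c → residue (if b then a else 0ℤ) ≡ c ⊗ (if b then 1F else 0F)
    residue-if true  {c = c} eq = trans eq (⊗-identityʳ c)
      where
      ⊗-identityʳ : ∀ c → c ≡ c ⊗ 1F
      ⊗-identityʳ = from-yes (all? λ c → c ≟ c ⊗ 1F)
    residue-if false {c = c} eq = sym (⊗-zeroʳ c)
    lemma : ∀ c a b → c ⊗ a ⊕ ⊝ (c ⊗ b) ≡ c ⊗ (a ⊕ 2F ⊗ b)
    lemma = from-yes (all? λ c → all? λ a → all? λ b → c ⊗ a ⊕ ⊝ (c ⊗ b) ≟ c ⊗ (a ⊕ 2F ⊗ b))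
    term : ∀ x e → residue (out x e) ⊕ ⊝ residue (into x e) ≡ ⟦ proj₁ (s e) ⟧ ⊗ δ (Φ.tail e) (Φ.head e) x
    term x e = trans
      (cong₂ (λ a b → a ⊕ ⊝ b) (residue-if (does (Φ.tail e ≟ x)) (proj₂ (s e))) (residue-if (does (Φ.head e ≟ x)) (proj₂ (s e))))
      (trans (lemma ⟦ proj₁ (s e) ⟧ (χ (Φ.tail e) x) (χ (Φ.head e) x)) (cong (⟦ proj₁ (s e) ⟧ ⊗_) (sym (δ-def _ _ x))))
    zero-boundary : ∀ x → 0F ⊕ Σ₃ (λ e → ⟦ proj₁ (s e) ⟧ ⊗ δ (Φ.tail e) (Φ.head e) x) ≡ 0F
    zero-boundary x = begin
      Σ₃ (λ e → ⟦ proj₁ (s e) ⟧ ⊗ δ (Φ.tail e) (Φ.head e) x)          ≡⟨ Σ₃-cong (term x) ⟨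
      Σ₃ (λ e → residue (out x e) ⊕ ⊝ residue (into x e))             ≡⟨ Σ₃-subtract (residue ∘ out x) (residue ∘ into x) ⟩
      Σ₃ (residue ∘ out x) ⊕ ⊝ Σ₃ (residue ∘ into x)                  ≡⟨ cong₂ (λ a b → a ⊕ ⊝ b) (residue-sum (out x)) (residue-sum (into x)) ⟨
      residue (sum (out x)) ⊕ ⊝ residue (sum (into x))                ≡⟨ cong (λ a → residue a ⊕ ⊝ residue (sum (into x))) conserved ⟩
      residue (sum (into x)) ⊕ ⊝ residue (sum (into x))               ≡⟨ cancel (residue (sum (into x))) ⟩
      0F                                                              ∎
      where
      open ≡-Reasoning
      conserved : sum (out x) ≡ sum (into x)
      conserved = trans (sum-def _) (trans (Φ.conserved x) (sym (sum-def _)))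
      cancel : ∀ a → a ⊕ ⊝ a ≡ 0F
      cancel = from-yes (all? λ a → a ⊕ ⊝ a ≟ 0F)

  -- Signs lift to the values 1 and -1 along the stored directions. All excesses are then divisible
  -- by 3, and `balance` removes them.
  feasible⇒flow : FeasibleGraph G → NowhereZero3Flow G
  feasible⇒flow h with feasible⇒signs {w = ∂} (subst (λ W → Feasible W (λ _ → 0F)) (map-tabulate id ∂) h)
  ... | s , eq = build (balance ∣ imbalance f₀ ∣ f₀ bound ranged₀ 3∣f₀)
    where
    unit : Sign → ℤ
    unit pos = 1ℤ
    unit neg = -1ℤ
    f₀ : Edge → ℤ
    f₀ = unit ∘ s
    ranged₀ : Ranged f₀
    ranged₀ e with s e
    ... | pos = one
    ... | neg = minus-one
    bound : imbalance f₀ ℤ.≤ + ∣ imbalance f₀ ∣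
    bound = ℤ.≤-reflexive (sym (ℤ.0≤i⇒+∣i∣≡i (subst (ℤ._≤ imbalance f₀) (sum-zero order) (sum-mono λ x → ℤ.+≤+ z≤n))))
    residue-unit : ∀ s b c → residue (unit s ℤ.* ((if b then 1ℤ else 0ℤ) ℤ.- (if c then 1ℤ else 0ℤ)))
      ≡ ⟦ s ⟧ ⊗ ((if b then 1F else 0F) ⊕ 2F ⊗ (if c then 1F else 0F))
    residue-unit pos true  true  = refl
    residue-unit pos true  false = refl
    residue-unit pos false true  = refl
    residue-unit pos false false = refl
    residue-unit neg true  true  = refl
    residue-unit neg true  false = refl
    residue-unit neg false true  = refl
    residue-unit neg false false = refl
    3∣f₀ : ThreeDivides f₀
    3∣f₀ x = trans (excess-residue f₀ x) (trans
      (Σ₃-cong (λ e → trans (residue-unit (s e) (does (tail e ≟ x)) (does (head e ≟ x)))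
        (cong (⟦ s e ⟧ ⊗_) (sym (δ-def _ _ x)))))
      (eq x))
    build : (∃[ g ] Ranged g × (∀ x → excess g x ≡ 0ℤ)) → NowhereZero3Flow G
    build (g , ranged , zero-excess) = record
      { orientation = record { tail = tail ; head = head ; orients = λ e → inj₁ refl }
      ; flow        = g
      ; values      = λ e → FlowValue⇒∈ (ranged e)
      ; conserved   = λ x → trans (sym (sum-def _)) (trans (conserved x) (sum-def _))
      }
      where
      out into : Vertex → Edge → ℤ
      out  x e = if does (tail e ≟ x) then g e else 0ℤ
      into x e = if does (head e ≟ x) then g e else 0ℤ
      split-if : ∀ b c a → a ℤ.* ((if b then 1ℤ else 0ℤ) ℤ.- (if c then 1ℤ else 0ℤ))
        ≡ (if b then a else 0ℤ) ℤ.+ -1ℤ ℤ.* (if c then a else 0ℤ)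
      split-if true  true  = lemma
        where
        lemma : ∀ a → a ℤ.* (1ℤ ℤ.- 1ℤ) ≡ a ℤ.+ -1ℤ ℤ.* a
        lemma = solve-∀
      split-if true  false = lemma
        where
        lemma : ∀ a → a ℤ.* (1ℤ ℤ.- 0ℤ) ≡ a ℤ.+ -1ℤ ℤ.* 0ℤ
        lemma = solve-∀
      split-if false true  = lemma
        where
        lemma : ∀ a → a ℤ.* (0ℤ ℤ.- 1ℤ) ≡ 0ℤ ℤ.+ -1ℤ ℤ.* a
        lemma = solve-∀
      split-if false false = ℤ.*-zeroʳ
      conserved : ∀ x → sum (out x) ≡ sum (into x)
      conserved x = ℤ.i-j≡0⇒i≡j _ _ (begin
        sum (out x) ℤ.- sum (into x)                       ≡⟨ cong (λ a → sum (out x) ℤ.+ a) (ℤ.-1*i≡-i _) ⟨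
        sum (out x) ℤ.+ -1ℤ ℤ.* sum (into x)               ≡⟨ cong (λ a → sum (out x) ℤ.+ a) (sum-* -1ℤ (into x)) ⟨
        sum (out x) ℤ.+ sum (λ e → -1ℤ ℤ.* into x e)       ≡⟨ sum-+ (out x) _ ⟨
        sum (λ e → out x e ℤ.+ -1ℤ ℤ.* into x e)           ≡⟨ sum-cong (λ e → split-if (does (tail e ≟ x)) (does (head e ≟ x)) (g e)) ⟨
        excess g x                                         ≡⟨ zero-excess x ⟩
        0ℤ                                                 ∎)
        where open ≡-Reasoning

-- Bull reductions

Pointwise-map : ∀ {A B C : Set} {f : A → C} {g : B → C} {h : A → B} {R : C → C → Set} →
  (∀ x → R (f x) (g (h x))) → ∀ xs → Pointwise R (map f xs) (map g (map h xs))
Pointwise-map p []       = []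
Pointwise-map p (x ∷ xs) = p x ∷ Pointwise-map p xs

module Embedding (H : Graph) {n : ℕ} (ι : Graph.Vertex H → Fin n) (ι-injective : ∀ {x y} → ι x ≡ ι y → x ≡ y) where
  open Graph H
  open Trees multigraph using (∂)

  pushed : Edge → Fin n → ℤ₃
  pushed e = δ (ι (proj₁ (ends e))) (ι (proj₂ (ends e)))

  private
    δ-ι : ∀ x y v → δ (ι x) (ι y) (ι v) ≡ δ x y v
    δ-ι x y v = trans (δ-def _ _ (ι v)) (trans (cong₂ (λ a b → a ⊕ 2F ⊗ b) (χ-ι x) (χ-ι y)) (sym (δ-def x y v)))
      where
      χ-ι : ∀ x → χ (ι x) (ι v) ≡ χ x v
      χ-ι x with x ≟ v
      ... | yes refl = χ-self (ι x)
      ... | no  x≢v  = χ-other (x≢v ∘ ι-injective)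

    pulled : Pointwise _≈±_ (map (_∘ ι) (map pushed (allFin size))) (map ∂ (allFin size))
    pulled = subst (λ W → Pointwise _≈±_ W (map ∂ (allFin size))) (map-∘ (allFin size))
      (go (allFin size))
      where
      go : ∀ es → Pointwise _≈±_ (map ((_∘ ι) ∘ pushed) es) (map ∂ es)
      go []       = []
      go (e ∷ es) = inj₁ (λ v → δ-ι _ _ v) ∷ go es

  -- The pushed vectors are 0 off the image of `ι`, so the larger vertex set imposes no further
  -- condition.
  feasible-pushed : FeasibleGraph H → Feasible (map pushed (allFin size)) (λ _ → 0F)
  feasible-pushed h = Feasible-pushforward ι (λ y → any? λ x → ι x ≟ y) _
    (λ y y∉ → refl , All.map⁺ (All.tabulate λ _ → δ-outside (λ { refl → y∉ (_ , refl) }) (λ { refl → y∉ (_ , refl) })))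
    (Feasible-cong± (Pointwise.symmetric ≈±-sym pulled) h)

  feasible-pulled : Feasible (map pushed (allFin size)) (λ _ → 0F) → FeasibleGraph H
  feasible-pulled h = Feasible-cong± pulled (Feasible-pullback ι _ h)

-- No sign can change the coordinate `x`, so it must be 0 already. This extracts the equations at
-- the two degree-three vertices of a bull.
Feasible-at : ∀ {V : Set} (W : List (V → ℤ₃)) {β x} → All (λ w → w x ≡ 0F) W → Feasible W β → β x ≡ 0F
Feasible-at []      []        h       = h _
Feasible-at (w ∷ W) {β} {x} (wx ∷ Wx) (s , h) = trans (sym (trans (cong (λ a → β x ⊕ ⟦ s ⟧ ⊗ a) wx)
  (trans (cong (β x ⊕_) (⊗-zeroʳ ⟦ s ⟧)) (⊕-identityʳ (β x))))) (Feasible-at W Wx h)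

Feasible-drop-zero : ∀ {V : Set} {w : V → ℤ₃} {W β} → (∀ x → w x ≡ 0F) → Feasible (w ∷ W) β → Feasible W β
Feasible-drop-zero {W = W} {β} w≗0 (s , h) = Feasible-congʳ W
  (λ x → trans (cong (λ a → β x ⊕ ⟦ s ⟧ ⊗ a) (w≗0 x)) (trans (cong (β x ⊕_) (⊗-zeroʳ ⟦ s ⟧)) (⊕-identityʳ (β x)))) h

-- At u and at v the three edges must carry equal signs outwards, so the five
-- edges of a bull act as the single vector δ a b.
module BullVectors {n : ℕ} {u v w a b : Fin n} where

  five : List (Fin n → ℤ₃) → List (Fin n → ℤ₃)
  five W = δ u v ∷ δ u w ∷ δ v w ∷ δ u a ∷ δ v b ∷ W

  private
    -- The outward sign at `u` is `s`; seen from `v` the edge uv has sign `⊝ s`, which `vw` and `vb`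
    -- share. The contributions cancel in threes at `u` and `v` and against each other at `w`,
    -- leaving only `a` and `b`.
    collapse : ∀ s x → 0F ⊕ s ⊗ δ u v x ⊕ s ⊗ δ u w x ⊕ ⊝ s ⊗ δ v w x ⊕ s ⊗ δ u a x ⊕ ⊝ s ⊗ δ v b x
      ≡ 0F ⊕ ⊝ s ⊗ δ a b x
    collapse s x = trans (lemma s (δ u v x) (δ v w x) (δ u a x) (δ v b x)
        (δ u w x) (δ-chain u v w x)) (cong (λ c → 0F ⊕ ⊝ s ⊗ c) (sym chain))
      where
      chain : δ a b x ≡ 2F ⊗ δ u a x ⊕ δ u v x ⊕ δ v b x
      chain = trans (δ-chain a u b x) (trans (cong₂ _⊕_ flip (δ-chain u v b x)) (sym (⊕-assoc (2F ⊗ δ u a x) _ _)))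
        where
        flip : δ a u x ≡ 2F ⊗ δ u a x
        flip = opp (δ a u x) (δ u a x) (trans (sym (δ-chain a u a x)) (δ-loop a x))
          where
          opp : ∀ c d → c ⊕ d ≡ 0F → c ≡ 2F ⊗ d
          opp 0F 0F _ = refl
          opp 1F 2F _ = refl
          opp 2F 1F _ = refl
          opp 0F 1F ()
          opp 0F 2F ()
          opp 1F 0F ()
          opp 1F 1F ()
          opp 2F 0F ()
          opp 2F 2F ()
      lemma : ∀ s p q r t o → o ≡ p ⊕ q →
        0F ⊕ s ⊗ p ⊕ s ⊗ o ⊕ ⊝ s ⊗ q ⊕ s ⊗ r ⊕ ⊝ s ⊗ t ≡ 0F ⊕ ⊝ s ⊗ (2F ⊗ r ⊕ p ⊕ t)
      lemma s p q r t _ refl = table s p q r t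
        where
        table : ∀ s p q r t →
          0F ⊕ s ⊗ p ⊕ s ⊗ (p ⊕ q) ⊕ ⊝ s ⊗ q ⊕ s ⊗ r ⊕ ⊝ s ⊗ t ≡ 0F ⊕ ⊝ s ⊗ (2F ⊗ r ⊕ p ⊕ t)
        table = from-yes (all? λ s → all? λ p → all? λ q → all? λ r → all? λ t →
          0F ⊕ s ⊗ p ⊕ s ⊗ (p ⊕ q) ⊕ ⊝ s ⊗ q ⊕ s ⊗ r ⊕ ⊝ s ⊗ t ≟ 0F ⊕ ⊝ s ⊗ (2F ⊗ r ⊕ p ⊕ t))

  ab⇒five : ∀ {W} → Feasible (δ a b ∷ W) (λ _ → 0F) → Feasible (five W) (λ _ → 0F)
  ab⇒five {W} (pos , h) = neg , neg , pos , neg , pos , Feasible-congʳ W (λ x → sym (collapse 2F x)) h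
  ab⇒five {W} (neg , h) = pos , pos , neg , pos , neg , Feasible-congʳ W (λ x → sym (collapse 1F x)) h

  five⇒ab : ∀ {W} → u ≢ v → u ≢ w → v ≢ w → a ≢ u → a ≢ v → b ≢ u → b ≢ v →
    All (λ w → w u ≡ 0F) W → All (λ w → w v ≡ 0F) W →
    Feasible (five W) (λ _ → 0F) → Feasible (δ a b ∷ W) (λ _ → 0F)
  five⇒ab {W} u≢v u≢w v≢w a≢u a≢v b≢u b≢v Wu Wv (s₁ , s₂ , s₃ , s₄ , s₅ , h) =
    conclude s₁ s₂ s₃ s₄ s₅
      (at u (δ-source u≢v) (δ-source u≢w) (δ-outside u≢v u≢w) (δ-source (a≢u ∘ sym)) (δ-outside u≢v (b≢u ∘ sym)) Wu)
      (at v (δ-target u≢v) (δ-outside (u≢v ∘ sym) v≢w) (δ-source v≢w) (δ-outside (u≢v ∘ sym) (a≢v ∘ sym)) (δ-source (b≢v ∘ sym)) Wv)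
      h
    where
    at : ∀ x {c d e f g} → δ u v x ≡ c → δ u w x ≡ d → δ v w x ≡ e → δ u a x ≡ f → δ v b x ≡ g →
      All (λ w → w x ≡ 0F) W →
      0F ⊕ ⟦ s₁ ⟧ ⊗ c ⊕ ⟦ s₂ ⟧ ⊗ d ⊕ ⟦ s₃ ⟧ ⊗ e ⊕ ⟦ s₄ ⟧ ⊗ f ⊕ ⟦ s₅ ⟧ ⊗ g ≡ 0F
    at x refl refl refl refl refl Wx = Feasible-at W Wx h
    conclude : ∀ s₁ s₂ s₃ s₄ s₅ →
      0F ⊕ ⟦ s₁ ⟧ ⊗ 1F ⊕ ⟦ s₂ ⟧ ⊗ 1F ⊕ ⟦ s₃ ⟧ ⊗ 0F ⊕ ⟦ s₄ ⟧ ⊗ 1F ⊕ ⟦ s₅ ⟧ ⊗ 0F ≡ 0F →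
      0F ⊕ ⟦ s₁ ⟧ ⊗ 2F ⊕ ⟦ s₂ ⟧ ⊗ 0F ⊕ ⟦ s₃ ⟧ ⊗ 1F ⊕ ⟦ s₄ ⟧ ⊗ 0F ⊕ ⟦ s₅ ⟧ ⊗ 1F ≡ 0F →
      Feasible W (λ x → 0F ⊕ ⟦ s₁ ⟧ ⊗ δ u v x ⊕ ⟦ s₂ ⟧ ⊗ δ u w x ⊕ ⟦ s₃ ⟧ ⊗ δ v w x ⊕ ⟦ s₄ ⟧ ⊗ δ u a x ⊕ ⟦ s₅ ⟧ ⊗ δ v b x) →
      Feasible (δ a b ∷ W) (λ _ → 0F)
    -- Of the 32 sign patterns, the equations at `u` and `v` leave just the two of the form s, s,
    -- -s, s, -s.
    conclude pos pos pos pos pos _ () _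
    conclude pos pos pos pos neg _ () _
    conclude pos pos pos neg pos () _ _
    conclude pos pos pos neg neg () _ _
    conclude pos pos neg pos pos _ () _
    conclude pos pos neg pos neg _ _ h = neg , Feasible-congʳ W (collapse 1F) h
    conclude pos pos neg neg pos () _ _
    conclude pos pos neg neg neg () _ _
    conclude pos neg pos pos pos () _ _
    conclude pos neg pos pos neg () _ _
    conclude pos neg pos neg pos () _ _
    conclude pos neg pos neg neg () _ _
    conclude pos neg neg pos pos () _ _
    conclude pos neg neg pos neg () _ _
    conclude pos neg neg neg pos () _ _
    conclude pos neg neg neg neg () _ _
    conclude neg pos pos pos pos () _ _
    conclude neg pos pos pos neg () _ _
    conclude neg pos pos neg pos () _ _
    conclude neg pos pos neg neg () _ _
    conclude neg pos neg pos pos () _ _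
    conclude neg pos neg pos neg () _ _
    conclude neg pos neg neg pos () _ _
    conclude neg pos neg neg neg () _ _
    conclude neg neg pos pos pos () _ _
    conclude neg neg pos pos neg () _ _
    conclude neg neg pos neg pos _ _ h = pos , Feasible-congʳ W (collapse 2F) h
    conclude neg neg pos neg neg _ () _
    conclude neg neg neg pos pos () _ _
    conclude neg neg neg pos neg () _ _
    conclude neg neg neg neg pos _ () _
    conclude neg neg neg neg neg _ () _

open Graph using (order; size; Vertex; Edge; degree)

degree-count : ∀ G x → degree G x ≡ length (filter (λ e → Graph.incident? G e x) (allFin (size G)))
degree-count G x = count (λ e → Graph.incident? G e x) id
  where
  count : ∀ {k} {P : Edge G → Set} (P? : ∀ e → Dec (P e)) (f : Fin k → Edge G) →
    FinSum.sum ℕ.+-0-commutativeMonoid (λ i → if does (P? (f i)) then 1 else 0) ≡ length (filter P? (tabulate f))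
  count {zero}  P? f = refl
  count {suc k} P? f with does (P? (f zero))
  ... | true  = cong suc (count P? (f ∘ suc))
  ... | false = count P? (f ∘ suc)

-- Apart from the vertex, the components are proofs of negations, and any two of these are
-- definitionally equal.
VertexAvoiding-≡ : ∀ {V E : Set} {G : Multigraph V E} {u v} {x y : VertexAvoiding G u v} → proj₁ x ≡ proj₁ y → x ≡ y
VertexAvoiding-≡ refl = refl

EdgeAvoiding-≡ : ∀ {V E : Set} {G : Multigraph V E} {u v} {e f : EdgeAvoiding G u v} → proj₁ e ≡ proj₁ f → e ≡ f
EdgeAvoiding-≡ refl = refl

-- A reduction lives on types of surviving vertices and edges; enumerations number it as a `Graph`.
-- The order is reported because the final recursion descends on it.
realise : ∀ {V E : Set} (M : Multigraph V E) {k l} → Fin k ↔ V → Fin l ↔ E →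
  ∃[ H ] order H ≡ k × Isomorphism (Graph.multigraph H) M
realise M {k} {l} φ ψ = H , refl , record
  { vertices      = φ
  ; edges         = ψ
  ; preservesEnds = λ e → inj₁ (cong₂ _,_ (sym (Inverse.strictlyInverseˡ φ _)) (sym (Inverse.strictlyInverseˡ φ _)))
  }
  where
  open Multigraph M
  from-injective : ∀ {x y} → Inverse.from φ x ≡ Inverse.from φ y → x ≡ y
  from-injective {x} {y} eq = trans (sym (Inverse.strictlyInverseˡ φ x))
    (trans (cong (Inverse.to φ) eq) (Inverse.strictlyInverseˡ φ y))
  H : Graph
  H = record
    { order = k ; size = l
    ; multigraph = record
      { ends     = λ i → Inverse.from φ (proj₁ (ends (Inverse.to ψ i))) , Inverse.from φ (proj₂ (ends (Inverse.to ψ i)))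
      ; loopless = λ i → loopless (Inverse.to ψ i) ∘ from-injective
      }
    }

-- The degree conditions appear as a listing of all edges in which only five meet `u` or `v`. This
-- is the form that `Feasible`, being about lists, can use.
record BullDecomposition (G : Graph) : Set where
  open Multigraph (Graph.multigraph G) using (Joins; Incident)
  field
    u v w a b      : Vertex G
    uv uw vw ua vb : Edge G
    uv-joins       : Joins uv u v
    uw-joins       : Joins uw u w
    vw-joins       : Joins vw v w
    ua-joins       : Joins ua u a
    vb-joins       : Joins vb v b
    a≢u            : a ≢ u
    a≢v            : a ≢ v
    a≢w            : a ≢ w
    b≢u            : b ≢ u
    b≢v            : b ≢ v
    b≢w            : b ≢ w
    rest           : List (Edge G)
    edges          : allFin (size G) ↭ uv ∷ uw ∷ vw ∷ ua ∷ vb ∷ rest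
    rest-avoids    : All (λ e → ¬ Incident e u × ¬ Incident e v) rest

module Reduce {G : Graph} (D : BullDecomposition G) where
  open BullDecomposition D
  open Graph G hiding (order; size; Vertex; Edge; degree; incident?)
  open Trees multigraph
  open Bulls multigraph using (incident?; joins-incidentˡ; joins-incidentʳ; joins-incident⇒; ∂-nonincident)

  deleted : Multigraph (VertexAvoiding multigraph u v) (EdgeAvoiding multigraph u v)
  deleted = delete₂ multigraph u v

  A B : VertexAvoiding multigraph u v
  A = a , a≢u , a≢v
  B = b , b≢u , b≢v

  reduced : Multigraph (VertexAvoiding multigraph u v) (EdgeAvoiding multigraph u v ⊎ A ≢ B)
  reduced = addEdge deleted A B

  private
    u≢v : u ≢ v
    u≢v = Joins⇒≢ uv-joins
    u≢w : u ≢ w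
    u≢w = Joins⇒≢ uw-joins
    v≢w : v ≢ w
    v≢w = Joins⇒≢ vw-joins

    newEdges : List (A ≢ B)
    newEdges with a ≟ b
    ... | yes _   = []
    ... | no a≢b = (a≢b ∘ cong proj₁) ∷ []

    newEdges-unique : Unique newEdges
    newEdges-unique with a ≟ b
    ... | yes _ = []
    ... | no  _ = [] ∷ []

    newEdges-complete : ∀ A≢B → A≢B ∈ newEdges
    newEdges-complete A≢B with a ≟ b
    ... | yes a≡b = contradiction (VertexAvoiding-≡ {G = multigraph} a≡b) A≢B
    ... | no  _   = here refl

    avoiders : ∀ {es} → All (λ e → ¬ Incident e u × ¬ Incident e v) es → List (EdgeAvoiding multigraph u v)
    avoiders []       = []
    avoiders (p ∷ ps) = (_ , p) ∷ avoiders ps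

    avoiders-es : ∀ {es} (ps : All (λ e → ¬ Incident e u × ¬ Incident e v) es) → map proj₁ (avoiders ps) ≡ es
    avoiders-es []       = refl
    avoiders-es (p ∷ ps) = cong (_ ∷_) (avoiders-es ps)

    rest-unique : Unique rest
    rest-unique with Unique-↭ edges (allFin⁺ (size G))
    ... | _ ∷ _ ∷ _ ∷ _ ∷ _ ∷ rest! = rest!

    rest-complete : ∀ e → ¬ Incident e u → ¬ Incident e v → e ∈ rest
    rest-complete e e∌u e∌v with ∈-resp-↭ edges (∈-allFin e)
    ... | here refl                                  = contradiction (joins-incidentˡ uv-joins) e∌u
    ... | there (here refl)                          = contradiction (joins-incidentˡ uw-joins) e∌u
    ... | there (there (here refl))                  = contradiction (joins-incidentˡ vw-joins) e∌v
    ... | there (there (there (here refl)))          = contradiction (joins-incidentˡ ua-joins) e∌u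
    ... | there (there (there (there (here refl))))  = contradiction (joins-incidentˡ vb-joins) e∌v
    ... | there (there (there (there (there e∈))))   = e∈

  reducedEdges : List (EdgeAvoiding multigraph u v ⊎ A ≢ B)
  reducedEdges = map inj₂ newEdges ++ map inj₁ (avoiders rest-avoids)

  reducedEdges-unique : Unique reducedEdges
  reducedEdges-unique = Unique-++⁺ (Unique-map⁺ (λ { refl → refl }) newEdges-unique)
    (Unique-map⁺ inj₁-injective (Unique-map⁻ (subst Unique (sym (avoiders-es rest-avoids)) rest-unique)))
    λ (x∈ , y∈) → case ∈-map⁻ inj₂ x∈ , ∈-map⁻ inj₁ y∈ of λ { ((_ , _ , refl) , (_ , _ , ())) }

  reducedEdges-complete : ∀ e → e ∈ reducedEdges
  reducedEdges-complete (inj₂ A≢B) = ∈-++⁺ˡ (∈-map⁺ inj₂ (newEdges-complete A≢B))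
  reducedEdges-complete (inj₁ (e , e∌u , e∌v)) = ∈-++⁺ʳ (map inj₂ newEdges) (∈-map⁺ inj₁
    (member (∈-map⁻ proj₁ (subst (e ∈_) (sym (avoiders-es rest-avoids)) (rest-complete e e∌u e∌v)))))
    where
    member : ∃[ f ] (f ∈ avoiders rest-avoids × e ≡ proj₁ f) → (e , e∌u , e∌v) ∈ avoiders rest-avoids
    member (f , f∈ , eq) = subst (_∈ avoiders rest-avoids) (EdgeAvoiding-≡ {G = multigraph} {u} {v} {f} (sym eq)) f∈

  private
    vec : EdgeAvoiding multigraph u v ⊎ A ≢ B → V → ℤ₃
    vec e = δ (proj₁ (proj₁ (Multigraph.ends reduced e))) (proj₁ (proj₂ (Multigraph.ends reduced e)))

    vec-avoiders : map vec (map inj₁ (avoiders rest-avoids)) ≡ map ∂ rest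
    vec-avoiders = trans (sym (map-∘ (avoiders rest-avoids)))
      (trans (map-∘ {g = ∂} {f = proj₁} (avoiders rest-avoids)) (cong (map ∂) (avoiders-es rest-avoids)))

    vecs : map vec reducedEdges ≡ map vec (map inj₂ newEdges) ++ map ∂ rest
    vecs = trans (map-++ vec (map inj₂ newEdges) _) (cong (map vec (map inj₂ newEdges) ++_) vec-avoiders)

    -- If `a` and `b` coincide no edge is added, but `δ a a` is 0 and may be listed all the same.
    add-new : ∀ {W} → Feasible (map vec (map inj₂ newEdges) ++ W) (λ _ → 0F) → Feasible (δ a b ∷ W) (λ _ → 0F)
    add-new h with a ≟ b
    ... | yes refl = Feasible-zero (δ-loop a) h
    ... | no  _    = h

    drop-new : ∀ {W} → Feasible (δ a b ∷ W) (λ _ → 0F) → Feasible (map vec (map inj₂ newEdges) ++ W) (λ _ → 0F)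
    drop-new h with a ≟ b
    ... | yes refl = Feasible-drop-zero (δ-loop a) h
    ... | no  _    = h

    open BullVectors {u = u} {v} {w} {a} {b}

    five-edges : ∂ uv ∷ ∂ uw ∷ ∂ vw ∷ ∂ ua ∷ ∂ vb ∷ map ∂ rest ↭ map ∂ (allFin (size G))
    five-edges = map⁺ ∂ (↭-sym edges)

    rest-vanishes : ∀ p → All (λ e → ¬ Incident e p) rest → All (λ w → w p ≡ 0F) (map ∂ rest)
    rest-vanishes p = All.map⁺ ∘ All.map ∂-nonincident

    five-joins : Pointwise _≈±_ (five (map ∂ rest)) (∂ uv ∷ ∂ uw ∷ ∂ vw ∷ ∂ ua ∷ ∂ vb ∷ map ∂ rest)
    five-joins = joins-∂ uv-joins ∷ joins-∂ uw-joins ∷ joins-∂ vw-joins ∷ joins-∂ ua-joins ∷ joins-∂ vb-joins ∷ ≈±-refls _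

  ab⇒feasible : Feasible (δ a b ∷ map ∂ rest) (λ _ → 0F) → FeasibleGraph G
  ab⇒feasible h = Feasible-↭ five-edges (Feasible-cong± five-joins (ab⇒five h))

  private
    feasible⇒ab : FeasibleGraph G → Feasible (δ a b ∷ map ∂ rest) (λ _ → 0F)
    feasible⇒ab h = five⇒ab u≢v u≢w v≢w a≢u a≢v b≢u b≢v
      (rest-vanishes u (All.map proj₁ rest-avoids)) (rest-vanishes v (All.map proj₂ rest-avoids))
      (Feasible-cong± (Pointwise.symmetric ≈±-sym five-joins) (Feasible-↭ (↭-sym five-edges) h))

  module _ {H : Graph} (iso : Isomorphism (Graph.multigraph H) reduced) where
    open Isomorphism iso renaming (edges to edge-bijection)

    private
      ι : Vertex H → Vertex G
      ι = proj₁ ∘ Inverse.to vertices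
      module Emb = Embedding H ι (λ eq → ↔-injective vertices (VertexAvoiding-≡ {G = multigraph} eq))

      joins-vec : ∀ {p x y} → p ≡ (x , y) ⊎ p ≡ (y , x) →
        δ (proj₁ x) (proj₁ y) ≈± δ (proj₁ {B = λ x → x ≢ u × x ≢ v} (proj₁ p)) (proj₁ {B = λ x → x ≢ u × x ≢ v} (proj₂ p))
      joins-vec (inj₁ refl) = ≈±-refl
      joins-vec (inj₂ refl) = δ-flip

      pushed-vec : Pointwise _≈±_ (map Emb.pushed (allFin (size H))) (map vec (map (Inverse.to edge-bijection) (allFin (size H))))
      pushed-vec = Pointwise-map (λ e → joins-vec (preservesEnds e)) (allFin (size H))

      listing : map vec (map (Inverse.to edge-bijection) (allFin (size H))) ↭ map vec (map inj₂ newEdges) ++ map ∂ rest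
      listing = ↭-trans (map⁺ vec (listing-↭ edge-bijection reducedEdges-unique reducedEdges-complete)) (↭-reflexive vecs)

    reduction-feasible : FeasibleGraph G → FeasibleGraph H
    reduction-feasible h = Emb.feasible-pulled (Feasible-cong± (Pointwise.symmetric ≈±-sym pushed-vec)
      (Feasible-↭ (↭-sym listing) (drop-new (feasible⇒ab h))))

    growing-feasible : FeasibleGraph H → FeasibleGraph G
    growing-feasible h = ab⇒feasible (add-new (Feasible-↭ listing (Feasible-cong± pushed-vec (Emb.feasible-pushed h))))

    private
      count : ∀ p {k} → length (filter (λ e → incident? e p) (uv ∷ uw ∷ vw ∷ ua ∷ vb ∷ rest)) ≡ k → degree G p ≡ k
      count p eq = trans (degree-count G p) (trans (↭-length (filter-↭ (λ e → incident? e p) edges)) eq)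

    isBullReduction : H IsBullReductionOf G
    isBullReduction = record
      { u = u ; v = v ; w = w ; a = a ; b = b
      ; degree-u = count u (begin
          length (filter P (uv ∷ uw ∷ vw ∷ ua ∷ vb ∷ rest)) ≡⟨ cong length (filter-accept P (joins-incidentˡ uv-joins)) ⟩
          suc (length (filter P (uw ∷ vw ∷ ua ∷ vb ∷ rest)))  ≡⟨ cong (suc ∘ length) (filter-accept P (joins-incidentˡ uw-joins)) ⟩
          suc (suc (length (filter P (vw ∷ ua ∷ vb ∷ rest)))) ≡⟨ cong (λ xs → suc (suc (length xs))) (filter-reject P (λ i → Sum.[ u≢v , u≢w ] (joins-incident⇒ vw-joins i))) ⟩
          suc (suc (length (filter P (ua ∷ vb ∷ rest))))      ≡⟨ cong (λ xs → suc (suc (length xs))) (filter-accept P (joins-incidentˡ ua-joins)) ⟩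
          suc (suc (suc (length (filter P (vb ∷ rest)))))     ≡⟨ cong (λ xs → suc (suc (suc (length xs)))) (filter-none P
            ((λ i → Sum.[ u≢v , b≢u ∘ sym ] (joins-incident⇒ vb-joins i)) ∷ All.map proj₁ rest-avoids)) ⟩
          3 ∎)
      ; degree-v = count v (begin
          length (filter Q (uv ∷ uw ∷ vw ∷ ua ∷ vb ∷ rest)) ≡⟨ cong length (filter-accept Q (joins-incidentʳ uv-joins)) ⟩
          suc (length (filter Q (uw ∷ vw ∷ ua ∷ vb ∷ rest)))  ≡⟨ cong (suc ∘ length) (filter-reject Q (λ i → Sum.[ u≢v ∘ sym , v≢w ] (joins-incident⇒ uw-joins i))) ⟩
          suc (length (filter Q (vw ∷ ua ∷ vb ∷ rest)))       ≡⟨ cong (suc ∘ length) (filter-accept Q (joins-incidentˡ vw-joins)) ⟩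
          suc (suc (length (filter Q (ua ∷ vb ∷ rest))))      ≡⟨ cong (λ xs → suc (suc (length xs))) (filter-reject Q (λ i → Sum.[ u≢v ∘ sym , a≢v ∘ sym ] (joins-incident⇒ ua-joins i))) ⟩
          suc (suc (length (filter Q (vb ∷ rest))))           ≡⟨ cong (λ xs → suc (suc (length xs))) (filter-accept Q (joins-incidentˡ vb-joins)) ⟩
          suc (suc (suc (length (filter Q rest))))            ≡⟨ cong (λ xs → suc (suc (suc (length xs)))) (filter-none Q (All.map proj₂ rest-avoids)) ⟩
          3 ∎)
      ; u~v = uv , uv-joins
      ; u~w = uw , uw-joins
      ; v~w = vw , vw-joins
      ; u~a = ua , ua-joins
      ; v~b = vb , vb-joins
      ; a≢u = a≢u ; a≢v = a≢v ; a≢w = a≢w ; b≢u = b≢u ; b≢v = b≢v ; b≢w = b≢w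
      ; reduced = iso
      }
      where
      open ≡-Reasoning
      P : ∀ e → Dec (Incident e u)
      P e = incident? e u
      Q : ∀ e → Dec (Incident e v)
      Q e = incident? e v

  reducedGraph : ∃[ H ] order H ℕ.< order G × Isomorphism (Graph.multigraph H) reduced
  reducedGraph with split (λ x → (x ≟ u) ⊎-dec (x ≟ v)) (allFin (order G))
  ... | Y , Z , perm , Y⊆ , ¬Z =
    let H , order≡ , iso = realise reduced (enumerate vertices-unique vertices-complete)
                             (enumerate reducedEdges-unique reducedEdges-complete)
    in H , subst (ℕ._< order G) (sym order≡) smaller , iso
    where
    survivors : ∀ {xs} → All (λ x → ¬ (x ≡ u ⊎ x ≡ v)) xs → List (VertexAvoiding multigraph u v)
    survivors []       = []
    survivors (p ∷ ps) = (_ , p ∘ inj₁ , p ∘ inj₂) ∷ survivors ps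
    survivors-xs : ∀ {xs} (ps : All (λ x → ¬ (x ≡ u ⊎ x ≡ v)) xs) → map proj₁ (survivors ps) ≡ xs
    survivors-xs []       = refl
    survivors-xs (p ∷ ps) = cong (_ ∷_) (survivors-xs ps)
    vertices-unique : Unique (survivors ¬Z)
    vertices-unique = Unique-map⁻ (subst Unique (sym (survivors-xs ¬Z)) (Unique-++⁻ʳ Y (Unique-↭ perm (allFin⁺ _))))
    vertices-complete : ∀ x → x ∈ survivors ¬Z
    vertices-complete (x , x≢u , x≢v) with ∈-++⁻ Y (∈-resp-↭ perm (∈-allFin x))
    ... | inj₁ x∈Y = contradiction (All.lookup Y⊆ x∈Y) Sum.[ x≢u , x≢v ]
    ... | inj₂ x∈Z with ∈-map⁻ proj₁ (subst (x ∈_) (sym (survivors-xs ¬Z)) x∈Z)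
    ...   | y , y∈ , eq = subst (_∈ survivors ¬Z) (VertexAvoiding-≡ {G = multigraph} {u} {v} {y} (sym eq)) y∈
    -- Putting `u` back among the survivors creates no repetition, so at least one vertex has been
    -- lost.
    smaller : length (survivors ¬Z) ℕ.< order G
    smaller = subst₂ ℕ._≤_ (cong suc (trans (cong length (sym (survivors-xs ¬Z))) (length-map proj₁ (survivors ¬Z)))) (length-tabulate id)
      (unique-⊆⇒length≤ {xs = u ∷ Z} {allFin (order G)}
        (∉⇒unique (λ u∈Z → All.lookup ¬Z u∈Z (inj₁ refl)) (Unique-++⁻ʳ Y (Unique-↭ perm (allFin⁺ _))))
        λ _ → ∈-allFin _)

-- Any other edge at `x` would be a fourth one.
incident-among : ∀ (G : Graph) {x e₁ e₂ e₃ e} → degree G x ≡ 3 → Unique (e₁ ∷ e₂ ∷ e₃ ∷ []) →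
  All (λ e → Graph.Incident G e x) (e₁ ∷ e₂ ∷ e₃ ∷ []) → Graph.Incident G e x → e ∈ e₁ ∷ e₂ ∷ e₃ ∷ []
incident-among G {x} {e₁} {e₂} {e₃} {e} degree≡3 es! es∋x e∋x with Any.any? (e ≟_) (e₁ ∷ e₂ ∷ e₃ ∷ [])
... | yes e∈ = e∈
... | no  e∉ = contradiction (subst (4 ℕ.≤_) (trans (sym (degree-count G x)) degree≡3)
      (unique-⊆⇒length≤ (∉⇒unique e∉ es!) λ f∈ → ∈-filter⁺ (λ e → Graph.incident? G e x) (∈-allFin _) (All.lookup (e∋x ∷ es∋x) f∈)))
    λ { (s≤s (s≤s (s≤s ()))) }

module _ {H G : Graph} (ρ : H IsBullReductionOf G) where
  open _IsBullReductionOf_ ρ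
  open Graph G using (multigraph; Incident; Joins)
  open Trees multigraph using (Joins-sym; Joins⇒≢)
  open Bulls multigraph using (incident?; joins-incidentˡ; joins-incidentʳ; joins-incident⇒; joins-other)

  -- The adjacency witnesses are five distinct edges, three at `u` and three at `v`, with uv counted
  -- at both. Degree three makes them all the edges there, so none of them has a parallel edge.
  bullDecomposition : BullDecomposition G
  bullDecomposition with split (λ e → incident? e u ⊎-dec incident? e v) (allFin (size G))
  ... | Y , Z , perm , Y⊆ , ¬Z = record
    { u = u ; v = v ; w = w ; a = a ; b = b
    ; uv = proj₁ u~v ; uw = proj₁ u~w ; vw = proj₁ v~w ; ua = proj₁ u~a ; vb = proj₁ v~b
    ; uv-joins = proj₂ u~v ; uw-joins = proj₂ u~w ; vw-joins = proj₂ v~w ; ua-joins = proj₂ u~a ; vb-joins = proj₂ v~b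
    ; a≢u = a≢u ; a≢v = a≢v ; a≢w = a≢w ; b≢u = b≢u ; b≢v = b≢v ; b≢w = b≢w
    ; rest = Z
    ; edges = ↭-trans perm (++⁺ʳ Z (unique-same-elements⇒↭ Y! five! among five⊆Y))
    ; rest-avoids = All.map (λ ¬i → ¬i ∘ inj₁ , ¬i ∘ inj₂) ¬Z
    }
    where
    uv = proj₂ u~v
    uw = proj₂ u~w
    vw = proj₂ v~w
    ua = proj₂ u~a
    vb = proj₂ v~b
    u≢v : u ≢ v
    u≢v = Joins⇒≢ uv
    u≢w : u ≢ w
    u≢w = Joins⇒≢ uw
    v≢w : v ≢ w
    v≢w = Joins⇒≢ vw
    five : List (Edge G)
    five = proj₁ u~v ∷ proj₁ u~w ∷ proj₁ v~w ∷ proj₁ u~a ∷ proj₁ v~b ∷ []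
    different : ∀ {e f x y z} → Joins e x y → Joins f x z → y ≢ z → e ≢ f
    different j k y≢z refl = y≢z (joins-other j k)
    disjoint : ∀ {e f p q x y} → Joins e p q → Joins f x y → x ≢ p → x ≢ q → e ≢ f
    disjoint j k x≢p x≢q refl = Sum.[ x≢p , x≢q ] (joins-incident⇒ j (joins-incidentˡ k))
    five! : Unique five
    five! = (different uv uw v≢w ∷ different (Joins-sym uv) vw u≢w ∷ different uv ua (a≢v ∘ sym) ∷ different (Joins-sym uv) vb (b≢u ∘ sym) ∷ [])
      ∷ (different (Joins-sym uw) (Joins-sym vw) u≢v ∷ different uw ua (a≢w ∘ sym) ∷ disjoint uw vb (u≢v ∘ sym) v≢w ∷ [])
      ∷ (disjoint vw ua u≢v u≢w ∷ different vw vb (b≢w ∘ sym) ∷ [])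
      ∷ (disjoint ua vb (u≢v ∘ sym) (a≢v ∘ sym) ∷ [])
      ∷ [] ∷ []
    Y! : Unique Y
    Y! = Unique-++⁻ˡ Y (Unique-↭ perm (allFin⁺ _))
    among-u : ∀ {e} → e ∈ proj₁ u~v ∷ proj₁ u~w ∷ proj₁ u~a ∷ [] → e ∈ five
    among-u (here p)                 = here p
    among-u (there (here p))         = there (here p)
    among-u (there (there (here p))) = there (there (there (here p)))
    among-v : ∀ {e} → e ∈ proj₁ u~v ∷ proj₁ v~w ∷ proj₁ v~b ∷ [] → e ∈ five
    among-v (here p)                 = here p
    among-v (there (here p))         = there (there (here p))
    among-v (there (there (here p))) = there (there (there (there (here p))))
    among : ∀ {e} → e ∈ Y → e ∈ five
    among e∈ with All.lookup Y⊆ e∈ | five!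
    ... | inj₁ i | (p ∷ _ ∷ q ∷ _) ∷ (_ ∷ r ∷ _) ∷ _ = among-u (incident-among G degree-u
          ((p ∷ q ∷ []) ∷ (r ∷ []) ∷ [] ∷ []) (joins-incidentˡ uv ∷ joins-incidentˡ uw ∷ joins-incidentˡ ua ∷ []) i)
    ... | inj₂ i | (_ ∷ p ∷ _ ∷ q ∷ _) ∷ _ ∷ (_ ∷ r ∷ _) ∷ _ = among-v (incident-among G degree-v
          ((p ∷ q ∷ []) ∷ (r ∷ []) ∷ [] ∷ []) (joins-incidentʳ uv ∷ joins-incidentˡ vw ∷ joins-incidentˡ vb ∷ []) i)
    five-incident : All (λ e → Incident e u ⊎ Incident e v) five
    five-incident = inj₁ (joins-incidentˡ uv) ∷ inj₁ (joins-incidentˡ uw) ∷ inj₂ (joins-incidentˡ vw)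
      ∷ inj₁ (joins-incidentˡ ua) ∷ inj₂ (joins-incidentˡ vb) ∷ []
    five⊆Y : ∀ {e} → e ∈ five → e ∈ Y
    five⊆Y e∈ with ∈-++⁻ Y (∈-resp-↭ perm (∈-allFin _))
    ... | inj₁ e∈Y = e∈Y
    ... | inj₂ e∈Z = contradiction (All.lookup five-incident e∈) (All.lookup ¬Z e∈Z)

  reduction-feasible : FeasibleGraph G → FeasibleGraph H
  reduction-feasible = Reduce.reduction-feasible bullDecomposition reduced

-- Spanning triangle-trees and K₄

open Graph using (multigraph)

module _ {V E V′ E′ : Set} {G : Multigraph V E} {M : Multigraph V′ E′} (iso : Isomorphism G M) where
  open Isomorphism iso
  private
    module G = Multigraph G
    module M = Multigraph M

  joins-from : ∀ {e x y} → M.Joins e x y →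
    G.Joins (Inverse.from edges e) (Inverse.from vertices x) (Inverse.from vertices y)
  joins-from {e} {x} {y} j = go j (subst (λ f → M.Joins f _ _) (Inverse.strictlyInverseˡ edges e) (preservesEnds (Inverse.from edges e)))
    where
    t h : V
    t = proj₁ (G.ends (Inverse.from edges e))
    h = proj₂ (G.ends (Inverse.from edges e))
    back : ∀ {p x} → Inverse.to vertices p ≡ x → p ≡ Inverse.from vertices x
    back {p} refl = sym (Inverse.strictlyInverseʳ vertices p)
    go : M.Joins e x y → M.Joins e (Inverse.to vertices t) (Inverse.to vertices h) →
      G.Joins (Inverse.from edges e) (Inverse.from vertices x) (Inverse.from vertices y)
    go (inj₁ p) (inj₁ q) with eq ← trans (sym q) p = inj₁ (cong₂ _,_ (back (cong proj₁ eq)) (back (cong proj₂ eq)))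
    go (inj₁ p) (inj₂ q) with eq ← trans (sym q) p = inj₂ (cong₂ _,_ (back (cong proj₂ eq)) (back (cong proj₁ eq)))
    go (inj₂ p) (inj₁ q) with eq ← trans (sym q) p = inj₂ (cong₂ _,_ (back (cong proj₁ eq)) (back (cong proj₂ eq)))
    go (inj₂ p) (inj₂ q) with eq ← trans (sym q) p = inj₁ (cong₂ _,_ (back (cong proj₂ eq)) (back (cong proj₁ eq)))

↔-swap : ∀ {A B : Set} → A ↔ B → B ↔ A
↔-swap β = mk↔ₛ′ (Inverse.from β) (Inverse.to β) (Inverse.strictlyInverseʳ β) (Inverse.strictlyInverseˡ β)

Isomorphism-sym : ∀ {V E V′ E′ : Set} {G : Multigraph V E} {M : Multigraph V′ E′} → Isomorphism G M → Isomorphism M G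
Isomorphism-sym iso = record
  { vertices = ↔-swap (Isomorphism.vertices iso)
  ; edges = ↔-swap (Isomorphism.edges iso)
  ; preservesEnds = λ e → joins-from iso (inj₁ refl)
  }

≅-feasible : ∀ G H → G ≅ H → FeasibleGraph G → FeasibleGraph H
≅-feasible G H iso h = Feasible-↭
    (map⁺ (Trees.∂ (multigraph H)) (listing-↭ edges (allFin⁺ _) ∈-allFin))
    (Feasible-cong± (Pointwise-map (λ e → joins-∂ (preservesEnds e)) (allFin (size G)))
      (Embedding.feasible-pushed G (Inverse.to vertices) (↔-injective vertices) h))
  where
  open Isomorphism iso
  open Trees (multigraph H) using (joins-∂)

sign? : ∀ {P : Sign → Set} → (∀ s → Dec (P s)) → Dec (∃[ s ] P s)
sign? P? with P? pos | P? neg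
... | yes p | _     = yes (pos , p)
... | no _  | yes p = yes (neg , p)
... | no ¬p | no ¬q = no λ { (pos , p) → ¬p p ; (neg , q) → ¬q q }

feasible? : ∀ {n} (W : List (Fin n → ℤ₃)) β → Dec (Feasible W β)
feasible? []      β = all? λ x → β x ≟ 0F
feasible? (w ∷ W) β = sign? λ s → feasible? W _

opaque
  unfolding δ

  -- Exhaustive evaluation of the 64 sign choices, for which `δ` has to compute. Conceptually, the
  -- three outward signs at a cubic vertex must agree, which would split the vertices into two
  -- classes with every edge between them, and `K₄` is not bipartite.
  K₄-infeasible : ¬ FeasibleGraph K₄
  K₄-infeasible = from-no (feasible? (map (Trees.∂ (multigraph K₄)) (allFin 6)) (λ _ → 0F))

module SpanningTrees {n m : ℕ} (G : Multigraph (Fin n) (Fin m)) where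
  open Multigraph G
  open Trees G
  open Bulls G using (joins-incident⇒; joins-incidentˡ; joins-other)

  triangleTree⇒tree : ∀ {T} → TriangleTree T → (φ : Vertex T → V) (ψ : Edge T → Fin m) →
    (∀ {x y} → φ x ≡ φ y → x ≡ y) → PreservesEnds (multigraph T) G φ ψ →
    Tree (tabulate ψ) (tabulate φ)
  triangleTree⇒tree triangle φ ψ φ-injective joins =
    -- Vertex 0 of `K₃` is attached to the opposite edge, which has index 2.
    attach (edge (joins 2F)) (here refl) (joins 2F) (joins 0F) (joins 1F) λ φ0∈ →
      case φ-injective (proj₂ (∈-tabulate⁻ {f = φ ∘ suc} φ0∈)) of λ ()
  triangleTree⇒tree (attach T f) φ ψ φ-injective joins =
    attach (triangleTree⇒tree T (φ ∘ suc) (λ e → ψ (suc (suc e))) (λ eq → case φ-injective eq of λ { refl → refl }) (λ e → joins (suc (suc e))))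
      (∈-tabulate⁺ f) (joins (suc (suc f))) (joins 0F) (joins 1F) λ φ0∈ →
      case φ-injective (proj₂ (∈-tabulate⁻ {f = φ ∘ suc} φ0∈)) of λ ()

  -- Edges are matched only up to order: `attachTriangle` lists the new edges according to the
  -- stored ends of the base, which a `Tree` may traverse the other way round.
  record Realisation (A : List (Fin m)) (S : List V) : Set where
    field
      {T}        : Graph
      isTree     : TriangleTree T
      vertexMap  : Vertex T → V
      edgeMap    : Edge T → Fin m
      vertices≡  : tabulate vertexMap ≡ S
      edges↭     : tabulate edgeMap ↭ A
      joins      : PreservesEnds (multigraph T) G vertexMap edgeMap

  joins-ends : ∀ {e x y p q} → Joins e x y → Joins e p q → (x ≡ p × y ≡ q) ⊎ (x ≡ q × y ≡ p)
  joins-ends (inj₁ p) (inj₁ q) with refl ← trans (sym p) q = inj₁ (refl , refl)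
  joins-ends (inj₁ p) (inj₂ q) with refl ← trans (sym p) q = inj₂ (refl , refl)
  joins-ends (inj₂ p) (inj₁ q) with refl ← trans (sym p) q = inj₂ (refl , refl)
  joins-ends (inj₂ p) (inj₂ q) with refl ← trans (sym p) q = inj₁ (refl , refl)

  attachRealisation : ∀ {A S f e₁ e₂ x y z} → Realisation A S → f ∈ A → Joins f y z → Joins e₁ x y → Joins e₂ x z →
    Realisation (e₁ ∷ e₂ ∷ A) (x ∷ S)
  attachRealisation {A} {S} {f} {e₁} {e₂} {x} ρ f∈ j j₁ j₂ = build (∈-tabulate⁻ (∈-resp-↭ (↭-sym edges↭) f∈))
    where
    open Realisation ρ
    build : (∃[ i ] f ≡ edgeMap i) → Realisation (e₁ ∷ e₂ ∷ A) (x ∷ S)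
    build (i , refl) = go (joins-ends j (joins i))
      where
      attachOn : ∀ {e₁ e₂} → Joins e₁ x (vertexMap (proj₁ (Graph.ends T i))) → Joins e₂ x (vertexMap (proj₂ (Graph.ends T i))) →
        ∀ {B} → e₁ ∷ e₂ ∷ A ↭ B → Realisation B (x ∷ S)
      attachOn {e₁} {e₂} j₁ j₂ perm = record
        { isTree = attach isTree i
        ; vertexMap = λ { zero → x ; (suc v) → vertexMap v }
        ; edgeMap = λ { zero → e₁ ; (suc zero) → e₂ ; (suc (suc e)) → edgeMap e }
        ; vertices≡ = cong (x ∷_) vertices≡
        ; edges↭ = ↭-trans (↭-prep e₁ (↭-prep e₂ edges↭)) perm
        ; joins = λ { zero → j₁ ; (suc zero) → j₂ ; (suc (suc e)) → joins e } }
      go : _ ⊎ _ → Realisation (e₁ ∷ e₂ ∷ A) (x ∷ S)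
      go (inj₁ (refl , refl)) = attachOn j₁ j₂ ↭-refl
      go (inj₂ (refl , refl)) = attachOn j₂ j₁ (↭-swap e₂ e₁ ↭-refl)

  -- The bound excludes the single edge, which is a `Tree` but not a `TriangleTree`.
  tree⇒triangleTree : ∀ {A S} → Tree A S → 3 ℕ.≤ length S → Realisation A S
  tree⇒triangleTree (edge _) (s≤s (s≤s ()))
  tree⇒triangleTree (attach {f = f} {e₁ = e₁} {x} {e₂} (edge {y = y} {z} j₀) (here refl) j j₁ j₂ x∉) _ = build (joins-ends j j₀)
    where
    triangleOn : ∀ {e₁ e₂} → Joins e₁ x y → Joins e₂ x z → ∀ {A} → e₁ ∷ e₂ ∷ f ∷ [] ↭ A → Realisation A (x ∷ y ∷ z ∷ [])
    triangleOn {e₁} {e₂} j₁ j₂ perm = record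
      { isTree = triangle
      ; vertexMap = λ { 0F → x ; 1F → y ; 2F → z }
      ; edgeMap = λ { 0F → e₁ ; 1F → e₂ ; 2F → f }
      ; vertices≡ = refl ; edges↭ = perm
      ; joins = λ { 0F → j₁ ; 1F → j₂ ; 2F → j₀ } }
    build : _ ⊎ _ → Realisation (e₁ ∷ e₂ ∷ f ∷ []) (x ∷ y ∷ z ∷ [])
    build (inj₁ (refl , refl)) = triangleOn j₁ j₂ ↭-refl
    build (inj₂ (refl , refl)) = triangleOn j₂ j₁ (↭-swap e₂ e₁ ↭-refl)
  tree⇒triangleTree (attach T@(attach T′ _ _ _ _ _) f∈ j j₁ j₂ _) _ =
    attachRealisation (tree⇒triangleTree T (s≤s (Tree-length T′))) f∈ j j₁ j₂

module _ (G : Graph) where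
  open Graph G hiding (order; size; Vertex; Edge; degree; multigraph; incident?)
  open Trees (multigraph G)
  open Bulls (multigraph G) using (joins-incidentˡ; joins-incidentʳ; joins-incident⇒; incident⇒joins; ∂-incident; All-Balanced-∂)
  open SpanningTrees (multigraph G)

  open FindBull (multigraph G) (allFin (size G)) using (Bull; peel)

  findBull : HasSpanningTriangleTree G → ¬ FeasibleGraph G → Bull
  findBull (T , isTree , S) infeasible
    with split (λ e → Any.any? (e ≟_) (tabulate (IsSpanningSubgraph.edgeMap S))) (allFin (size G))
  ... | Y , Z , perm , Y⊆ , ¬Z = peel infeasible {X = Z}
      (triangleTree⇒tree isTree vertexMap edgeMap (proj₁ vertexBijective) preservesEnds) [] []
      (tabulate⁺ (proj₁ vertexBijective)) full
      (↭-trans perm (↭-trans (++⁺ʳ Z Y↭) (++-comm (tabulate edgeMap) Z)))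
      (subst (3 ℕ.≤_) (sym (length-tabulate vertexMap)) (order≥3 isTree))
    where
    open IsSpanningSubgraph S
    order≥3 : ∀ {T} → TriangleTree T → 3 ℕ.≤ order T
    order≥3 triangle     = ℕ.≤-refl
    order≥3 (attach T _) = ℕ.m≤n⇒m≤1+n (order≥3 T)
    full : ∀ x → x ∈ tabulate vertexMap
    full x with proj₂ vertexBijective x
    ... | y , eq = subst (_∈ tabulate vertexMap) (eq refl) (∈-tabulate⁺ y)
    in-Y : ∀ {e} → e ∈ tabulate edgeMap → e ∈ Y
    in-Y {e} e∈ with ∈-++⁻ Y (∈-resp-↭ perm (∈-allFin e))
    ... | inj₁ e∈Y = e∈Y
    ... | inj₂ e∈Z = contradiction e∈ (All.lookup ¬Z e∈Z)
    Y↭ : Y ↭ tabulate edgeMap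
    Y↭ = unique-same-elements⇒↭ (Unique-++⁻ˡ Y (Unique-↭ perm (allFin⁺ _))) (tabulate⁺ edgeInjective)
      (All.lookup Y⊆) in-Y

  module _ (bull : Bull) where
    open Bull bull

    private
      u∉ : u ∉ treeVertices
      u∉ = Unique[x∷xs]⇒x∉xs unique ∘ there
      v∉ : v ∉ treeVertices
      v∉ with unique
      ... | _ ∷ unique′ = Unique[x∷xs]⇒x∉xs unique′

      misses : ∀ {p} → p ∉ treeVertices → ∀ {e} → Inside treeVertices e → ¬ Incident e p
      misses p∉ (s∈ , t∈) = Sum.[ (λ { refl → p∉ s∈ }) , (λ { refl → p∉ t∈ }) ]

      apart : ∀ {x p} → x ∈ treeVertices → p ∉ treeVertices → x ≢ p
      apart x∈ p∉ refl = p∉ x∈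

    decomposition : BullDecomposition G
    decomposition = record
      { u = u ; v = v ; w = w ; a = a ; b = b ; uv = uv ; uw = uw ; vw = vw ; ua = ua ; vb = vb
      ; uv-joins = uv-joins ; uw-joins = uw-joins ; vw-joins = vw-joins ; ua-joins = ua-joins ; vb-joins = vb-joins
      ; a≢u = apart a∈ u∉ ; a≢v = apart a∈ v∉ ; a≢w = a≢w
      ; b≢u = apart b∈ u∉ ; b≢v = apart b∈ v∉ ; b≢w = b≢w
      ; rest = treeEdges ++ rest
      ; edges = edges
      ; rest-avoids = All.++⁺ (All.tabulate λ e∈ → misses u∉ (Tree-inside tree e∈) , misses v∉ (Tree-inside tree e∈)) rest-avoids
      }

    -- The tree recorded with the bull meets neither `u` nor `v`, so its edges survive the deletion
    -- and map to `inj₁`; it covers every other vertex, hence spans.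
    spanningTree : 3 ℕ.≤ length treeVertices → ∀ {H} →
      Isomorphism (multigraph H) (Reduce.reduced decomposition) → HasSpanningTriangleTree H
    spanningTree 3≤ {H} iso = T , isTree , record
      { vertexMap = Inverse.from vertices ∘ vertex
      ; edgeMap = Inverse.from edges′ ∘ edge′
      ; vertexBijective = injective , surjective
      ; edgeInjective = λ eq → tabulate-injective edgeMap (Unique-↭ (↭-sym edges↭) treeEdges!)
          (cong proj₁ (inj₁-injective (↔-injective (↔-swap edges′) eq)))
      ; preservesEnds = λ e → joins-from iso (lift {e∌ = misses u∉ (inside e) , misses v∉ (inside e)} (joins e))
      }
      where
      open Realisation (tree⇒triangleTree tree 3≤)
      open Isomorphism iso renaming (edges to edges′)
      tabulate-injective : ∀ {A : Set} {k} (f : Fin k → A) → Unique (tabulate f) → ∀ {i j} → f i ≡ f j → i ≡ j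
      tabulate-injective f _ {zero} {zero} _ = refl
      tabulate-injective f f! {zero} {suc j} eq = contradiction (subst (_∈ tabulate (f ∘ suc)) (sym eq) (∈-tabulate⁺ j)) (Unique[x∷xs]⇒x∉xs f!)
      tabulate-injective f f! {suc i} {zero} eq = contradiction (subst (_∈ tabulate (f ∘ suc)) eq (∈-tabulate⁺ i)) (Unique[x∷xs]⇒x∉xs f!)
      tabulate-injective f (_ ∷ f!) {suc i} {suc j} eq = cong suc (tabulate-injective (f ∘ suc) f! eq)
      in-tree : ∀ i → vertexMap i ∈ treeVertices
      in-tree i = subst (vertexMap i ∈_) vertices≡ (∈-tabulate⁺ i)
      vertex : Vertex T → VertexAvoiding (multigraph G) u v
      vertex i = vertexMap i , apart (in-tree i) u∉ , apart (in-tree i) v∉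
      inside : ∀ e → Inside treeVertices (edgeMap e)
      inside e = Tree-inside tree (∈-resp-↭ edges↭ (∈-tabulate⁺ e))
      edge′ : Edge T → EdgeAvoiding (multigraph G) u v ⊎ Reduce.A decomposition ≢ Reduce.B decomposition
      edge′ e = inj₁ (edgeMap e , misses u∉ (inside e) , misses v∉ (inside e))
      treeVertices! : Unique (tabulate vertexMap)
      treeVertices! = subst Unique (sym vertices≡) (Tree-unique tree)
      treeEdges! : Unique treeEdges
      treeEdges! with Unique-↭ edges (allFin⁺ (size G))
      ... | _ ∷ _ ∷ _ ∷ _ ∷ _ ∷ es! = Unique-++⁻ˡ treeEdges es!
      injective : Injective _≡_ _≡_ (Inverse.from vertices ∘ vertex)
      injective eq = tabulate-injective vertexMap treeVertices! (cong proj₁ (↔-injective (↔-swap vertices) eq))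
      survivor : ∀ (x : VertexAvoiding (multigraph G) u v) → ∃[ i ] vertex i ≡ x
      survivor (x , x≢u , x≢v) with full x
      ... | here x≡u           = contradiction x≡u x≢u
      ... | there (here x≡v)   = contradiction x≡v x≢v
      ... | there (there x∈)   with ∈-tabulate⁻ (subst (x ∈_) (sym vertices≡) x∈)
      ...   | i , x≡ = i , VertexAvoiding-≡ {G = multigraph G} (sym x≡)
      surjective : ∀ y → ∃[ i ] (∀ {j} → j ≡ i → Inverse.from vertices (vertex j) ≡ y)
      surjective y with survivor (Inverse.to vertices y)
      ... | i , eq = i , λ { refl → trans (cong (Inverse.from vertices) eq) (Inverse.strictlyInverseʳ vertices y) }
      lift : ∀ {e e∌ x y} {p : x ≢ u × x ≢ v} {q : y ≢ u × y ≢ v} → Joins e x y →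
        Multigraph.Joins (Reduce.reduced decomposition) (inj₁ (e , e∌)) (x , p) (y , q)
      lift (inj₁ eq) = inj₁ (cong₂ _,_ (VertexAvoiding-≡ {G = multigraph G} (cong proj₁ eq)) (VertexAvoiding-≡ {G = multigraph G} (cong proj₂ eq)))
      lift (inj₂ eq) = inj₂ (cong₂ _,_ (VertexAvoiding-≡ {G = multigraph G} (cong proj₁ eq)) (VertexAvoiding-≡ {G = multigraph G} (cong proj₂ eq)))

  module _ (D : BullDecomposition G) where
    open BullDecomposition D

    -- On the vertices u, v, w, a alone, every further edge is parallel to wa,
    -- and two such edges can be balanced against each other.
    four-vertices : ¬ FeasibleGraph G → a ≡ b → ∀ {f es} → rest ≡ f ∷ es → Joins f w a →
      Unique (u ∷ v ∷ w ∷ a ∷ []) → (∀ x → x ∈ u ∷ v ∷ w ∷ a ∷ []) → G ≅ K₄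
    four-vertices _ a≡b {f} {[]} rest≡ f-joins vertices! full = Isomorphism-sym record
      { vertices = enumerate vertices! full
      ; edges = enumerate (Unique-↭ order-edges (allFin⁺ _)) (λ e → ∈-resp-↭ order-edges (∈-allFin e))
      ; preservesEnds = λ { 0F → uv-joins ; 1F → uw-joins ; 2F → ua-joins ; 3F → vw-joins
                          ; 4F → subst (Joins vb v) (sym a≡b) vb-joins ; 5F → f-joins }
      }
      where
      order-edges : allFin (size G) ↭ uv ∷ uw ∷ ua ∷ vw ∷ vb ∷ f ∷ []
      order-edges = ↭-trans edges (↭-trans (↭-reflexive (cong (λ es → uv ∷ uw ∷ vw ∷ ua ∷ vb ∷ es) rest≡))
        (↭-prep uv (↭-prep uw (↭-swap vw ua ↭-refl))))
    four-vertices infeasible a≡b {f} {e ∷ es} rest≡ f-joins vertices! full = contradiction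
      -- As `a` equals `b`, the vector that stands for the bull is 0, and only the edges between `w`
      -- and `a` have to be signed.
      (Reduce.ab⇒feasible D (Feasible-zero δ≡0
        (subst (λ es → Feasible (map ∂ es) (λ _ → 0F)) (sym rest≡)
          (Feasible-↭ (++-comm (map ∂ (f ∷ e ∷ es)) [])
            (steer {x = w} {[]} (s≤s (s≤s z≤n)) (All-Balanced-∂ wa! (All.tabulate inside))
              (All.map⁺ (All.tabulate λ e∈ → ∂-incident (at-w (inside e∈))))
              (λ γ b γw → Balanced-singleton (Balanced-tail b γw)) _ (Balanced-0 _))))))
      infeasible
      where
      δ≡0 : ∀ x → δ a b x ≡ 0F
      δ≡0 x = trans (cong (λ b → δ a b x) (sym a≡b)) (δ-loop a x)
      wa! : Unique (w ∷ a ∷ [])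
      wa! = drop⁺ 2 vertices!
      inside : ∀ {g} → g ∈ f ∷ e ∷ es → Inside (w ∷ a ∷ []) g
      inside {g} g∈ = place (full _) (g∌u ∘ inj₁) (g∌v ∘ inj₁) , place (full _) (g∌u ∘ inj₂) (g∌v ∘ inj₂)
        where
        g∌u : ¬ Incident g u
        g∌u = proj₁ (All.lookup rest-avoids (subst (g ∈_) (sym rest≡) g∈))
        g∌v : ¬ Incident g v
        g∌v = proj₂ (All.lookup rest-avoids (subst (g ∈_) (sym rest≡) g∈))
        place : ∀ {x} → x ∈ u ∷ v ∷ w ∷ a ∷ [] → x ≢ u → x ≢ v → x ∈ w ∷ a ∷ []
        place (here x≡u)         x≢u _   = contradiction x≡u x≢u
        place (there (here x≡v)) _   x≢v = contradiction x≡v x≢v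
        place (there (there x∈)) _   _   = x∈
      at-w : ∀ {g} → Inside (w ∷ a ∷ []) g → Incident g w
      at-w (here s≡w , _)                            = inj₁ s≡w
      at-w (there (here _) , here t≡w)               = inj₂ t≡w
      at-w {g} (there (here s≡a) , there (here t≡a)) = contradiction (trans s≡a (sym t≡a)) (loopless g)

  -- A tree on two vertices is one edge. As `a` and `b` differ from the end `w`, both are the other
  -- end, and `u`, `v`, `w`, `a` are all the vertices.
  small-bull⇒K₄ : ¬ FeasibleGraph G → (bull : Bull) → length (Bull.treeVertices bull) ℕ.≤ 2 → G ≅ K₄
  small-bull⇒K₄ infeasible record { tree = attach T _ _ _ _ _ } ≤2 = contradiction ≤2 (ℕ.<⇒≱ (s≤s (Tree-length T)))
  small-bull⇒K₄ infeasible bull@record { tree = edge {f} {y} {z} j } _ = locate (Bull.w∈ bull) (Bull.a∈ bull) (Bull.b∈ bull)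
    where
    open Bull bull
    reorder : ∀ {x x′} → y ∷ z ∷ [] ↭ x ∷ x′ ∷ [] → w ≡ x → a ≡ x′ → u ∷ v ∷ y ∷ z ∷ [] ↭ u ∷ v ∷ w ∷ a ∷ []
    reorder p refl refl = ↭-prep _ (↭-prep _ p)
    finish : u ∷ v ∷ y ∷ z ∷ [] ↭ u ∷ v ∷ w ∷ a ∷ [] → a ≡ b → Joins f w a → G ≅ K₄
    finish p a≡b f-joins = four-vertices (decomposition bull) infeasible a≡b refl f-joins
      (Unique-↭ p unique) (λ x → ∈-resp-↭ p (full x))
    locate : w ∈ y ∷ z ∷ [] → a ∈ y ∷ z ∷ [] → b ∈ y ∷ z ∷ [] → G ≅ K₄
    locate (here w≡) (here a≡) _ = contradiction (trans a≡ (sym w≡)) a≢w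
    locate (here w≡) _ (here b≡) = contradiction (trans b≡ (sym w≡)) b≢w
    locate (here w≡) (there (here a≡)) (there (here b≡)) =
      finish (reorder ↭-refl w≡ a≡) (trans a≡ (sym b≡)) (subst₂ (Joins f) (sym w≡) (sym a≡) j)
    locate (there (here w≡)) (there (here a≡)) _ = contradiction (trans a≡ (sym w≡)) a≢w
    locate (there (here w≡)) _ (there (here b≡)) = contradiction (trans b≡ (sym w≡)) b≢w
    locate (there (here w≡)) (here a≡) (here b≡) =
      finish (reorder (↭-swap y z ↭-refl) w≡ a≡) (trans a≡ (sym b≡)) (subst₂ (Joins f) (sym w≡) (sym a≡) (Joins-sym j))

  -- The size of the tree beside the bull decides: two vertices give `K₄`, three or more give a
  -- spanning triangle-tree of the reduction. The reduction stays infeasible because signs for it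
  -- would extend to the five edges of the bull.
  infeasible⇒K₄⊎reduction : HasSpanningTriangleTree G → ¬ FeasibleGraph G →
    G ≅ K₄ ⊎ ∃[ H ] (order H ℕ.< order G × H IsBullReductionOf G × HasSpanningTriangleTree H × ¬ FeasibleGraph H)
  infeasible⇒K₄⊎reduction spanning infeasible with findBull spanning infeasible
  ... | bull with length (Bull.treeVertices bull) ℕ.≤? 2
  ...   | yes ≤2 = inj₁ (small-bull⇒K₄ infeasible bull ≤2)
  ...   | no  ≰2 with Reduce.reducedGraph (decomposition bull)
  ...     | H , smaller , iso = inj₂ (H , smaller , Reduce.isBullReduction (decomposition bull) iso
          , spanningTree bull (ℕ.≰⇒> ≰2) {H} iso , infeasible ∘ Reduce.growing-feasible (decomposition bull) iso)

-- The two characterisations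

≅K₄⇒infeasible : ∀ G → G ≅ K₄ → ¬ FeasibleGraph G
≅K₄⇒infeasible G iso = K₄-infeasible ∘ ≅-feasible G K₄ iso

formed⇒infeasible : ∀ {G} → FormedFromK₄ G → ¬ FeasibleGraph G
formed⇒infeasible (K , iso , series) = follow series (≅K₄⇒infeasible K iso)
  where
  follow : ∀ {K G} → Star _IsBullReductionOf_ K G → ¬ FeasibleGraph K → ¬ FeasibleGraph G
  follow ε        infeasible = infeasible
  follow (ρ ◅ ρs) infeasible = follow ρs (infeasible ∘ reduction-feasible ρ)

-- Well-founded recursion on the order, since a bull-reduction has fewer vertices. The reduction
-- just found becomes the last growing operation of the series.
infeasible⇒formed : ∀ G → Acc ℕ._<_ (order G) → HasSpanningTriangleTree G → ¬ FeasibleGraph G → FormedFromK₄ G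
infeasible⇒formed G (acc rec) spanning infeasible with infeasible⇒K₄⊎reduction G spanning infeasible
... | inj₁ iso = G , iso , ε
... | inj₂ (H , smaller , ρ , spanning′ , infeasible′) with infeasible⇒formed H (rec smaller) spanning′ infeasible′
...   | K , iso , series = K , iso , series ◅◅ ρ ◅ ε

theorem1p6 : (G : Graph) → HasSpanningTriangleTree G →
    ((¬ NowhereZero3Flow G) ⇔
    (G ≅ K₄ ⊎ (∃[ G₁ ] (G IsBullGrowingOf G₁ × HasSpanningTriangleTree G₁ × ¬ NowhereZero3Flow G₁))))
    × ((¬ NowhereZero3Flow G) ⇔ FormedFromK₄ G)
theorem1p6 G spanning =
  mk⇔ (λ noFlow → Sum.map id (λ (H , _ , ρ , spanning′ , infeasible) → H , ρ , spanning′ , infeasible ∘ flow⇒feasible H)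
         (infeasible⇒K₄⊎reduction G spanning (noFlow ∘ feasible⇒flow G)))
      Sum.[ (λ iso → ≅K₄⇒infeasible G iso ∘ flow⇒feasible G)
           , (λ (H , ρ , _ , noFlow) → noFlow ∘ feasible⇒flow H ∘ reduction-feasible ρ ∘ flow⇒feasible G) ]
  , mk⇔ (λ noFlow → infeasible⇒formed G (<-wellFounded (order G)) spanning (noFlow ∘ feasible⇒flow G))
        (λ formed → formed⇒infeasible formed ∘ flow⇒feasible G)
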